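{- Suppose $1/n\ll1/K\ll\lambda\ll\alpha$. If $G$ is a digraph of order $(1+\alpha)n$ with $\delta^0(G)\ge(1/2+\alpha)n$, then $G$ contains every oriented tree $T$ of order $n$ with $\Delta(T)\le n^{(K\log n)^{ -1/2}}$.
   Context: Hierarchy notation: $a\ll b$ means for every $b>0$ there is $a_0>0$ such that the statement holds for all $0<a<a_0$; for chains the constants are chosen right to left; $1/n\ll\cdot$ means $n$ sufficiently large. $\log$ is the natural logarithm. A digraph has no loops and at most one edge in each direction; $\delta^0(G)$ is the minimum over vertices of the minimum of in- and outdegree. An oriented tree is an orientation of a tree; $\Delta(T)$ is the maximum degree of the underlying tree. "$G$ contains $T$" means $G$ has a subdigraph isomorphic to $T$. -}

module Defs where

open import Data.Nat as ℕ using (ℕ; zero; suc; _+_; _*_; _^_; _≤_; _<_; _⊔_)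
open import Data.Fin using (Fin; zero; suc)
open import Data.Bool using (Bool; true; false; _∨_; T)
open import Data.List using (List; []; _∷_)
open import Data.List.Relation.Unary.Unique.Propositional using (Unique)
open import Data.Product using (Σ; ∃; _×_; _,_)
open import Data.Empty using (⊥)
open import Relation.Binary.PropositionalEquality using (_≡_)
open import Relation.Nullary using (¬_)
open import Function.Definitions using (Injective)
open import Data.Integer using (+_)
open import Data.Rational as ℚ using (ℚ)

ℕtoℚ : ℕ → ℚ
ℕtoℚ n = (+ n) ℚ./ 1

count : ∀ {N} → (Fin N → Bool) → ℕ
count {zero} f = 0
count {suc N} f = (if' (f zero)) + count (λ i → f (suc i))
  where
  if' : Bool → ℕ
  if' true = 1
  if' false = 0

maxF : ∀ {N} → (Fin N → ℕ) → ℕ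
maxF {zero} f = 0
maxF {suc N} f = f zero ⊔ maxF (λ i → f (suc i))

record Digraph (N : ℕ) : Set where
  field
    E     : Fin N → Fin N → Bool
    loopless : ∀ v → E v v ≡ false
open Digraph public

outdeg indeg : ∀ {N} → Digraph N → Fin N → ℕ
outdeg G v = count (λ u → E G v u)
indeg  G v = count (λ u → E G u v)

MinSemidegreeAtLeast : ∀ {N} → Digraph N → ℚ → Set
MinSemidegreeAtLeast G x =
  ∀ v → (x ℚ.≤ ℕtoℚ (outdeg G v)) × (x ℚ.≤ ℕtoℚ (indeg G v))

UAdj : ∀ {n} → Digraph n → Fin n → Fin n → Bool
UAdj G u v = E G u v ∨ E G v u

data UWalk {n} (G : Digraph n) : List (Fin n) → Set where
  single : ∀ v → UWalk G (v ∷ [])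
  step   : ∀ u v vs → T (UAdj G u v) → UWalk G (v ∷ vs) → UWalk G (u ∷ v ∷ vs)

data EndsAt {n} : List (Fin n) → Fin n → Set where
  here  : ∀ v → EndsAt (v ∷ []) v
  there : ∀ u {vs v} → EndsAt vs v → EndsAt (u ∷ vs) v

Connected : ∀ {n} → Digraph n → Set
Connected {n} G = ∀ (u v : Fin n) →
  ∃ λ ws → UWalk G (u ∷ ws) × EndsAt (u ∷ ws) v

HasCycle : ∀ {n} → Digraph n → Set
HasCycle {n} G = Σ (Fin n) λ v₀ → Σ (Fin n) λ v₁ → Σ (List (Fin n)) λ ws →
  Σ (Fin n) λ vk →
    UWalk G (v₀ ∷ v₁ ∷ ws) × Unique (v₀ ∷ v₁ ∷ ws) ×
    EndsAt (v₀ ∷ v₁ ∷ ws) vk × ¬ (vk ≡ v₁) × T (UAdj G vk v₀)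

record OrientedTree (n : ℕ) : Set where
  field
    graph      : Digraph n
    oriented   : ∀ u v → T (E graph u v) → E graph v u ≡ false
    connected  : Connected graph
    acyclic    : ¬ HasCycle graph
open OrientedTree public

udeg : ∀ {n} → Digraph n → Fin n → ℕ
udeg G v = count (λ u → UAdj G v u)

Δ : ∀ {n} → OrientedTree n → ℕ
Δ T' = maxF (udeg (graph T'))

Contains : ∀ {N n} → Digraph N → OrientedTree n → Set
Contains {N} {n} G T' = Σ (Fin n → Fin N) λ f →
  Injective _≡_ _≡_ f × (∀ u v → T (E (graph T') u v) → T (E G (f u) (f v)))

-- The degree bound  d ≤ n^((K log n)^(-1/2))  expressed in ℕ.
-- ExpLt p q d  :⇔  e^p < d^q  (i.e. p/q < ln d), using that
-- (1+1/M)^(M+1) decreases to e:  e^p < m  iff  ∃ M ≥ 1 with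
-- (M+1)^((M+1)p) < m · M^((M+1)p).
ExpLt : ℕ → ℕ → ℕ → Set
ExpLt p q d = Σ ℕ λ M → 1 ≤ M ×
  (suc M ^ (suc M * p) < d ^ q * M ^ (suc M * p))

-- DegBound K n d  :⇔  K (ln d)² ≤ ln n   (for d ≥ 2, n ≥ 2), which is
-- equivalent to  d ≤ n^((K ln n)^(-1/2)):  for every rational p/q < ln d,
-- K (p/q) ln d ≤ ln n, i.e. d^(K p) ≤ n^q.  For d ≤ 1 it holds trivially,
-- as does d ≤ n^(…) when n ≥ 1.
DegBound : ℕ → ℕ → ℕ → Set
DegBound K n d = ∀ p q → 1 ≤ q → ExpLt p q d → d ^ (K * p) ≤ n ^ q

{-# OPTIONS --safe #-}
module Submission where

-- Vertices are embedded so that the set U of unused vertices stays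
-- quasi-random: every vertex sees, in both directions, noticeably more than
-- half of U.  The tree is cut into pieces of between m and about Δ m vertices,
-- which are embedded one after the other, parents first.  All degrees are
-- controlled by one potential, the sum over all vertices v and both directions
-- of (1 + 2 z) ^ L, where z is the proportion of U not adjacent to v.  To first
-- order its change is the sum of prices of the vertices used, and it suffices
-- that each piece costs little more than the average price of its size.
--
-- Since degrees inside U exceed |U| / 2, U spans an r-regular digraph.  A
-- random walk along it, forwards or backwards, preserves the uniform
-- distribution, so a tree-indexed walk from a uniform root has average price,
-- and choosing every vertex below its conditional expectation makes it
-- deterministic and injective.  The root of a piece is not free, however: it
-- must be adjacent to a given vertex.  As any two vertices have many common
-- neighbours, the position of a vertex can be chosen such that a fixed
-- proportion of the tree below it (by weight) can start from cheap positions.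
-- Repeating this for h = O(1) levels leaves a negligible part of the piece,
-- besides at most Δ ^ h vertices near the root, which are few compared with m.
-- Only here the degree bound is used, in the weak form Δ ^ K ≤ n.

open import Defs
open import Data.Bool using (Bool; true; false; T; _∧_; _∨_; not)
open import Data.Bool.Properties using (T-∧; T-∨; T?)
open import Data.Empty using (⊥; ⊥-elim)
open import Data.Fin using (Fin; zero; suc; splitAt; fromℕ<; _↑ˡ_; _↑ʳ_)
import Data.Fin.Properties as Fin
open import Data.Nat hiding (_≟_)
open import Data.Nat.Properties hiding (_≟_)
open import Data.Nat.Tactic.RingSolver using (solve-∀)
open import Data.Product using (Σ; ∃; ∃₂; _×_; _,_; proj₁; proj₂)
open import Data.Sum using (_⊎_; inj₁; inj₂; [_,_]′)
open import Data.Unit using (tt)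
open import Function using (_∘_; case_of_)
open import Function.Bundles using (Equivalence)
open import Relation.Binary.PropositionalEquality
open import Relation.Nullary using (¬_; yes; no; does)
open import Algebra.Properties.Semiring.Sum +-*-semiring
  using (sum; sum-cong-≗; ∑-distrib-+; ∑-comm; *-distribˡ-sum; *-distribʳ-sum)
open import Data.List using (List; []; _∷_; _++_)
open import Data.List.Membership.Propositional using (_∈_)
open import Data.List.Membership.Propositional.Properties using (∈-++⁺ˡ; ∈-++⁺ʳ)
open import Data.List.Relation.Unary.All as All using (All; []; _∷_)
import Data.List.Relation.Unary.All.Properties as All
open import Data.List.Relation.Unary.Any using (here; there)
open import Data.List.Relation.Unary.AllPairs using ([]; _∷_)
open import Data.List.Relation.Unary.Unique.Propositional using (Unique)
open import Function.Definitions using (Injective)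
open import Data.Integer as ℤ using (-[1+_])
import Data.Integer.Properties as ℤ
open import Data.Nat.Coprimality using (Coprime)
open import Data.Rational as ℚ using (ℚ; mkℚ; toℚᵘ; 0ℚ; 1ℚ; ½; *<*)
import Data.Rational.Properties as ℚ
open import Data.Rational.Unnormalised as ℚᵘ using (mkℚᵘ; _≃_; *≡*; *≤*)
import Data.Rational.Unnormalised.Properties as ℚᵘ

-- Finite sums and cardinalities

-- All estimates are between natural numbers: `y` is the accuracy, and a loss of a factor 1 + 1/y
-- appears as `y` against `suc y`. A piece of s vertices may exceed its average price by a relative
-- O(1/y), so the normalised potential grows by a factor 1 + O(B L s / (n y)) per piece and exp(O(B
-- L / y)) in total. A degree that fell too low would have raised its own term by ((p + 1) / p) ^ L
-- over the initial bound, so the sum of 2 N terms excludes this once L is large compared with log N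
-- and y is a large constant. On the other hand L must not be too large: the first-order expansion
-- needs S L to be small against n, where S bounds the size of a piece. An L of order n^(1/8) meets
-- both demands without any logarithm, since S is at most of order n^(1/4). Used vertices keep their
-- terms in the potential, because a used vertex may still have to be the parent of a later piece.

𝟙 : Bool → ℕ
𝟙 true  = 1
𝟙 false = 0

card : ∀ {n} → (Fin n → Bool) → ℕ
card X = sum (λ v → 𝟙 (X v))

sumOver : ∀ {n} → (Fin n → Bool) → (Fin n → ℕ) → ℕ
sumOver X c = sum (λ v → 𝟙 (X v) * c v)

_∩_ _∖_ : ∀ {n} → (Fin n → Bool) → (Fin n → Bool) → Fin n → Bool
(X ∩ Y) v = X v ∧ Y v
(X ∖ Y) v = X v ∧ not (Y v)

_==_ : ∀ {n} → Fin n → Fin n → Bool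
a == b = does (a Fin.≟ b)

_⊆_ : ∀ {n} → (Fin n → Bool) → (Fin n → Bool) → Set
X ⊆ Y = ∀ v → T (X v) → T (Y v)

infixl 7 _∩_ _∖_
infix 4 _⊆_

∧⁺ : ∀ {x y} → T x → T y → T (x ∧ y)
∧⁺ p q = Equivalence.from T-∧ (p , q)

∧⁻ : ∀ x {y} → T (x ∧ y) → T x × T y
∧⁻ x = Equivalence.to (T-∧ {x})

not⁺ : ∀ {x} → ¬ T x → T (not x)
not⁺ {true}  h = h tt
not⁺ {false} h = tt

not⁻ : ∀ {x} → T (not x) → ¬ T x
not⁻ {false} _ ()

==-refl : ∀ {n} (a : Fin n) → T (a == a)
==-refl a with a Fin.≟ a
... | yes _ = tt
... | no ¬p = ¬p refl

==⇒≡ : ∀ {n} (a b : Fin n) → T (a == b) → a ≡ b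
==⇒≡ a b h with a Fin.≟ b
... | yes p = p

𝟙-true : ∀ {x} → T x → 𝟙 x ≡ 1
𝟙-true {true} _ = refl

𝟙-false : ∀ {x} → ¬ T x → 𝟙 x ≡ 0
𝟙-false {true}  h = ⊥-elim (h tt)
𝟙-false {false} _ = refl

𝟙≤1 : ∀ x → 𝟙 x ≤ 1
𝟙≤1 true  = ≤-refl
𝟙≤1 false = z≤n

𝟙-mono : ∀ {x y} → (T x → T y) → 𝟙 x ≤ 𝟙 y
𝟙-mono {false} _ = z≤n
𝟙-mono {true} {y} h = ≤-reflexive (sym (𝟙-true (h tt)))

𝟙-∧ : ∀ x y → 𝟙 (x ∧ y) ≡ 𝟙 x * 𝟙 y
𝟙-∧ true  y = sym (*-identityˡ (𝟙 y))
𝟙-∧ false y = refl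

sum-mono : ∀ {n} {f g : Fin n → ℕ} → (∀ i → f i ≤ g i) → sum f ≤ sum g
sum-mono {zero}  h = z≤n
sum-mono {suc n} h = +-mono-≤ (h zero) (sum-mono (h ∘ suc))

sum-const : ∀ n k → sum {n} (λ _ → k) ≡ n * k
sum-const zero    k = refl
sum-const (suc n) k = cong (k +_) (sum-const n k)

term≤sum : ∀ {n} (f : Fin n → ℕ) i → f i ≤ sum f
term≤sum f zero    = m≤m+n (f zero) _
term≤sum f (suc i) = ≤-trans (term≤sum (f ∘ suc) i) (m≤n+m _ (f zero))

-- Turns one total into pointwise equalities: for the degrees of a saturated digraph and for the
-- labels of a spanning forest.
sum-tight : ∀ {n} {f g : Fin n → ℕ} → (∀ i → f i ≤ g i) → sum g ≤ sum f → ∀ i → f i ≡ g i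
sum-tight {suc n} {f} {g} h e zero = ≤-antisym (h zero)
  (+-cancelʳ-≤ _ (g zero) (f zero)
    (≤-trans e (+-monoʳ-≤ (f zero) (sum-mono (h ∘ suc)))))
sum-tight {suc n} {f} {g} h e (suc i) = sum-tight (h ∘ suc)
  (+-cancelˡ-≤ (g zero) _ _ (≤-trans e (+-monoˡ-≤ _ (h zero)))) i

sum-strict : ∀ {n} {f g : Fin n → ℕ} → sum f < sum g → ∃ λ i → f i < g i
sum-strict {zero} ()
sum-strict {suc n} {f} {g} h with f zero <? g zero
... | yes p = zero , p
... | no ¬p = let i , q = sum-strict (+-cancelˡ-< (g zero) _ _
                    (≤-<-trans (+-monoˡ-≤ _ (≮⇒≥ ¬p)) h)) in suc i , q

sum-δ : ∀ {n} (b : Fin n) (c : Fin n → ℕ) → sum (λ v → 𝟙 (v == b) * c v) ≡ c b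
sum-δ {suc n} zero c = begin
  c zero + 0 + sum (λ v → 𝟙 (suc v == zero) * c (suc v))
    ≡⟨ cong₂ _+_ (+-identityʳ (c zero)) (trans (sum-const n 0) (*-zeroʳ n)) ⟩
  c zero + 0 ≡⟨ +-identityʳ (c zero) ⟩
  c zero ∎
  where open ≡-Reasoning
sum-δ (suc b) c = sum-δ b (c ∘ suc)

sumOver-mono : ∀ {n} (X : Fin n → Bool) {f g : Fin n → ℕ} →
  (∀ v → T (X v) → f v ≤ g v) → sumOver X f ≤ sumOver X g
sumOver-mono X {f} {g} h = sum-mono λ v → aux (X v) (h v)
  where
  aux : ∀ x {a b} → (T x → a ≤ b) → 𝟙 x * a ≤ 𝟙 x * b
  aux true  h = *-monoʳ-≤ 1 (h tt)
  aux false h = z≤n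

sumOver-⊆ : ∀ {n} {X Y : Fin n → Bool} → X ⊆ Y → ∀ c → sumOver X c ≤ sumOver Y c
sumOver-⊆ s c = sum-mono λ v → *-monoˡ-≤ (c v) (𝟙-mono (s v))

sumOver-1 : ∀ {n} (X : Fin n → Bool) → sumOver X (λ _ → 1) ≡ card X
sumOver-1 X = sum-cong-≗ λ v → *-identityʳ (𝟙 (X v))

sumOver-const : ∀ {n} (X : Fin n → Bool) k → sumOver X (λ _ → k) ≡ card X * k
sumOver-const X k = sym (*-distribʳ-sum k (λ v → 𝟙 (X v)))

sumOver-+ : ∀ {n} (X : Fin n → Bool) f g →
  sumOver X (λ v → f v + g v) ≡ sumOver X f + sumOver X g
sumOver-+ X f g = trans (sum-cong-≗ λ v → *-distribˡ-+ (𝟙 (X v)) (f v) (g v))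
  (∑-distrib-+ (λ v → 𝟙 (X v) * f v) (λ v → 𝟙 (X v) * g v))

sumOver-* : ∀ {n} (X : Fin n → Bool) k f →
  sumOver X (λ v → k * f v) ≡ k * sumOver X f
sumOver-* X k f = trans (sum-cong-≗ λ v → swap (𝟙 (X v)) k (f v))
  (sym (*-distribˡ-sum k (λ v → 𝟙 (X v) * f v)))
  where
  swap : ∀ a b c → a * (b * c) ≡ b * (a * c)
  swap = solve-∀

sumOver-cong : ∀ {n} (X : Fin n → Bool) {f g : Fin n → ℕ} →
  (∀ v → T (X v) → f v ≡ g v) → sumOver X f ≡ sumOver X g
sumOver-cong X h = ≤-antisym (sumOver-mono X λ v x → ≤-reflexive (h v x))
  (sumOver-mono X λ v x → ≤-reflexive (sym (h v x)))

sumOver-swap : ∀ {m n} (X : Fin m → Bool) (Y : Fin n → Bool) (f : Fin m → Fin n → ℕ) →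
  sumOver X (λ a → sumOver Y (f a)) ≡ sumOver Y (λ b → sumOver X (λ a → f a b))
sumOver-swap X Y f = begin
  sum (λ a → 𝟙 (X a) * sum (λ b → 𝟙 (Y b) * f a b))
    ≡⟨ sum-cong-≗ (λ a → *-distribˡ-sum (𝟙 (X a)) (λ b → 𝟙 (Y b) * f a b)) ⟩
  sum (λ a → sum (λ b → 𝟙 (X a) * (𝟙 (Y b) * f a b)))
    ≡⟨ ∑-comm (λ a b → 𝟙 (X a) * (𝟙 (Y b) * f a b)) ⟩
  sum (λ b → sum (λ a → 𝟙 (X a) * (𝟙 (Y b) * f a b)))
    ≡⟨ sum-cong-≗ (λ b → trans (sum-cong-≗ λ a → swap (𝟙 (X a)) (𝟙 (Y b)) (f a b))
         (sym (*-distribˡ-sum (𝟙 (Y b)) (λ a → 𝟙 (X a) * f a b)))) ⟩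
  sum (λ b → 𝟙 (Y b) * sum (λ a → 𝟙 (X a) * f a b)) ∎
  where
  open ≡-Reasoning
  swap : ∀ a b c → a * (b * c) ≡ b * (a * c)
  swap = solve-∀

card-mono : ∀ {n} {X Y : Fin n → Bool} → X ⊆ Y → card X ≤ card Y
card-mono s = sum-mono λ v → 𝟙-mono (s v)

sumOver-∩ : ∀ {n} (X Y : Fin n → Bool) c →
  sumOver (X ∩ Y) c ≡ sumOver X (λ v → 𝟙 (Y v) * c v)
sumOver-∩ X Y c = sum-cong-≗ λ v →
  trans (cong (_* c v) (𝟙-∧ (X v) (Y v))) (*-assoc (𝟙 (X v)) (𝟙 (Y v)) (c v))

card-∩ : ∀ {n} (X Y : Fin n → Bool) → card (X ∩ Y) ≡ sumOver X (λ v → 𝟙 (Y v))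
card-∩ X Y = sum-cong-≗ λ v → 𝟙-∧ (X v) (Y v)

sumOver-split : ∀ {n} (X Y : Fin n → Bool) c →
  sumOver X c ≡ sumOver (X ∩ Y) c + sumOver (X ∖ Y) c
sumOver-split X Y c = trans
  (sum-cong-≗ λ v → aux (X v) (Y v) (c v))
  (∑-distrib-+ (λ v → 𝟙 (X v ∧ Y v) * c v) (λ v → 𝟙 (X v ∧ not (Y v)) * c v))
  where
  aux : ∀ x y k → 𝟙 x * k ≡ 𝟙 (x ∧ y) * k + 𝟙 (x ∧ not y) * k
  aux false y k = refl
  aux true true k = sym (+-identityʳ _)
  aux true false k = refl

card-split : ∀ {n} (X Y : Fin n → Bool) → card X ≡ card (X ∩ Y) + card (X ∖ Y)
card-split X Y = begin
  card X ≡⟨ sumOver-1 X ⟨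
  sumOver X (λ _ → 1) ≡⟨ sumOver-split X Y (λ _ → 1) ⟩
  sumOver (X ∩ Y) (λ _ → 1) + sumOver (X ∖ Y) (λ _ → 1)
    ≡⟨ cong₂ _+_ (sumOver-1 (X ∩ Y)) (sumOver-1 (X ∖ Y)) ⟩
  card (X ∩ Y) + card (X ∖ Y) ∎
  where open ≡-Reasoning

-- Inclusion-exclusion inside `U`, free of subtraction. It yields the lower bounds for common and
-- for still available neighbours.
card-∩-lower : ∀ {n} {U X Y : Fin n → Bool} → X ⊆ U → Y ⊆ U →
  card X + card Y ≤ card U + card (X ∩ Y)
card-∩-lower {U = U} {X} {Y} X⊆U Y⊆U = begin
  card X + card Y ≡⟨ ∑-distrib-+ (𝟙 ∘ X) (𝟙 ∘ Y) ⟨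
  sum (λ v → 𝟙 (X v) + 𝟙 (Y v))
    ≤⟨ sum-mono (λ v → aux (X v) (Y v) (X⊆U v) (Y⊆U v)) ⟩
  sum (λ v → 𝟙 (U v) + 𝟙 (X v ∧ Y v)) ≡⟨ ∑-distrib-+ (𝟙 ∘ U) (𝟙 ∘ (X ∩ Y)) ⟩
  card U + card (X ∩ Y) ∎
  where
  open ≤-Reasoning
  aux : ∀ x y {u} → (T x → T u) → (T y → T u) → 𝟙 x + 𝟙 y ≤ 𝟙 u + 𝟙 (x ∧ y)
  aux true true h _ = ≤-reflexive (cong (_+ 1) (sym (𝟙-true (h tt))))
  aux true false h _ = ≤-trans (≤-reflexive (sym (𝟙-true (h tt)))) (m≤m+n _ 0)
  aux false y _ k = ≤-trans (𝟙-mono k) (m≤m+n _ 0)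

sumOver-∸-δ : ∀ {n} (A : Fin n → Bool) b (c : Fin n → ℕ) → T (A b) →
  sumOver A c ≡ c b + sumOver (A ∖ (_== b)) c
sumOver-∸-δ A b c Ab = trans (sumOver-split A (_== b) c)
  (cong (_+ sumOver (A ∖ (_== b)) c)
    (trans (sum-cong-≗ λ v → cong (_* c v) (aux v)) (sum-δ b c)))
  where
  aux : ∀ v → 𝟙 (A v ∧ (v == b)) ≡ 𝟙 (v == b)
  aux v with v Fin.≟ b
  ... | no _ = 𝟙-false (λ h → proj₂ (∧⁻ (A v) h))
  ... | yes refl = 𝟙-true (∧⁺ Ab tt)

card-∸-δ : ∀ {n} (A : Fin n → Bool) b → T (A b) → card A ≡ suc (card (A ∖ (_== b)))
card-∸-δ A b Ab = begin
  card A ≡⟨ sumOver-1 A ⟨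
  sumOver A (λ _ → 1) ≡⟨ sumOver-∸-δ A b (λ _ → 1) Ab ⟩
  suc (sumOver (A ∖ (_== b)) (λ _ → 1)) ≡⟨ cong suc (sumOver-1 (A ∖ (_== b))) ⟩
  suc (card (A ∖ (_== b))) ∎
  where open ≡-Reasoning

minimum : ∀ {n} (X : Fin n → Bool) (φ : Fin n → ℕ) → 0 < card X →
  ∃ λ v → T (X v) × (∀ w → T (X w) → φ v ≤ φ w)
minimum {suc n} X φ pos with T? (X zero) | 0 <? card (X ∘ suc)
... | no ¬x | no ¬p = ⊥-elim (¬p (subst (λ k → 0 < k + card (X ∘ suc)) (𝟙-false ¬x) pos))
... | yes x | no ¬p = zero , x , λ
  { zero _ → ≤-refl
  ; (suc w) h → ⊥-elim (¬p (≤-trans (≤-reflexive (sym (𝟙-true h))) (term≤sum (𝟙 ∘ X ∘ suc) w))) }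
... | no ¬x | yes p = let v , Xv , m = minimum (X ∘ suc) (φ ∘ suc) p in
  suc v , Xv , λ { zero h → ⊥-elim (¬x h) ; (suc w) h → m w h }
... | yes x | yes p with minimum (X ∘ suc) (φ ∘ suc) p
... | v , Xv , m with φ zero ≤? φ (suc v)
... | yes q = zero , x , λ { zero _ → ≤-refl ; (suc w) h → ≤-trans q (m w h) }
... | no ¬q = suc v , Xv , λ { zero _ → ≰⇒≥ ¬q ; (suc w) h → m w h }

-- The derandomising step: a minimiser takes the place of a random choice, so a bound on an
-- expectation becomes a bound for one vertex.
below-average : ∀ {n} (X : Fin n → Bool) (φ : Fin n → ℕ) → 0 < card X →
  ∃ λ v → T (X v) × (card X * φ v ≤ sumOver X φ)
below-average X φ pos = let v , Xv , m = minimum X φ pos in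
  v , Xv , ≤-trans (≤-reflexive (sym (sumOver-const X (φ v)))) (sumOver-mono X m)

search : ∀ {m n} (P : Fin m → Fin n → Bool) →
  (∃₂ λ a b → T (P a b)) ⊎ (∀ a b → ¬ T (P a b))
search P with Fin.any? (λ a → Fin.any? (λ b → T? (P a b)))
... | yes (a , b , p) = inj₁ (a , b , p)
... | no ¬p = inj₂ λ a b h → ¬p (a , b , h)

-- Spanning regular subdigraphs

row col : ∀ {N} → (Fin N → Fin N → Bool) → Fin N → ℕ
row D a = card (D a)
col D b = card (λ a → D a b)

edges# : ∀ {N} → (Fin N → Fin N → Bool) → ℕ
edges# D = sum (row D)

-- A deletion is the same relation read backwards, so `adds-row` and `adds-col` serve insertions and
-- deletions alike.
record AddsEdge {N : ℕ} (D : Fin N → Fin N → Bool) (a b : Fin N) (D' : Fin N → Fin N → Bool) : Set where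
  constructor adds
  field entry : ∀ x y → 𝟙 (D' x y) ≡ 𝟙 (D x y) + 𝟙 ((x == a) ∧ (y == b))
open AddsEdge

insertEdge deleteEdge : ∀ {N} → (Fin N → Fin N → Bool) → Fin N → Fin N → Fin N → Fin N → Bool
insertEdge D a b x y = D x y ∨ ((x == a) ∧ (y == b))
deleteEdge D a b x y = D x y ∧ not ((x == a) ∧ (y == b))

module _ {N : ℕ} where

  private
    V = Fin N
    Rel = V → V → Bool

  both-==⇒ : ∀ (D : Rel) {a b x y} → T ((x == a) ∧ (y == b)) → (D x y ≡ D a b)
  both-==⇒ D {a} {b} {x} {y} h =
    let p , q = ∧⁻ (x == a) h in cong₂ D (==⇒≡ x a p) (==⇒≡ y b q)

  insert-adds : ∀ (D : Rel) a b → ¬ T (D a b) → AddsEdge D a b (insertEdge D a b)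
  insert-adds D a b ¬d = adds λ x y → aux (D x y) ((x == a) ∧ (y == b))
    (λ d h → ¬d (subst T (both-==⇒ D h) d))
    where
    aux : ∀ d e → (T d → T e → ⊥) → 𝟙 (d ∨ e) ≡ 𝟙 d + 𝟙 e
    aux true true h = ⊥-elim (h tt tt)
    aux true false h = refl
    aux false e h = refl

  delete-adds : ∀ (D : Rel) a b → T (D a b) → AddsEdge (deleteEdge D a b) a b D
  delete-adds D a b d = adds λ x y → aux (D x y) ((x == a) ∧ (y == b))
    (λ h → subst T (sym (both-==⇒ D h)) d)
    where
    aux : ∀ d e → (T e → T d) → 𝟙 d ≡ 𝟙 (d ∧ not e) + 𝟙 e
    aux true true h = refl
    aux true false h = refl
    aux false true h = ⊥-elim (h tt)
    aux false false h = refl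

  adds-row : ∀ {D D' : Rel} {a b} → AddsEdge D a b D' → ∀ x → row D' x ≡ row D x + 𝟙 (x == a)
  adds-row {D} {D'} {a} {b} h x = begin
    row D' x ≡⟨ sum-cong-≗ (entry h x) ⟩
    sum (λ y → 𝟙 (D x y) + 𝟙 ((x == a) ∧ (y == b)))
      ≡⟨ ∑-distrib-+ (λ y → 𝟙 (D x y)) (λ y → 𝟙 ((x == a) ∧ (y == b))) ⟩
    row D x + sum (λ y → 𝟙 ((x == a) ∧ (y == b)))
      ≡⟨ cong (row D x +_) (trans
           (sum-cong-≗ λ y → trans (𝟙-∧ (x == a) (y == b)) (*-comm (𝟙 (x == a)) _))
           (sum-δ b (λ _ → 𝟙 (x == a)))) ⟩
    row D x + 𝟙 (x == a) ∎
    where open ≡-Reasoning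

  adds-col : ∀ {D D' : Rel} {a b} → AddsEdge D a b D' → ∀ y → col D' y ≡ col D y + 𝟙 (y == b)
  adds-col {D} {D'} {a} {b} h y = begin
    col D' y ≡⟨ sum-cong-≗ (λ x → entry h x y) ⟩
    sum (λ x → 𝟙 (D x y) + 𝟙 ((x == a) ∧ (y == b)))
      ≡⟨ ∑-distrib-+ (λ x → 𝟙 (D x y)) (λ x → 𝟙 ((x == a) ∧ (y == b))) ⟩
    col D y + sum (λ x → 𝟙 ((x == a) ∧ (y == b)))
      ≡⟨ cong (col D y +_) (trans
           (sum-cong-≗ λ x → 𝟙-∧ (x == a) (y == b))
           (sum-δ a (λ _ → 𝟙 (y == b)))) ⟩
    col D y + 𝟙 (y == b) ∎
    where open ≡-Reasoning

  sum-col : ∀ (D : Rel) → sum (col D) ≡ edges# D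
  sum-col D = ∑-comm (λ b a → 𝟙 (D a b))

  module Regular (U : V → Bool) (H : Rel) (r : ℕ)
    (H⊆ : ∀ a b → T (H a b) → T (U a) × T (U b))
    (out-large : ∀ a → T (U a) → card U + 2 * r ≤ 2 * row H a)
    (in-large : ∀ b → T (U b) → card U + 2 * r ≤ 2 * col H b) where

    record Partial (D : Rel) : Set where
      field
        sub  : ∀ a b → T (D a b) → T (H a b)
        rows : ∀ a → row D a ≤ r
        cols : ∀ b → col D b ≤ r
    open Partial

    unsaturated : ∀ {f : V → ℕ} → sum f < card U * r → ∃ λ a → T (U a) × f a < r
    unsaturated {f} lt with sum-strict {f = f} (subst (sum f <_) (sym (sumOver-const U r)) lt)
    ... | a , q = a , aux (U a) q
      where
      aux : ∀ u → f a < 𝟙 u * r → T u × f a < r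
      aux true h = tt , subst (f a <_) (+-identityʳ r) h

    bump : ∀ {k} (x a : V) → k ≤ r → (x ≡ a → k < r) → k + 𝟙 (x == a) ≤ r
    bump {k} x a p q with x Fin.≟ a
    ... | yes e = subst (_≤ r) (+-comm 1 k) (q e)
    ... | no _ = subst (_≤ r) (sym (+-identityʳ k)) p

    addEdge : ∀ {D D' : Rel} {a b} → Partial D → AddsEdge D a b D' → T (H a b) →
      row D a < r → col D b < r →
      Partial D'
    addEdge {D} {D'} {a} {b} pd h Hab ra cb = record
      { sub = λ x y d → [ sub pd x y , (λ e → subst T (sym (both-==⇒ H e)) Hab) ]′
          (𝟙-sum (D x y) ((x == a) ∧ (y == b)) (D' x y) (entry h x y) d)
      ; rows = λ x → subst (_≤ r) (sym (adds-row h x))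
          (bump x a (rows pd x) (λ { refl → ra }))
      ; cols = λ y → subst (_≤ r) (sym (adds-col h y))
          (bump y b (cols pd y) (λ { refl → cb }))
      }
      where
      𝟙-sum : ∀ d e d' → 𝟙 d' ≡ 𝟙 d + 𝟙 e → T d' → T d ⊎ T e
      𝟙-sum true e d' p t = inj₁ tt
      𝟙-sum false true d' p t = inj₂ tt
      𝟙-sum false false true () t

    adds-edges# : ∀ {D D' : Rel} {a b} → AddsEdge D a b D' → edges# D' ≡ suc (edges# D)
    adds-edges# {D} {D'} {a} {b} h = begin
      sum (row D') ≡⟨ sum-cong-≗ (adds-row h) ⟩
      sum (λ x → row D x + 𝟙 (x == a)) ≡⟨ ∑-distrib-+ (row D) (λ x → 𝟙 (x == a)) ⟩
      edges# D + sum (λ x → 𝟙 (x == a)) ≡⟨ cong (edges# D +_) (trans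
         (sum-cong-≗ λ x → sym (*-identityʳ (𝟙 (x == a)))) (sum-δ a (λ _ → 1))) ⟩
      edges# D + 1 ≡⟨ +-comm (edges# D) 1 ⟩
      suc (edges# D) ∎
      where open ≡-Reasoning

    module Augment (D : Rel) (pd : Partial D) (a b : V) (Ua : T (U a)) (Ub : T (U b))
      (ra : row D a < r) (cb : col D b < r) (small : edges# D < card U * r) where

      free : Rel
      free x y = H x y ∧ not (D x y)

      Nout Nin : V → Bool
      Nout y = free a y
      Nin x = free x b

      half : ∀ {u h d k} → u + 2 * r ≤ 2 * h → h ≤ d + k → d ≤ r → u ≤ 2 * k
      half {u} {h} {d} {k} p q s = +-cancelʳ-≤ (2 * r) u (2 * k) (≤-trans p
        (≤-trans (*-monoʳ-≤ 2 q) (≤-trans (*-monoʳ-≤ 2 (+-monoˡ-≤ k s))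
          (≤-reflexive (eq r k)))))
        where
        eq : ∀ r k → 2 * (r + k) ≡ 2 * k + 2 * r
        eq = solve-∀

      Nout-large : card U ≤ 2 * card Nout
      Nout-large = half {d = row D a} (out-large a Ua)
        (≤-trans (≤-reflexive (card-split (H a) (D a)))
          (+-monoˡ-≤ (card Nout) (card-mono {X = H a ∩ D a} {Y = D a} λ y h → proj₂ (∧⁻ (H a y) h))))
        (rows pd a)

      Nin-large : card U ≤ 2 * card Nin
      Nin-large = half {d = col D b} (in-large b Ub)
        (≤-trans (≤-reflexive (card-split (λ x → H x b) (λ x → D x b)))
          (+-monoˡ-≤ (card Nin) (card-mono {X = (λ x → H x b) ∩ (λ x → D x b)} {Y = λ x → D x b}
            λ x h → proj₂ (∧⁻ (H x b) h))))
        (cols pd b)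

      swappable : Rel
      swappable x y = D x y ∧ (Nin x ∧ Nout y)

      -- Without a swap, the edges of `D` leaving `Nin` and those entering `Nout` are disjoint. Both
      -- kinds number at least `r` per vertex, and the two sets together have at least `card U`
      -- vertices.
      no-swap⇒saturated : (∀ x y → ¬ T (swappable x y)) →
        (∀ y → T (Nout y) → r ≤ col D y) → (∀ x → T (Nin x) → r ≤ row D x) →
        card U * r ≤ edges# D
      no-swap⇒saturated none co ro = ≤-trans
        (≤-trans (*-monoˡ-≤ r many) (≤-reflexive (*-distribʳ-+ r (card Nin) (card Nout))))
        (≤-trans (+-mono-≤ rowpart colpart) (≤-trans (≤-reflexive (sym together)) tally))
        where
        many : card U ≤ card Nin + card Nout
        many = *-cancelˡ-≤ 2 (≤-trans (≤-reflexive (dbl (card U)))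
          (≤-trans (+-mono-≤ Nin-large Nout-large)
            (≤-reflexive (sym (*-distribˡ-+ 2 (card Nin) (card Nout))))))
          where
          dbl : ∀ u → 2 * u ≡ u + u
          dbl = solve-∀
        rowpart : card Nin * r ≤ sum (λ x → sum (λ y → 𝟙 (D x y) * 𝟙 (Nin x)))
        rowpart = ≤-trans (≤-reflexive (sym (sumOver-const Nin r)))
          (≤-trans (sumOver-mono Nin ro)
            (≤-reflexive (sum-cong-≗ λ x → trans (*-comm (𝟙 (Nin x)) _)
              (*-distribʳ-sum (𝟙 (Nin x)) (𝟙 ∘ D x)))))
        colpart : card Nout * r ≤ sum (λ x → sum (λ y → 𝟙 (D x y) * 𝟙 (Nout y)))
        colpart = ≤-trans (≤-reflexive (sym (sumOver-const Nout r)))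
          (≤-trans (sumOver-mono Nout co)
            (≤-reflexive (trans (sum-cong-≗ λ y → trans (*-comm (𝟙 (Nout y)) _)
              (*-distribʳ-sum (𝟙 (Nout y)) (λ x → 𝟙 (D x y))))
              (∑-comm (λ y x → 𝟙 (D x y) * 𝟙 (Nout y))))))
        together : sum (λ x → sum (λ y → 𝟙 (D x y) * 𝟙 (Nin x) + 𝟙 (D x y) * 𝟙 (Nout y))) ≡ _
        together = trans (sum-cong-≗ λ x →
            ∑-distrib-+ (λ y → 𝟙 (D x y) * 𝟙 (Nin x)) (λ y → 𝟙 (D x y) * 𝟙 (Nout y)))
          (∑-distrib-+ (λ x → sum (λ y → 𝟙 (D x y) * 𝟙 (Nin x)))
            (λ x → sum (λ y → 𝟙 (D x y) * 𝟙 (Nout y))))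
        tally : sum (λ x → sum (λ y → 𝟙 (D x y) * 𝟙 (Nin x) + 𝟙 (D x y) * 𝟙 (Nout y))) ≤ edges# D
        tally = sum-mono λ x → sum-mono λ y → aux (D x y) (Nin x) (Nout y) (none x y)
          where
          aux : ∀ d p q → ¬ T (d ∧ (p ∧ q)) → 𝟙 d * 𝟙 p + 𝟙 d * 𝟙 q ≤ 𝟙 d
          aux false p q h = z≤n
          aux true true true h = ⊥-elim (h tt)
          aux true true false h = ≤-refl
          aux true false true h = ≤-refl
          aux true false false h = z≤n

      -- The edge from `x` to `y` is exchanged for one from `x` to `b` and one from `a` to `y`, so
      -- only row `a` and column `b` grow.
      swap : ∀ x y → T (swappable x y) → ∃ λ D' → Partial D' × edges# D' ≡ suc (edges# D)
      swap x y h = D₃ , pd₃ , trans (adds-edges# add₃)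
          (cong suc (trans (adds-edges# add₂)
            (sym (adds-edges# add₁))))
        where
        Dxy : T (D x y)
        Dxy = proj₁ (∧⁻ (D x y) h)
        Hxb : T (H x b) × T (not (D x b))
        Hxb = ∧⁻ (H x b) (proj₁ (∧⁻ (Nin x) (proj₂ (∧⁻ (D x y) h))))
        Hay : T (H a y) × T (not (D a y))
        Hay = ∧⁻ (H a y) (proj₂ (∧⁻ (Nin x) (proj₂ (∧⁻ (D x y) h))))
        D₁ = deleteEdge D x y
        D₂ = insertEdge D₁ x b
        D₃ = insertEdge D₂ a y
        add₁ : AddsEdge D₁ x y D
        add₁ = delete-adds D x y Dxy
        ¬D₁xb : ¬ T (D₁ x b)
        ¬D₁xb d = not⁻ (proj₂ Hxb) (proj₁ (∧⁻ (D x b) d))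
        add₂ : AddsEdge D₁ x b D₂
        add₂ = insert-adds D₁ x b ¬D₁xb
        ¬D₂ay : ¬ T (D₂ a y)
        ¬D₂ay d with Equivalence.to (T-∨ {D₁ a y}) d
        ... | inj₁ d₁ = not⁻ (proj₂ Hay) (proj₁ (∧⁻ (D a y) d₁))
        -- This case forces `a` = `x`, although `D x y` holds and `D a y` fails.
        ... | inj₂ e = not⁻ (proj₂ Hay)
            (subst (λ z → T (D z y)) (sym (==⇒≡ a x (proj₁ (∧⁻ (a == x) e)))) Dxy)
        add₃ : AddsEdge D₂ a y D₃
        add₃ = insert-adds D₂ a y ¬D₂ay
        row₁ : ∀ z → row D z ≡ row D₁ z + 𝟙 (z == x)
        row₁ = adds-row add₁
        row₂ : ∀ z → row D₂ z ≡ row D z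
        row₂ z = trans (adds-row add₂ z) (sym (row₁ z))
        col₁ : ∀ z → col D z ≡ col D₁ z + 𝟙 (z == y)
        col₁ = adds-col add₁
        col₂ : ∀ z → col D₂ z ≡ col D₁ z + 𝟙 (z == b)
        col₂ = adds-col add₂
        col₃ : ∀ z → col D₃ z ≡ col D z + 𝟙 (z == b)
        col₃ z = begin
          col D₃ z ≡⟨ adds-col add₃ z ⟩
          col D₂ z + 𝟙 (z == y) ≡⟨ cong (_+ 𝟙 (z == y)) (col₂ z) ⟩
          col D₁ z + 𝟙 (z == b) + 𝟙 (z == y) ≡⟨ comm (col D₁ z) (𝟙 (z == b)) (𝟙 (z == y)) ⟩
          col D₁ z + 𝟙 (z == y) + 𝟙 (z == b) ≡⟨ cong (_+ 𝟙 (z == b)) (col₁ z) ⟨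
          col D z + 𝟙 (z == b) ∎
          where
          open ≡-Reasoning
          comm : ∀ p q s → p + q + s ≡ p + s + q
          comm = solve-∀
        D₂⊆H : ∀ u v → T (D₂ u v) → T (H u v)
        D₂⊆H u v d with Equivalence.to (T-∨ {D₁ u v}) d
        ... | inj₁ d₁ = sub pd u v (proj₁ (∧⁻ (D u v) d₁))
        ... | inj₂ e = subst T (sym (both-==⇒ H e)) (proj₁ Hxb)
        pd₃ : Partial D₃
        pd₃ = record
          { sub = λ u v d → [ D₂⊆H u v , (λ e → subst T (sym (both-==⇒ H e)) (proj₁ Hay)) ]′
              (Equivalence.to (T-∨ {D₂ u v}) d)
          ; rows = λ z → subst (_≤ r)
              (sym (trans (adds-row add₃ z) (cong (_+ 𝟙 (z == a)) (row₂ z))))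
              (bump z a (rows pd z) (λ { refl → ra }))
          ; cols = λ z → subst (_≤ r) (sym (col₃ z)) (bump z b (cols pd z) (λ { refl → cb })) }

      augment : ∃ λ D' → Partial D' × edges# D' ≡ suc (edges# D)
      augment with Fin.any? (λ y → T? (Nout y ∧ (col D y <ᵇ r)))
                 | Fin.any? (λ x → T? (Nin x ∧ (row D x <ᵇ r)))
                 | search swappable
      ... | yes (y , h) | _ | _ =
        let f , lt = ∧⁻ (Nout y) h
            Hay , ¬D = ∧⁻ (H a y) f
            add = insert-adds D a y (not⁻ ¬D)
        in insertEdge D a y , addEdge pd add Hay ra (<ᵇ⇒< _ _ lt) ,
           adds-edges# add
      ... | no _ | yes (x , h) | _ =
        let f , lt = ∧⁻ (Nin x) h
            Hxb , ¬D = ∧⁻ (H x b) f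
            add = insert-adds D x b (not⁻ ¬D)
        in insertEdge D x b , addEdge pd add Hxb (<ᵇ⇒< _ _ lt) cb ,
           adds-edges# add
      ... | no _ | no _ | inj₁ (x , y , h) = swap x y h
      ... | no ¬y | no ¬x | inj₂ none = ⊥-elim (<⇒≱ small (no-swap⇒saturated none
        (λ y f → ≮⇒≥ λ lt → ¬y (y , ∧⁺ f (<⇒<ᵇ lt)))
        (λ x f → ≮⇒≥ λ lt → ¬x (x , ∧⁺ f (<⇒<ᵇ lt)))))

    enlarge : ∀ {D} → Partial D → edges# D < card U * r →
      ∃ λ D' → Partial D' × edges# D' ≡ suc (edges# D)
    enlarge {D} pd small =
      let a , Ua , ra = unsaturated small
          b , Ub , cb = unsaturated (subst (_< card U * r) (sym (sum-col D)) small)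
      in Augment.augment D pd a b Ua Ub ra cb small

    grow : ∀ k {D} → Partial D → edges# D + k ≡ card U * r →
      ∃ λ D' → Partial D' × edges# D' ≡ card U * r
    grow zero pd e = _ , pd , trans (sym (+-identityʳ _)) e
    grow (suc k) {D} pd e =
      let D' , pd' , e' = enlarge pd (subst (edges# D <_) e (m<m+n (edges# D) z<s))
      in grow k pd' (trans (cong (_+ k) e') (trans (sym (+-suc (edges# D) k)) e))

    outside : ∀ {D} → Partial D → ∀ a → row D a ≤ 𝟙 (U a) * r
    outside {D} pd a with T? (U a)
    ... | yes Ua = subst (row D a ≤_) (sym (trans (cong (_* r) (𝟙-true Ua)) (*-identityˡ r))) (rows pd a)
    ... | no ¬Ua = ≤-trans (sum-mono λ b → ≤-reflexive
          (𝟙-false λ d → ¬Ua (proj₁ (H⊆ a b (sub pd a b d)))))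
        (≤-trans (≤-reflexive (trans (sum-const N 0) (*-zeroʳ N))) z≤n)

    outside′ : ∀ {D} → Partial D → ∀ b → col D b ≤ 𝟙 (U b) * r
    outside′ {D} pd b with T? (U b)
    ... | yes Ub = subst (col D b ≤_) (sym (trans (cong (_* r) (𝟙-true Ub)) (*-identityˡ r))) (cols pd b)
    ... | no ¬Ub = ≤-trans (sum-mono λ a → ≤-reflexive
          (𝟙-false λ d → ¬Ub (proj₂ (H⊆ a b (sub pd a b d)))))
        (≤-trans (≤-reflexive (trans (sum-const N 0) (*-zeroʳ N))) z≤n)

    regular : ∃ λ D → (∀ a b → T (D a b) → T (H a b)) ×
      (∀ a → row D a ≡ 𝟙 (U a) * r) × (∀ b → col D b ≡ 𝟙 (U b) * r)
    regular =
      let D , pd , e = grow (card U * r) {λ _ _ → false} empty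
            (cong (_+ card U * r) (trans (sum-cong-≗ {n = N} λ _ → row-∅) (trans (sum-const N 0) (*-zeroʳ N))))
      in D , sub pd ,
         -- With `card U * r` edges the bound `r` for the rows and columns in `U` has no slack left.
         sum-tight (outside pd) (≤-reflexive (trans (sumOver-const U r) (sym e))) ,
         sum-tight (outside′ pd) (≤-reflexive (trans (sumOver-const U r) (trans (sym e) (sym (sum-col D)))))
      where
      row-∅ : card {N} (λ _ → false) ≡ 0
      row-∅ = trans (sum-const N 0) (*-zeroʳ N)
      empty : Partial (λ _ _ → false)
      empty = record { sub = λ _ _ () ; rows = λ _ → subst (_≤ r) (sym row-∅) z≤n
                     ; cols = λ _ → subst (_≤ r) (sym row-∅) z≤n }

-- Forests and their threaded embeddings

-- A forest is hung below a vertex: d is the orientation of the edge to the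
-- first root x (true: away from the parent), sub hangs below x, and rest
-- contains the remaining roots.
data Forest (n : ℕ) : Set where
  nil  : Forest n
  cons : (d : Bool) (x : Fin n) (sub rest : Forest n) → Forest n

size : ∀ {n} → Forest n → ℕ
size nil = 0
size (cons d x sub rest) = suc (size sub + size rest)

nbr : ∀ {N} → Digraph N → Bool → Fin N → Fin N → Bool
nbr G true  a b = E G a b
nbr G false a b = E G b a

nbr-flip : ∀ {N} (G : Digraph N) d a b → nbr G (not d) b a ≡ nbr G d a b
nbr-flip G true  a b = refl
nbr-flip G false a b = refl

-- A and A' are the vertices available before and after the embedding, which
-- makes every embedding injective by construction.
data Emb {N n} (G : Digraph N) : (A : Fin N → Bool) → Fin N → Forest n → (A' : Fin N → Bool) → Set where
  nil  : ∀ {A a} → Emb G A a nil A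
  cons : ∀ {A A' A'' a d x sub rest} (b : Fin N) → T (A b) → T (nbr G d a b) →
    Emb G (A ∖ (_== b)) b sub A' → Emb G A' a rest A'' → Emb G A a (cons d x sub rest) A''

-- Linear arithmetic in one step: a consequence of `a ≤ b` is reduced to a comparison of `x + b`
-- with `y + a`, usually an identity for the ring solver.
lin : ∀ {a b x y} → a ≤ b → x + b ≤ y + a → x ≤ y
lin {a} {b} {x} {y} p q = +-cancelʳ-≤ b x y (≤-trans q (+-monoʳ-≤ y p))

module _ {N n : ℕ} {G : Digraph N} where

  cost : (Fin N → ℕ) → ∀ {A a A'} {F : Forest n} → Emb G A a F A' → ℕ
  cost c nil = 0
  cost c (cons b _ _ e f) = c b + cost c e + cost c f

  -- Telescopes over the vertices consumed. With `price` for `c` it expresses the cost of a piece by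
  -- the sums over `U` before and after, which is how the potential sees it.
  cost-sum : ∀ c {A a A'} {F : Forest n} (e : Emb G A a F A') →
    sumOver A c ≡ cost c e + sumOver A' c
  cost-sum c nil = refl
  cost-sum c {A} {A' = A''} (cons {A' = A'} b Ab _ e f) = begin
    sumOver A c ≡⟨ sumOver-∸-δ A b c Ab ⟩
    c b + sumOver (A ∖ (_== b)) c ≡⟨ cong (c b +_) (cost-sum c e) ⟩
    c b + (cost c e + sumOver A' c) ≡⟨ +-assoc (c b) _ _ ⟨
    c b + cost c e + sumOver A' c ≡⟨ cong (c b + cost c e +_) (cost-sum c f) ⟩
    c b + cost c e + (cost c f + sumOver A'' c) ≡⟨ +-assoc (c b + cost c e) _ _ ⟨
    c b + cost c e + cost c f + sumOver A'' c ∎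
    where open ≡-Reasoning

  cost-1 : ∀ {A a A'} {F : Forest n} (e : Emb G A a F A') → cost (λ _ → 1) e ≡ size F
  cost-1 nil = refl
  cost-1 (cons b _ _ e f) = cong₂ (λ p q → suc (p + q)) (cost-1 e) (cost-1 f)

  card-Emb : ∀ {A a A'} {F : Forest n} (e : Emb G A a F A') → card A ≡ size F + card A'
  card-Emb {A} {A' = A'} e = begin
    card A ≡⟨ sumOver-1 A ⟨
    sumOver A (λ _ → 1) ≡⟨ cost-sum (λ _ → 1) e ⟩
    cost (λ _ → 1) e + sumOver A' (λ _ → 1) ≡⟨ cong₂ _+_ (cost-1 e) (sumOver-1 A') ⟩
    _ ∎
    where open ≡-Reasoning

  Emb-⊆ : ∀ {A a A'} {F : Forest n} → Emb G A a F A' → A' ⊆ A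
  Emb-⊆ nil v h = h
  Emb-⊆ {A} (cons b _ _ e f) v h = proj₁ (∧⁻ (A v) (Emb-⊆ e v (Emb-⊆ f v h)))

∖-==-⊆ : ∀ {N} {A U : Fin N → Bool} (b : Fin N) → A ⊆ U → (A ∖ (_== b)) ⊆ U
∖-==-⊆ {A = A} b s v h = s v (proj₁ (∧⁻ (A v) h))

-- Room A U k S: A misses at most S - k vertices of U, so that k more may be used.
Room : ∀ {N} → (A U : Fin N → Bool) → ℕ → ℕ → Set
Room A U k S = card U + k ≤ card A + S

room-∸ : ∀ {N} {A U : Fin N → Bool} {k S} b → T (A b) → Room A U (suc k) S → Room (A ∖ (_== b)) U k S
room-∸ {A = A} {U} {k} {S} b Ab h = s≤s⁻¹ (subst₂ _≤_ (+-suc (card U) k) (cong (_+ S) (card-∸-δ A b Ab)) h)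

room-Emb : ∀ {N n} {G : Digraph N} {A U : Fin N → Bool} {A' a} {F : Forest n} {k S} →
  Emb G A a F A' → Room A U (size F + k) S → Room A' U k S
room-Emb {A = A} {U} {A'} {F = F} {k} {S} e h = lin h (≤-reflexive
  (trans (cong (λ z → card U + k + (z + S)) (card-Emb e)) (eq (card U) k (size F) (card A') S)))
  where
  eq : ∀ u k f a s → u + k + (f + a + s) ≡ a + s + (u + (f + k))
  eq = solve-∀

room-weaken : ∀ {N} {A U : Fin N → Bool} {k l S} → l ≤ k → Room A U k S → Room A U l S
room-weaken {U = U} l≤k h = ≤-trans (+-monoʳ-≤ (card U) l≤k) h

-- Random walk along a regular digraph: cost-to-go functions

module Walk {N n : ℕ} (G : Digraph N) (U : Fin N → Bool) (c : Fin N → ℕ) (S r' : ℕ) (0<r' : 0 < r')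
  (D : Fin N → Fin N → Bool)
  (D⊆ : ∀ a b → T (D a b) → T (E G a b) × T (U a) × T (U b))
  (D-row : ∀ a → row D a ≡ 𝟙 (U a) * (r' + S))
  (D-col : ∀ b → col D b ≡ 𝟙 (U b) * (r' + S)) where

  private
    r : ℕ
    r = r' + S

  along : Bool → Fin N → Fin N → Bool
  along true  a b = D a b
  along false a b = D b a

  along⊆ : ∀ d a b → T (along d a b) → T (nbr G d a b) × T (U b)
  along⊆ true  a b h = proj₁ (D⊆ a b h) , proj₂ (proj₂ (D⊆ a b h))
  along⊆ false a b h = proj₁ (D⊆ b a h) , proj₁ (proj₂ (D⊆ b a h))

  along-card : ∀ d a → card (along d a) ≡ 𝟙 (U a) * r
  along-card true  = D-row
  along-card false = D-col

  along-col : ∀ d b → card (λ a → along d a b) ≡ 𝟙 (U b) * r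
  along-col true  = D-col
  along-col false = D-row

  -- The expected cost of embedding the forest below a by the random walk,
  -- scaled by r' ^ k; k bounds the height.  Weights 1/r' instead of 1/r leave
  -- room for the at most S vertices that may already be occupied.
  toGo : ℕ → Forest n → Fin N → ℕ
  toGo k nil a = 0
  -- A default outside the range of use: `embed-cheaply` requires `size F ≤ k`.
  toGo zero (cons d x sub rest) a = 0
  toGo (suc k) (cons d x sub rest) a =
    sumOver (along d a) (λ w → r' ^ k * c w + toGo k sub w) + toGo (suc k) rest a

  treeCost : ℕ → Forest n → Fin N → ℕ
  treeCost k sub w = r' ^ k * c w + toGo k sub w

  -- Rows and columns of `D` both sum to `r` on `U`, so the uniform distribution is stationary for a
  -- step in either direction.
  sum-along : ∀ d φ → sumOver U (λ a → sumOver (along d a) φ) ≤ r * sumOver U φ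
  sum-along d φ = begin
    sumOver U (λ a → sumOver (along d a) φ)
      ≤⟨ sum-mono (λ a → ≤-trans (*-monoˡ-≤ (sumOver (along d a) φ) (𝟙≤1 (U a)))
           (≤-reflexive (*-identityˡ _))) ⟩
    sum (λ a → sum (λ w → 𝟙 (along d a w) * φ w))
      ≡⟨ ∑-comm (λ a w → 𝟙 (along d a w) * φ w) ⟩
    sum (λ w → sum (λ a → 𝟙 (along d a w) * φ w))
      ≡⟨ sum-cong-≗ (λ w → sym (*-distribʳ-sum (φ w) (λ a → 𝟙 (along d a w)))) ⟩
    sum (λ w → card (λ a → along d a w) * φ w)
      ≡⟨ sum-cong-≗ (λ w → trans (cong (_* φ w) (along-col d w)) (eq (𝟙 (U w)) r (φ w))) ⟩
    sum (λ w → r * (𝟙 (U w) * φ w)) ≡⟨ *-distribˡ-sum r (λ w → 𝟙 (U w) * φ w) ⟨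
    r * sumOver U φ ∎
    where
    open ≤-Reasoning
    eq : ∀ u r f → u * r * f ≡ r * (u * f)
    eq = solve-∀

  r'^≤r^ : ∀ k → r' ^ k ≤ r ^ k
  r'^≤r^ k = ^-monoˡ-≤ k (m≤m+n r' S)

  -- Linearity of expectation: each vertex of `F` is uniformly distributed and contributes the
  -- average price. The factor `r ^ k` in place of `r' ^ k` is what the weights 1/r' lose.
  sum-toGo : ∀ k F → sumOver U (toGo k F) ≤ r ^ k * (size F * sumOver U c)
  sum-treeCost : ∀ k F → sumOver U (treeCost k F) ≤ r ^ k * (suc (size F) * sumOver U c)

  sum-toGo k nil = ≤-trans (≤-reflexive (trans (sumOver-const U 0) (*-zeroʳ (card U)))) z≤n
  sum-toGo zero (cons d x sub rest) =
    ≤-trans (≤-reflexive (trans (sumOver-const U 0) (*-zeroʳ (card U)))) z≤n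
  sum-toGo (suc k) (cons d x sub rest) = begin
    sumOver U (toGo (suc k) (cons d x sub rest))
      ≡⟨ sumOver-+ U (λ a → sumOver (along d a) (treeCost k sub)) (toGo (suc k) rest) ⟩
    sumOver U (λ a → sumOver (along d a) (treeCost k sub)) + sumOver U (toGo (suc k) rest)
      ≤⟨ +-mono-≤ (≤-trans (sum-along d (treeCost k sub)) (*-monoʳ-≤ r (sum-treeCost k sub)))
           (sum-toGo (suc k) rest) ⟩
    r * (r ^ k * (suc (size sub) * sumOver U c)) + r * r ^ k * (size rest * sumOver U c)
      ≡⟨ eq r (r ^ k) (size sub) (size rest) (sumOver U c) ⟩
    r * r ^ k * (suc (size sub + size rest) * sumOver U c) ∎
    where
    open ≤-Reasoning
    eq : ∀ r q s t A → r * (q * ((1 + s) * A)) + r * q * (t * A) ≡ r * q * ((1 + (s + t)) * A)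
    eq = solve-∀

  sum-treeCost k F = begin
    sumOver U (treeCost k F) ≡⟨ sumOver-+ U (λ w → r' ^ k * c w) (toGo k F) ⟩
    sumOver U (λ w → r' ^ k * c w) + sumOver U (toGo k F)
      ≡⟨ cong (_+ sumOver U (toGo k F)) (sumOver-* U (r' ^ k) c) ⟩
    r' ^ k * sumOver U c + sumOver U (toGo k F)
      ≤⟨ +-mono-≤ (*-monoˡ-≤ (sumOver U c) (r'^≤r^ k)) (sum-toGo k F) ⟩
    r ^ k * sumOver U c + r ^ k * (size F * sumOver U c)
      ≡⟨ *-distribˡ-+ (r ^ k) (sumOver U c) _ ⟨
    r ^ k * (suc (size F) * sumOver U c) ∎
    where open ≤-Reasoning

  -- The method of conditional expectations. At least `r'` of the `r` vertices in `along d a` are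
  -- still available, so `r'` times the least cost-to-go among them is at most the full sum in
  -- `toGo`.
  embed-cheaply : ∀ k F {A} a → size F ≤ k → A ⊆ U → Room A U (size F) S → T (U a) →
    ∃ λ A' → Σ (Emb G A a F A') λ e → cost c e * r' ^ k ≤ toGo k F a
  embed-cheaply k nil a _ _ _ _ = _ , nil , z≤n
  embed-cheaply (suc k) (cons d x sub rest) {A} a (s≤s sz) A⊆U room Ua =
    let w , A∩w , φw≤ = below-average (A ∩ along d a) (treeCost k sub) (≤-trans 0<r' many)
        Aw , aw = ∧⁻ (A w) A∩w
        room₁ = room-∸ {A = A} {U} w Aw room
        A₁ , e₁ , c₁ = embed-cheaply k sub w (m+n≤o⇒m≤o (size sub) sz) (∖-==-⊆ {A = A} w A⊆U)
          (room-weaken {A = A ∖ (_== w)} {U} (m≤m+n (size sub) (size rest)) room₁) (A⊆U w Aw)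
        A₁⊆U = λ v h → ∖-==-⊆ {A = A} w A⊆U v (Emb-⊆ e₁ v h)
        A₂ , e₂ , c₂ = embed-cheaply (suc k) rest a
          (≤-trans (m+n≤o⇒n≤o (size sub) sz) (n≤1+n k)) A₁⊆U (room-Emb {U = U} e₁ room₁) Ua
    in A₂ , cons w Aw (proj₁ (along⊆ d a w aw)) e₁ e₂ ,
       (begin
         (c w + cost c e₁ + cost c e₂) * (r' * r' ^ k)
           ≡⟨ eq (c w) (cost c e₁) (cost c e₂) r' (r' ^ k) ⟩
         r' * (r' ^ k * c w + cost c e₁ * r' ^ k) + cost c e₂ * (r' * r' ^ k)
           ≤⟨ +-mono-≤ (*-monoʳ-≤ r' (+-monoʳ-≤ (r' ^ k * c w) c₁)) c₂ ⟩
         r' * treeCost k sub w + toGo (suc k) rest a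
           ≤⟨ +-monoˡ-≤ (toGo (suc k) rest a) (≤-trans (*-monoˡ-≤ (treeCost k sub w) many)
                (≤-trans φw≤ (sumOver-⊆ {X = A ∩ along d a} {along d a} (λ v h → proj₂ (∧⁻ (A v) h)) (treeCost k sub)))) ⟩
         toGo (suc k) (cons d x sub rest) a ∎)
    where
    open ≤-Reasoning
    eq : ∀ w e f r q → (w + e + f) * (r * q) ≡ r * (q * w + e * q) + f * (r * q)
    eq = solve-∀
    many : r' ≤ card (A ∩ along d a)
    many = lin (+-mono-≤ {card U} {card A + S} (≤-trans (m≤m+n (card U) _) room)
        (≤-trans (≤-reflexive (cong (card A +_) (sym (trans (along-card d a) (trans (cong (_* r) (𝟙-true Ua)) (*-identityˡ r))))))
          (card-∩-lower {U = U} {A} {along d a} A⊆U (λ v h → proj₂ (along⊆ d a v h)))))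
      (≤-reflexive (eq' r' (card U) (card A) S (card (A ∩ along d a))))
      where
      eq' : ∀ r' u a s m → r' + (a + s + (u + m)) ≡ m + (u + (a + (r' + s)))
      eq' = solve-∀

-- Connecting a tree to a prescribed parent

roots : ∀ {n} → Forest n → ℕ
roots nil = 0
roots (cons d x sub rest) = suc (roots rest)

data Branching {n} (Δ : ℕ) : Forest n → Set where
  nil  : Branching Δ nil
  cons : ∀ {d x sub rest} → roots sub ≤ Δ → Branching Δ sub → Branching Δ rest →
    Branching Δ (cons d x sub rest)

-- The geometric sum 1 + Δ + ... + Δ^(h-1): a bound for the top `h` levels of a tree.
ballSize : ℕ → ℕ → ℕ
ballSize Δ zero    = 0
ballSize Δ (suc h) = 1 + Δ * ballSize Δ h

-- L sub is the set of positions from which a tree with root forest sub can be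
-- embedded at no more than about the average price (κ and β are the scale).
module Connect {N n : ℕ} (G : Digraph N) (U : Fin N → Bool) (c : Fin N → ℕ) (S W κ β ν g' f : ℕ)
  (g-eq : suc g' ≡ 2 * ν)
  (c≤W : ∀ w → c w ≤ W)
  (L : Forest n → Fin N → Bool)
  (L⊆U : ∀ sub → L sub ⊆ U)
  (L-large : ∀ sub → card U ≤ card (L sub) * f)
  (from-L : ∀ sub {A : Fin N → Bool} w → T (L sub w) → T (A w) → A ⊆ U → Room A U (suc (size sub)) S →
    ∃ λ A' → Σ (Emb G (A ∖ (_== w)) w sub A') λ e → (c w + cost c e) * κ ≤ suc (size sub) * β)
  (common : ∀ A a d w d' → A ⊆ U → Room A U 0 S →
    card U ≤ ν * card ((A ∩ nbr G d a) ∩ nbr G d' w))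
  (S-small : S * (suc g' * f) < card U) where

  private
    g : ℕ
    g = suc g'

  0<U : 0 < card U
  0<U = ≤-<-trans z≤n S-small

  0<L : ∀ (sub : Forest n) → 0 < card (L sub)
  0<L sub with card (L sub) | L-large sub
  ... | zero  | h = ⊥-elim (<⇒≱ 0<U h)
  ... | suc _ | _ = z<s

  pool : (Fin N → Bool) → Bool → Fin N → Fin N → Bool
  pool A d a = A ∩ nbr G d a

  pool-nonempty : ∀ A d a → A ⊆ U → Room A U 0 S → 0 < card (pool A d a)
  pool-nonempty A d a A⊆U room with card (pool A d a) in eq
  ... | suc _ = z<s
  ... | zero  = ⊥-elim (<⇒≱ 0<U (≤-trans (common A a d a d A⊆U room)
    (≤-trans (*-monoʳ-≤ ν (≤-trans (card-mono {X = pool A d a ∩ nbr G d a} {pool A d a}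
        (λ v h → proj₁ (∧⁻ (pool A d a v) h))) (≤-reflexive eq)))
      (≤-reflexive (*-zeroʳ ν)))))

  -- The threshold 1/g = 1/(2ν) is half of 1/ν, which bounds from below the average proportion of
  -- `L sub` seen from a pool of candidates.
  good : Bool → Forest n → Fin N → Bool
  good d sub z = card (L sub) ≤ᵇ g * card (L sub ∩ nbr G d z)

  badWeight : Forest n → Fin N → ℕ
  badWeight nil z = 0
  badWeight (cons d x sub rest) z = 𝟙 (not (good d sub z)) * suc (size sub) + badWeight rest z

  -- Double counting of the adjacent pairs between `Z` and `L sub`. Each member of `L sub` sees at
  -- least `card U / ν` of `Z`, while a bad vertex lies in fewer than `card (L sub) / g` pairs; as g
  -- = 2ν, bad vertices account for at most half of the guaranteed pairs.
  few-bad : ∀ {Z} → Z ⊆ U → (∀ w d → card U ≤ ν * card (Z ∩ nbr G d w)) →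
    ∀ d (sub : Forest n) → g * card (Z ∖ good d sub) ≤ g' * card Z
  few-bad {Z} Z⊆U comm d sub = lin {a = card Z} {g * cg} z≤ (≤-reflexive
      (trans (eq g' cb cg) (cong (λ z → g' * z + z) (sym split))))
    where
    open ≤-Reasoning
    l = card (L sub)
    cg = card (Z ∩ good d sub)
    cb = card (Z ∖ good d sub)
    split : card Z ≡ cg + cb
    split = card-split Z (good d sub)
    eq : ∀ g' b k → (1 + g') * b + (1 + g') * k ≡ g' * (k + b) + (k + b)
    eq = solve-∀
    pairs# : ℕ
    pairs# = sumOver Z (λ z → card (L sub ∩ nbr G d z))
    lower : l * card U ≤ ν * pairs#
    lower = begin
      l * card U ≡⟨ sumOver-const (L sub) (card U) ⟨
      sumOver (L sub) (λ _ → card U) ≤⟨ sumOver-mono (L sub) (λ w _ → comm w (not d)) ⟩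
      sumOver (L sub) (λ w → ν * card (Z ∩ nbr G (not d) w)) ≡⟨ sumOver-* (L sub) ν _ ⟩
      ν * sumOver (L sub) (λ w → card (Z ∩ nbr G (not d) w))
        ≡⟨ cong (ν *_) (sumOver-cong (L sub) λ w _ → trans (card-∩ Z (nbr G (not d) w))
             (sumOver-cong Z λ z _ → cong 𝟙 (nbr-flip G d z w))) ⟩
      ν * sumOver (L sub) (λ w → sumOver Z (λ z → 𝟙 (nbr G d z w)))
        ≡⟨ cong (ν *_) (sumOver-swap (L sub) Z (λ w z → 𝟙 (nbr G d z w))) ⟩
      ν * sumOver Z (λ z → sumOver (L sub) (λ w → 𝟙 (nbr G d z w)))
        ≡⟨ cong (ν *_) (sumOver-cong Z λ z _ → card-∩ (L sub) (nbr G d z)) ⟨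
      ν * pairs# ∎
    pointwise : ∀ z → g * card (L sub ∩ nbr G d z) ≤
      𝟙 (good d sub z) * (g * l) + 𝟙 (not (good d sub z)) * l
    pointwise z with good d sub z in is-good
    ... | true = ≤-trans (*-monoʳ-≤ g (card-mono {X = L sub ∩ nbr G d z} {L sub}
            λ v h → proj₁ (∧⁻ (L sub v) h)))
          (≤-reflexive (sym (trans (+-identityʳ _) (+-identityʳ (g * l)))))
    ... | false = ≤-trans (<⇒≤ (≰⇒> λ h → subst T is-good (≤⇒≤ᵇ h)))
          (≤-reflexive (sym (+-identityʳ l)))
    upper : g * pairs# ≤ l * (g * cg + cb)
    upper = begin
      g * pairs# ≡⟨ sumOver-* Z g _ ⟨
      sumOver Z (λ z → g * card (L sub ∩ nbr G d z)) ≤⟨ sumOver-mono Z (λ z _ → pointwise z) ⟩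
      sumOver Z (λ z → 𝟙 (good d sub z) * (g * l) + 𝟙 (not (good d sub z)) * l)
        ≡⟨ sumOver-+ Z (λ z → 𝟙 (good d sub z) * (g * l)) (λ z → 𝟙 (not (good d sub z)) * l) ⟩
      sumOver Z (λ z → 𝟙 (good d sub z) * (g * l)) + sumOver Z (λ z → 𝟙 (not (good d sub z)) * l)
        ≡⟨ cong₂ _+_ (sumOver-∩ Z (good d sub) (λ _ → g * l)) (sumOver-∩ Z (not ∘ good d sub) (λ _ → l)) ⟨
      sumOver (Z ∩ good d sub) (λ _ → g * l) + sumOver (Z ∖ good d sub) (λ _ → l)
        ≡⟨ cong₂ _+_ (sumOver-const (Z ∩ good d sub) (g * l)) (sumOver-const (Z ∖ good d sub) l) ⟩
      cg * (g * l) + cb * l ≡⟨ eq' cg g l cb ⟩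
      l * (g * cg + cb) ∎
      where
      eq' : ∀ k g l b → k * (g * l) + b * l ≡ l * (g * k + b)
      eq' = solve-∀
    2u≤ : 2 * card U ≤ g * cg + cb
    2u≤ = *-cancelˡ-≤ l ⦃ >-nonZero (0<L sub) ⦄ (begin
      l * (2 * card U) ≡⟨ eq' l (card U) ⟩
      2 * (l * card U) ≤⟨ *-monoʳ-≤ 2 lower ⟩
      2 * (ν * pairs#) ≡⟨ trans (cong (_* pairs#) g-eq) (*-assoc 2 ν pairs#) ⟨
      g * pairs# ≤⟨ upper ⟩
      l * (g * cg + cb) ∎)
      where
      eq' : ∀ l u → l * (2 * u) ≡ 2 * (l * u)
      eq' = solve-∀
    z≤ : card Z ≤ g * cg
    z≤ = +-cancelʳ-≤ (card Z) _ _ (begin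
      card Z + card Z ≡⟨ cong (card Z +_) (+-identityʳ (card Z)) ⟨
      2 * card Z ≤⟨ *-monoʳ-≤ 2 (card-mono Z⊆U) ⟩
      2 * card U ≤⟨ 2u≤ ⟩
      g * cg + cb ≤⟨ +-monoʳ-≤ (g * cg) (m+n≤o⇒n≤o cg (≤-reflexive (sym split))) ⟩
      g * cg + card Z ∎)

  average-bad : ∀ {Z} → Z ⊆ U → (∀ w d → card U ≤ ν * card (Z ∩ nbr G d w)) →
    ∀ (F : Forest n) → g * sumOver Z (badWeight F) ≤ g' * card Z * size F
  average-bad {Z} Z⊆U comm nil = ≤-reflexive (trans (cong (g *_)
    (trans (sumOver-const Z 0) (*-zeroʳ (card Z))))
    (trans (*-zeroʳ g) (sym (*-zeroʳ (g' * card Z)))))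
  average-bad {Z} Z⊆U comm (cons d x sub rest) = begin
    g * sumOver Z (badWeight (cons d x sub rest))
      ≡⟨ cong (g *_) (sumOver-+ Z (λ z → 𝟙 (not (good d sub z)) * s) (badWeight rest)) ⟩
    g * (sumOver Z (λ z → 𝟙 (not (good d sub z)) * s) + sumOver Z (badWeight rest))
      ≡⟨ cong (λ k → g * (k + sumOver Z (badWeight rest)))
           (trans (sym (sumOver-∩ Z (not ∘ good d sub) (λ _ → s))) (sumOver-const (Z ∖ good d sub) s)) ⟩
    g * (card (Z ∖ good d sub) * s + sumOver Z (badWeight rest))
      ≡⟨ eq g (card (Z ∖ good d sub)) s _ ⟩
    g * card (Z ∖ good d sub) * s + g * sumOver Z (badWeight rest)
      ≤⟨ +-mono-≤ (*-monoˡ-≤ s (few-bad Z⊆U comm d sub)) (average-bad Z⊆U comm rest) ⟩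
    g' * card Z * s + g' * card Z * size rest ≡⟨ *-distribˡ-+ (g' * card Z) s (size rest) ⟨
    g' * card Z * (suc (size sub + size rest)) ∎
    where
    open ≤-Reasoning
    s = suc (size sub)
    eq : ∀ g a s b → g * (a * s + b) ≡ g * a * s + g * b
    eq = solve-∀

  -- Averaging the total weight, not the trees one by one, lets a single `z` serve all trees of `F`
  -- at once.
  choose : ∀ (F : Forest n) A d a → A ⊆ U → Room A U 0 S →
    ∃ λ z → T (A z) × T (nbr G d a z) × g * badWeight F z ≤ g' * size F
  choose F A d a A⊆U room =
    let z , Zz , le = below-average Z (badWeight F) 0<Z
        Az , az = ∧⁻ (A z) Zz
    in z , Az , az , *-cancelˡ-≤ (card Z) ⦃ >-nonZero 0<Z ⦄ (begin
         card Z * (g * badWeight F z) ≡⟨ eq (card Z) g (badWeight F z) ⟩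
         g * (card Z * badWeight F z) ≤⟨ *-monoʳ-≤ g le ⟩
         g * sumOver Z (badWeight F)
           ≤⟨ average-bad (λ v h → A⊆U v (proj₁ (∧⁻ (A v) h)))
                (λ w d' → common A a d w d' A⊆U room) F ⟩
         g' * card Z * size F ≡⟨ trans (cong (_* size F) (*-comm g' (card Z))) (*-assoc (card Z) g' (size F)) ⟩
         card Z * (g' * size F) ∎)
    where
    open ≤-Reasoning
    Z = pool A d a
    0<Z = pool-nonempty A d a A⊆U room
    eq : ∀ z g b → z * (g * b) ≡ g * (z * b)
    eq = solve-∀

  -- A good vertex sees more than `S` members of `L sub`, and at most `S` vertices of `U` are
  -- occupied.
  good⇒available : ∀ A d (sub : Forest n) z → A ⊆ U → Room A U 0 S → T (good d sub z) →
    ∃ λ w → T (A w) × T (nbr G d z w) × T (L sub w)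
  good⇒available A d sub z A⊆U room h =
    -- Minimising a constant merely picks an element.
    let w , p , _ = minimum (A ∩ X) (λ _ → 0) 0<
        Aw , Xw = ∧⁻ (A w) p
        Lw , zw = ∧⁻ (L sub w) Xw
    in w , Aw , zw , Lw
    where
    open ≤-Reasoning
    X = L sub ∩ nbr G d z
    S<X : S < card X
    S<X = *-cancelʳ-< (g * f) S (card X) (begin-strict
      S * (g * f) <⟨ S-small ⟩
      card U ≤⟨ L-large sub ⟩
      card (L sub) * f ≤⟨ *-monoˡ-≤ f (≤ᵇ⇒≤ (card (L sub)) (g * card X) h) ⟩
      g * card X * f ≡⟨ eq g (card X) f ⟩
      card X * (g * f) ∎)
      where
      eq : ∀ g x f → g * x * f ≡ x * (g * f)
      eq = solve-∀
    0< : 0 < card (A ∩ X)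
    0< = lin {card A + suc S} {card A + card X} (+-monoʳ-≤ (card A) S<X)
      (begin
        1 + (card A + card X)
          ≤⟨ s≤s (card-∩-lower {U = U} {A} {X} A⊆U (λ v q → L⊆U sub v (proj₁ (∧⁻ (L sub v) q)))) ⟩
        1 + (card U + card (A ∩ X))
          ≤⟨ s≤s (+-monoˡ-≤ (card (A ∩ X)) (≤-trans (m≤m+n (card U) 0) room)) ⟩
        1 + (card A + S + card (A ∩ X)) ≡⟨ eq (card A) S (card (A ∩ X)) ⟩
        card (A ∩ X) + (card A + suc S) ∎)
      where
      eq : ∀ a s x → 1 + (a + s + x) ≡ x + (a + (1 + s))
      eq = solve-∀

  -- Pays up to the maximal price `W` per vertex; meant for the small remainder after the last
  -- level.
  greedy : ∀ (F : Forest n) A a → A ⊆ U → Room A U (size F) S →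
    ∃ λ A' → Σ (Emb G A a F A') λ e → cost c e ≤ W * size F
  greedy nil A a _ _ = A , nil , z≤n
  greedy (cons d x sub rest) A a A⊆U room =
    -- For `nil` the weight bound is void, and `choose` just supplies an available neighbour.
    let w , Aw , aw , _ = choose nil A d a A⊆U (room-weaken {A = A} {U} z≤n room)
        room₁ = room-∸ {A = A} {U} w Aw room
        A₁⊆U = ∖-==-⊆ {A = A} w A⊆U
        A₁ , e₁ , c₁ = greedy sub (A ∖ (_== w)) w A₁⊆U
          (room-weaken {A = A ∖ (_== w)} {U} (m≤m+n (size sub) (size rest)) room₁)
        A₂ , e₂ , c₂ = greedy rest A₁ a (λ v h → A₁⊆U v (Emb-⊆ e₁ v h)) (room-Emb {U = U} e₁ room₁)
    in A₂ , cons w Aw aw e₁ e₂ ,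
       ≤-trans (+-mono-≤ (+-mono-≤ (c≤W w) c₁) c₂) (≤-reflexive (eq W (size sub) (size rest)))
    where
    eq : ∀ W s t → W + W * s + W * t ≡ W * (1 + (s + t))
    eq = solve-∀

  -- cost ≤ ci + W * co, where ci is the price of the part embedded at average
  -- cost and co counts the remaining vertices.
  record Split (h size# bad# ball# cost# : ℕ) : Set where
    constructor split
    field
      ci co : ℕ
      total : cost# ≤ ci + W * co
      cheap : ci * κ ≤ size# * β
      few   : co * g ^ h ≤ g ^ h * ball# + g' ^ h * bad#

  -- The root is paid at maximal price but chosen well for its subtrees: the good ones start in `L`,
  -- the bad ones recurse. Each level multiplies the weight of the bad part by at most `g' / g`, and
  -- the roots met on the way are counted by `ballSize`.
  connect-tree : ∀ h Δ d (x : Fin n) (sub : Forest n) A a → Branching Δ sub → roots sub ≤ Δ → A ⊆ U →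
    Room A U (suc (size sub)) S →
    ∃₂ λ z A' → T (A z) × T (nbr G d a z) × Σ (Emb G (A ∖ (_== z)) z sub A') λ e →
      Split h (suc (size sub)) (suc (size sub)) (ballSize Δ h) (c z + cost c e)

  connect-forest : ∀ h Δ (F : Forest n) A z → Branching Δ F → A ⊆ U → Room A U (size F) S →
    ∃ λ A' → Σ (Emb G A z F A') λ e →
      Split h (size F) (badWeight F z) (ballSize Δ h * roots F) (cost c e)

  connect-tree zero Δ d x sub A a br ro A⊆U room =
    let z , Az , az , _ = choose nil A d a A⊆U (room-weaken {A = A} {U} z≤n room)
        room₁ = room-∸ {A = A} {U} z Az room
        A₁ , e₁ , c₁ = greedy sub (A ∖ (_== z)) z (∖-==-⊆ {A = A} z A⊆U) room₁
    -- With no levels left, the whole tree counts as expensive.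
    in z , A₁ , Az , az , e₁ , split 0 (suc (size sub))
         (≤-trans (+-mono-≤ (c≤W z) c₁) (≤-reflexive (sym (*-suc W (size sub)))))
         z≤n (≤-reflexive (eq (suc (size sub))))
    where
    eq : ∀ s → s * 1 ≡ 1 * 0 + 1 * s
    eq = solve-∀
  connect-tree (suc h) Δ d x sub A a br ro A⊆U room =
    let z , Az , az , bad = choose sub A d a A⊆U (room-weaken {A = A} {U} z≤n room)
        room₁ = room-∸ {A = A} {U} z Az room
        A₁ , e₁ , split ci co tot ch fw =
          connect-forest h Δ sub (A ∖ (_== z)) z br (∖-==-⊆ {A = A} z A⊆U) room₁
    in z , A₁ , Az , az , e₁ , split ci (suc co)
         (≤-trans (+-mono-≤ (c≤W z) tot) (≤-reflexive (eq₁ W ci co)))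
         (≤-trans ch (*-monoˡ-≤ β (n≤1+n (size sub))))
         (begin
           suc co * (g * g ^ h) ≡⟨ eq₂ co g (g ^ h) ⟩
           g * g ^ h + g * (co * g ^ h) ≤⟨ +-monoʳ-≤ (g * g ^ h) (*-monoʳ-≤ g fw) ⟩
           g * g ^ h + g * (g ^ h * (ballSize Δ h * roots sub) + g' ^ h * badWeight sub z)
             ≡⟨ eq₃ g (g ^ h) (ballSize Δ h) (roots sub) (g' ^ h) (badWeight sub z) ⟩
           g * g ^ h * (1 + roots sub * ballSize Δ h) + g' ^ h * (g * badWeight sub z)
             ≤⟨ +-mono-≤ (*-monoʳ-≤ (g * g ^ h) (s≤s (*-monoˡ-≤ (ballSize Δ h) ro)))
                  (*-monoʳ-≤ (g' ^ h) (≤-trans bad (*-monoʳ-≤ g' (n≤1+n (size sub))))) ⟩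
           g * g ^ h * ballSize Δ (suc h) + g' ^ h * (g' * suc (size sub))
             ≡⟨ cong (g * g ^ h * ballSize Δ (suc h) +_) (eq₄ (g' ^ h) g' (suc (size sub))) ⟩
           g ^ suc h * ballSize Δ (suc h) + g' ^ suc h * suc (size sub) ∎)
    where
    open ≤-Reasoning
    eq₁ : ∀ W i o → W + (i + W * o) ≡ i + W * (1 + o)
    eq₁ = solve-∀
    eq₂ : ∀ o g q → (1 + o) * (g * q) ≡ g * q + g * (o * q)
    eq₂ = solve-∀
    eq₃ : ∀ g q b r p w → g * q + g * (q * (b * r) + p * w) ≡ g * q * (1 + r * b) + p * (g * w)
    eq₃ = solve-∀
    eq₄ : ∀ p g' s → p * (g' * s) ≡ g' * p * s
    eq₄ = solve-∀

  connect-forest h Δ nil A z br A⊆U room = A , nil , split 0 0 z≤n z≤n z≤n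
  connect-forest h Δ (cons d x sub rest) A z (cons ro br br') A⊆U room with T? (good d sub z)
  ... | yes is-good =
    let w , Aw , zw , Lw = good⇒available A d sub z A⊆U (room-weaken {A = A} {U} z≤n room) is-good
        room₁ = room-∸ {A = A} {U} w Aw room
        A₁⊆U = ∖-==-⊆ {A = A} w A⊆U
        A₁ , e₁ , c₁ = from-L sub {A} w Lw Aw A⊆U
          (room-weaken {A = A} {U} (s≤s (m≤m+n (size sub) (size rest))) room)
        A₂ , e₂ , split ci co tot ch fw = connect-forest h Δ rest A₁ z br'
          (λ v q → A₁⊆U v (Emb-⊆ e₁ v q)) (room-Emb {U = U} e₁ room₁)
    in A₂ , cons w Aw zw e₁ e₂ , split (c w + cost c e₁ + ci) co
         (≤-trans (+-monoʳ-≤ (c w + cost c e₁) tot) (≤-reflexive (sym (+-assoc (c w + cost c e₁) ci _))))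
         (begin
           (c w + cost c e₁ + ci) * κ ≡⟨ *-distribʳ-+ κ (c w + cost c e₁) ci ⟩
           (c w + cost c e₁) * κ + ci * κ ≤⟨ +-mono-≤ c₁ ch ⟩
           suc (size sub) * β + size rest * β ≡⟨ *-distribʳ-+ β (suc (size sub)) (size rest) ⟨
           suc (size sub + size rest) * β ∎)
         (≤-trans fw (+-mono-≤ (*-monoʳ-≤ (g ^ h) (*-monoʳ-≤ (ballSize Δ h) (n≤1+n (roots rest))))
           (*-monoʳ-≤ (g' ^ h) (m≤n+m (badWeight rest z) _))))
    where open ≤-Reasoning
  ... | no not-good =
    let w , A₁ , Aw , zw , e₁ , split ci₁ co₁ tot₁ ch₁ fw₁ =
          connect-tree h Δ d x sub A z br ro A⊆U
            (room-weaken {A = A} {U} (s≤s (m≤m+n (size sub) (size rest))) room)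
        room₁ = room-∸ {A = A} {U} w Aw room
        A₁⊆U = ∖-==-⊆ {A = A} w A⊆U
        A₂ , e₂ , split ci co tot ch fw = connect-forest h Δ rest A₁ z br'
          (λ v q → A₁⊆U v (Emb-⊆ e₁ v q)) (room-Emb {U = U} e₁ room₁)
    in A₂ , cons w Aw zw e₁ e₂ , split (ci₁ + ci) (co₁ + co)
         (≤-trans (+-mono-≤ tot₁ tot) (≤-reflexive (eq₁ ci₁ ci W co₁ co)))
         (begin
           (ci₁ + ci) * κ ≡⟨ *-distribʳ-+ κ ci₁ ci ⟩
           ci₁ * κ + ci * κ ≤⟨ +-mono-≤ ch₁ ch ⟩
           suc (size sub) * β + size rest * β ≡⟨ *-distribʳ-+ β (suc (size sub)) (size rest) ⟨
           suc (size sub + size rest) * β ∎)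
         (begin
           (co₁ + co) * g ^ h ≡⟨ *-distribʳ-+ (g ^ h) co₁ co ⟩
           co₁ * g ^ h + co * g ^ h ≤⟨ +-mono-≤ fw₁ fw ⟩
           (g ^ h * ballSize Δ h + g' ^ h * suc (size sub)) +
             (g ^ h * (ballSize Δ h * roots rest) + g' ^ h * badWeight rest z)
             ≡⟨ eq₂ (g ^ h) (ballSize Δ h) (g' ^ h) (suc (size sub)) (roots rest) (badWeight rest z) ⟩
           g ^ h * (ballSize Δ h * suc (roots rest)) + g' ^ h * (1 * suc (size sub) + badWeight rest z)
             ≡⟨ cong (λ k → g ^ h * (ballSize Δ h * suc (roots rest)) + g' ^ h * (k * suc (size sub) + badWeight rest z))
                  (sym (𝟙-true (not⁺ not-good))) ⟩
           g ^ h * (ballSize Δ h * suc (roots rest)) + g' ^ h * badWeight (cons d x sub rest) z ∎)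
    where
    open ≤-Reasoning
    eq₁ : ∀ i j W o p → i + W * o + (j + W * p) ≡ i + j + W * (o + p)
    eq₁ = solve-∀
    eq₂ : ∀ q b p s r w → (q * b + p * s) + (q * (b * r) + p * w) ≡ q * (b * (1 + r)) + p * (1 * s + w)
    eq₂ = solve-∀

-- Embedding one tree cheaply

-- Bernoulli's inequality for (1 - t/(x+t))^k, with `w` in the role of x + t - k t.
bernoulli-reverse : ∀ k x t w → w + k * t ≡ x + t → (x + t) ^ k * w ≤ x ^ k * (x + t)
bernoulli-reverse zero x t w e = ≤-reflexive (cong (1 *_) (trans (sym (+-identityʳ w)) e))
bernoulli-reverse (suc k) x t w e = begin
  (x + t) * (x + t) ^ k * w ≡⟨ eq₁ (x + t) ((x + t) ^ k) w ⟩
  (x + t) ^ k * ((x + t) * w) ≤⟨ *-monoʳ-≤ ((x + t) ^ k) (begin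
     (x + t) * w ≡⟨ eq₂ x t w ⟩
     x * w + w * t ≤⟨ +-monoʳ-≤ (x * w) (*-monoˡ-≤ t w≤x) ⟩
     x * w + x * t ≡⟨ *-distribˡ-+ x w t ⟨
     x * (w + t) ∎) ⟩
  (x + t) ^ k * (x * (w + t)) ≡⟨ eq₃ ((x + t) ^ k) x (w + t) ⟩
  x * ((x + t) ^ k * (w + t)) ≤⟨ *-monoʳ-≤ x (bernoulli-reverse k x t (w + t)
     (trans (+-assoc w t (k * t)) e)) ⟩
  x * (x ^ k * (x + t)) ≡⟨ *-assoc x (x ^ k) (x + t) ⟨
  x * x ^ k * (x + t) ∎
  where
  open ≤-Reasoning
  eq₁ : ∀ y q w → y * q * w ≡ q * (y * w)
  eq₁ = solve-∀
  eq₂ : ∀ x t w → (x + t) * w ≡ x * w + w * t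
  eq₂ = solve-∀
  eq₃ : ∀ q x w → q * (x * w) ≡ x * (q * w)
  eq₃ = solve-∀
  w≤x : w ≤ x
  w≤x = +-cancelʳ-≤ t w x (≤-trans (≤-trans (m≤m+n (w + t) (k * t))
    (≤-reflexive (+-assoc w t (k * t)))) (≤-reflexive e))

-- Serves twice: for the passage from `r'` to `r` over `S` levels, and for the growth of the
-- potential over all pieces.
pow-ratio : ∀ k x t y → 0 < x + t → k * t * suc y ≤ x + t → (x + t) ^ k * y ≤ suc y * x ^ k
pow-ratio k x t y pos h = *-cancelʳ-≤ _ _ (x + t) ⦃ >-nonZero pos ⦄ (begin
  (x + t) ^ k * y * (x + t) ≡⟨ *-assoc ((x + t) ^ k) y (x + t) ⟩
  (x + t) ^ k * (y * (x + t)) ≤⟨ *-monoʳ-≤ ((x + t) ^ k) small ⟩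
  (x + t) ^ k * (w * suc y) ≡⟨ *-assoc ((x + t) ^ k) w (suc y) ⟨
  (x + t) ^ k * w * suc y ≤⟨ *-monoˡ-≤ (suc y) (bernoulli-reverse k x t w w+) ⟩
  x ^ k * (x + t) * suc y ≡⟨ eq (x ^ k) (x + t) (suc y) ⟩
  suc y * x ^ k * (x + t) ∎)
  where
  open ≤-Reasoning
  w = x + t ∸ k * t
  w+ : w + k * t ≡ x + t
  w+ = m∸n+n≡m (≤-trans (m≤m*n (k * t) (suc y)) h)
  eq : ∀ q z y → q * z * y ≡ y * q * z
  eq = solve-∀
  small : y * (x + t) ≤ w * suc y
  small = lin h (≤-reflexive (trans (cong (λ z → y * z + z) (sym w+)) (trans (eq' w (k * t) y) (cong (λ z → w * suc y + k * t * suc y) w+))))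
    where
    eq' : ∀ w p y → y * (w + p) + (w + p) ≡ w * (1 + y) + p * (1 + y)
    eq' = solve-∀

0<^ : ∀ {x} k → 0 < x → 0 < x ^ k
0<^ zero _ = z<s
0<^ {x} (suc k) p = *-mono-< p (0<^ {x} k p)

module CheapTree {N n : ℕ} (G : Digraph N) (U : Fin N → Bool) (c : Fin N → ℕ) (B S W y g' : ℕ)
  (0<B : 0 < B) (g-eq : suc g' ≡ 2 * (4 * B))
  (degrees : ∀ a d → card U * (2 * B + 1) ≤ 4 * B * card (U ∩ nbr G d a))
  (c≤W : ∀ w → c w ≤ W)
  (W-avg : W * card U ≤ 2 * sumOver U c)
  (0<y : 0 < y) (0<S : 0 < S)
  (U-large : 8 * B * (S * S * suc y + S) < card U) where

  private
    u A r' r k : ℕ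
    u = card U
    A = sumOver U c
    -- Large enough for (1 + S/r')^S ≤ 1 + 1/y, where the exponent `S` bounds the size of a piece.
    r' = S * S * suc y
    r = r' + S
    k = S

    0<r' : 0 < r'
    0<r' = *-mono-< (*-mono-< 0<S 0<S) z<s

    4≤8 : 4 ≤ 8
    4≤8 = s≤s (s≤s (s≤s (s≤s z≤n)))

    4Br≤u : 4 * B * r ≤ u
    4Br≤u = ≤-trans (≤-trans (*-monoˡ-≤ r (*-monoˡ-≤ B 4≤8))
      (n≤1+n _)) U-large

  inside : Fin N → Fin N → Bool
  inside a b = E G a b ∧ (U a ∧ U b)

  row-inside : ∀ a → T (U a) → row inside a ≡ card (U ∩ nbr G true a)
  row-inside a Ua = sum-cong-≗ λ b → cong 𝟙 (aux (E G a b) (U a) (U b) Ua)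
    where
    aux : ∀ e x z → T x → e ∧ (x ∧ z) ≡ z ∧ e
    aux true true true _ = refl
    aux true true false _ = refl
    aux false x true _ = refl
    aux false x false _ = refl

  col-inside : ∀ b → T (U b) → col inside b ≡ card (U ∩ nbr G false b)
  col-inside b Ub = sum-cong-≗ λ a → cong 𝟙 (aux (E G a b) (U a) (U b) Ub)
    where
    aux : ∀ e x z → T z → e ∧ (x ∧ z) ≡ x ∧ e
    aux true true true _ = refl
    aux true false true _ = refl
    aux false true z _ = refl
    aux false false z _ = refl

  -- The surplus u/(4B) of every degree over u/2 pays for `r`.
  degree-inside : ∀ a d → u + 2 * r ≤ 2 * card (U ∩ nbr G d a)
  degree-inside a d = *-cancelˡ-≤ (2 * B) ⦃ >-nonZero (*-mono-< {0} {2} z<s 0<B) ⦄ (begin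
    2 * B * (u + 2 * r) ≡⟨ eq B u r ⟩
    2 * B * u + 4 * B * r ≤⟨ +-monoʳ-≤ (2 * B * u) 4Br≤u ⟩
    2 * B * u + u ≡⟨ eq' B u ⟩
    u * (2 * B + 1) ≤⟨ degrees a d ⟩
    4 * B * card (U ∩ nbr G d a) ≡⟨ eq'' B (card (U ∩ nbr G d a)) ⟩
    2 * B * (2 * card (U ∩ nbr G d a)) ∎)
    where
    open ≤-Reasoning
    eq : ∀ B u r → 2 * B * (u + 2 * r) ≡ 2 * B * u + 4 * B * r
    eq = solve-∀
    eq' : ∀ B u → 2 * B * u + u ≡ u * (2 * B + 1)
    eq' = solve-∀
    eq'' : ∀ B x → 4 * B * x ≡ 2 * B * (2 * x)
    eq'' = solve-∀

  regularPart = Regular.regular U inside r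
    (λ a b h → ∧⁻ (U a) (proj₂ (∧⁻ (E G a b) h)))
    (λ a Ua → subst (λ x → u + 2 * r ≤ 2 * x) (sym (row-inside a Ua)) (degree-inside a true))
    (λ b Ub → subst (λ x → u + 2 * r ≤ 2 * x) (sym (col-inside b Ub)) (degree-inside b false))

  D : Fin N → Fin N → Bool
  D = proj₁ regularPart

  D⊆G : ∀ a b → T (D a b) → T (E G a b) × T (U a) × T (U b)
  D⊆G a b h = let p , q = ∧⁻ (E G a b) (proj₁ (proj₂ regularPart) a b h) in p , ∧⁻ (U a) q

  open Walk {n = n} G U c S r' 0<r' D D⊆G
    (proj₁ (proj₂ (proj₂ regularPart)))
    (proj₂ (proj₂ (proj₂ regularPart)))

  ceiling : Forest n → ℕ
  ceiling sub = r ^ k * (suc (size sub) * A)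

  -- `ceiling sub / u` bounds the average of `treeCost k sub` on `U`; the test allows a factor 1 +
  -- 1/y above it.
  cheapAt : Forest n → Fin N → Bool
  cheapAt sub w = U w ∧ (treeCost k sub w * (u * y) ≤ᵇ suc y * ceiling sub)

  -- Markov's inequality for the cost-to-go.
  cheap-large : ∀ sub → u ≤ card (cheapAt sub) * suc y
  cheap-large sub = lin {b * suc y} {u * y} few (≤-reflexive
      (trans (eq u y) (trans (cong (_* suc y) split) (*-distribʳ-+ (suc y) l b))))
    where
    open ≤-Reasoning
    X = ceiling sub
    P : Fin N → Bool
    P w = treeCost k sub w * (u * y) ≤ᵇ suc y * X
    l = card (U ∩ P)
    b = card (U ∖ P)
    split : u ≡ l + b
    split = card-split U P
    eq : ∀ u y → u + u * y ≡ u * (1 + y)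
    eq = solve-∀
    markov : b * suc (suc y * X) ≤ u * y * X
    markov = begin
      b * suc (suc y * X) ≡⟨ sumOver-const (U ∖ P) (suc (suc y * X)) ⟨
      sumOver (U ∖ P) (λ _ → suc (suc y * X))
        ≤⟨ sumOver-mono (U ∖ P) (λ w h → ≰⇒> λ le → not⁻ (proj₂ (∧⁻ (U w) h)) (≤⇒≤ᵇ le)) ⟩
      sumOver (U ∖ P) (λ w → treeCost k sub w * (u * y))
        ≤⟨ sumOver-⊆ {X = U ∖ P} {U} (λ w h → proj₁ (∧⁻ (U w) h)) _ ⟩
      sumOver U (λ w → treeCost k sub w * (u * y))
        ≡⟨ sumOver-cong U (λ w _ → *-comm (treeCost k sub w) (u * y)) ⟩
      sumOver U (λ w → u * y * treeCost k sub w) ≡⟨ sumOver-* U (u * y) (treeCost k sub) ⟩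
      u * y * sumOver U (treeCost k sub) ≤⟨ *-monoʳ-≤ (u * y) (sum-treeCost k sub) ⟩
      u * y * X ∎
    cancel : ∀ X → b * suc (suc y * X) ≤ u * y * X → b * suc y ≤ u * y
    -- A ceiling of 0 cannot be cancelled, but the strict inequality on the expensive set then makes
    -- this set empty.
    cancel zero h = ≤-trans (≤-reflexive (cong (_* suc y) b≡0)) z≤n
      where
      b≡0 : b ≡ 0
      b≡0 = n≤0⇒n≡0 (≤-trans (m≤m*n b (suc (suc y * 0))) (≤-trans h (≤-reflexive (*-zeroʳ (u * y)))))
    cancel (suc X) h = *-cancelʳ-≤ (b * suc y) (u * y) (suc X) (begin
      b * suc y * suc X ≡⟨ *-assoc b (suc y) (suc X) ⟩
      b * (suc y * suc X) ≤⟨ *-monoʳ-≤ b (n≤1+n _) ⟩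
      b * suc (suc y * suc X) ≤⟨ h ⟩
      u * y * suc X ∎)
    few : b * suc y ≤ u * y
    few = cancel X markov

  -- `β / κ` is the average price A/u times (1 + 1/y)^2: one factor comes from `cheapAt`, the other
  -- from `ratio`.
  κ β : ℕ
  κ = u * (y * y)
  β = suc y * suc y * A

  ratio : r ^ k * y ≤ suc y * r' ^ k
  ratio = pow-ratio k r' S y (≤-trans 0<r' (m≤m+n r' S)) (m≤m+n r' S)

  from-cheapAt : ∀ sub {A₀ : Fin N → Bool} w → T (cheapAt sub w) → T (A₀ w) → A₀ ⊆ U →
    Room A₀ U (suc (size sub)) S →
    ∃ λ A' → Σ (Emb G (A₀ ∖ (_== w)) w sub A') λ e → (c w + cost c e) * κ ≤ suc (size sub) * β
  from-cheapAt sub {A₀} w h A₀w A₀⊆U room =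
    let A' , e , le = embed-cheaply k sub w size≤ (∖-==-⊆ {A = A₀} w A₀⊆U)
          (room-∸ {A = A₀} {U} w A₀w room) (A₀⊆U w A₀w)
    in A' , e , *-cancelʳ-≤ _ _ (r' ^ k) ⦃ >-nonZero (0<^ {r'} k 0<r') ⦄ (begin
         (c w + cost c e) * κ * r' ^ k ≡⟨ eq₁ (c w) (cost c e) u y (r' ^ k) ⟩
         (r' ^ k * c w + cost c e * r' ^ k) * (u * y) * y
           ≤⟨ *-monoˡ-≤ y (*-monoˡ-≤ (u * y) (+-monoʳ-≤ (r' ^ k * c w) le)) ⟩
         treeCost k sub w * (u * y) * y ≤⟨ *-monoˡ-≤ y (≤ᵇ⇒≤ (treeCost k sub w * (u * y)) (suc y * ceiling sub) (proj₂ (∧⁻ (U w) h))) ⟩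
         suc y * ceiling sub * y ≡⟨ eq₂ (suc y) (r ^ k) (suc (size sub)) A y ⟩
         suc y * (suc (size sub) * A) * (r ^ k * y)
           ≤⟨ *-monoʳ-≤ (suc y * (suc (size sub) * A)) ratio ⟩
         suc y * (suc (size sub) * A) * (suc y * r' ^ k) ≡⟨ eq₃ (suc y) (suc (size sub)) A (r' ^ k) ⟩
         suc (size sub) * β * r' ^ k ∎)
    where
    open ≤-Reasoning
    size≤ : size sub ≤ k
    size≤ = ≤-trans (n≤1+n _) (+-cancelˡ-≤ u _ _ (≤-trans room (+-monoˡ-≤ S (card-mono A₀⊆U))))
    eq₁ : ∀ c e u y q → (c + e) * (u * (y * y)) * q ≡ (q * c + e * q) * (u * y) * y
    eq₁ = solve-∀
    eq₂ : ∀ z q s A y → z * (q * (s * A)) * y ≡ z * (s * A) * (q * y)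
    eq₂ = solve-∀
    eq₃ : ∀ z s A q → z * (s * A) * (z * q) ≡ s * (z * z * A) * q
    eq₃ = solve-∀

  -- Two sets of (1/2 + 1/(4B)) u vertices share u/(2B), of which at most S ≤ u/(4B) are occupied.
  common-neighbours : ∀ A₀ a d w d' → A₀ ⊆ U → Room A₀ U 0 S →
    u ≤ 4 * B * card ((A₀ ∩ nbr G d a) ∩ nbr G d' w)
  common-neighbours A₀ a d w d' A₀⊆U room =
    lin {u * (2 * B + 1) + u * (2 * B + 1)} {4 * B * (u + S + t)} twice (begin
      u + 4 * B * (u + S + t) ≡⟨ eq₁ u B S t ⟩
      u + 4 * B * u + 4 * B * t + 4 * B * S
        ≤⟨ +-monoʳ-≤ (u + 4 * B * u + 4 * B * t) (≤-trans (*-monoʳ-≤ (4 * B) (m≤n+m S r')) 4Br≤u) ⟩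
      u + 4 * B * u + 4 * B * t + u ≡⟨ eq₂ u B t ⟩
      4 * B * t + (u * (2 * B + 1) + u * (2 * B + 1)) ∎)
    where
    open ≤-Reasoning
    X Z : Fin N → Bool
    X = U ∩ nbr G d a
    Z = U ∩ nbr G d' w
    t = card ((A₀ ∩ nbr G d a) ∩ nbr G d' w)
    x+z≤ : card X + card Z ≤ u + card (X ∩ Z)
    x+z≤ = card-∩-lower {U = U} {X} {Z} (λ v h → proj₁ (∧⁻ (U v) h)) (λ v h → proj₁ (∧⁻ (U v) h))
    a+xz≤ : card A₀ + card (X ∩ Z) ≤ u + t
    a+xz≤ = ≤-trans (card-∩-lower {U = U} {A₀} {X ∩ Z} A₀⊆U
        (λ v h → proj₁ (∧⁻ (U v) (proj₁ (∧⁻ (X v) h)))))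
      (+-monoʳ-≤ u (card-mono {X = A₀ ∩ (X ∩ Z)} {(A₀ ∩ nbr G d a) ∩ nbr G d' w} λ v h →
        let A₀v , q = ∧⁻ (A₀ v) h
            Xv , Zv = ∧⁻ (X v) q
        in ∧⁺ (∧⁺ A₀v (proj₂ (∧⁻ (U v) Xv))) (proj₂ (∧⁻ (U v) Zv))))
    x+z≤′ : card X + card Z ≤ u + S + t
    x+z≤′ = lin (+-mono-≤ x+z≤ (+-mono-≤ a+xz≤ room))
      (≤-reflexive (eq (card X + card Z) u (card (X ∩ Z)) t (card A₀) S))
      where
      eq : ∀ p u q t a s → p + (u + q + (u + t + (a + s))) ≡ u + s + t + (p + (a + q + (u + 0)))
      eq = solve-∀
    twice : u * (2 * B + 1) + u * (2 * B + 1) ≤ 4 * B * (u + S + t)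
    twice = begin
      u * (2 * B + 1) + u * (2 * B + 1) ≤⟨ +-mono-≤ (degrees a d) (degrees w d') ⟩
      4 * B * card X + 4 * B * card Z ≡⟨ *-distribˡ-+ (4 * B) (card X) (card Z) ⟨
      4 * B * (card X + card Z) ≤⟨ *-monoʳ-≤ (4 * B) x+z≤′ ⟩
      4 * B * (u + S + t) ∎
    eq₁ : ∀ u B S t → u + 4 * B * (u + S + t) ≡ u + 4 * B * u + 4 * B * t + 4 * B * S
    eq₁ = solve-∀
    eq₂ : ∀ u B t → u + 4 * B * u + 4 * B * t + u ≡ 4 * B * t + (u * (2 * B + 1) + u * (2 * B + 1))
    eq₂ = solve-∀

  private
    S-small : S * (suc g' * suc y) < u
    S-small = ≤-<-trans (begin
      S * (suc g' * suc y) ≡⟨ cong (λ z → S * (z * suc y)) g-eq ⟩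
      S * (2 * (4 * B) * suc y) ≡⟨ eq S B (suc y) ⟩
      8 * B * (1 * S * suc y) ≤⟨ *-monoʳ-≤ (8 * B) (≤-trans (*-monoˡ-≤ (suc y) (*-monoˡ-≤ S 0<S)) (m≤m+n _ S)) ⟩
      8 * B * (S * S * suc y + S) ∎) U-large
      where
      open ≤-Reasoning
      eq : ∀ S B z → S * (2 * (4 * B) * z) ≡ 8 * B * (1 * S * z)
      eq = solve-∀

  open Connect {n = n} G U c S W κ β (4 * B) g' (suc y) g-eq c≤W cheapAt
    (λ sub w h → proj₁ (∧⁻ (U w) h)) cheap-large (λ sub {A₀} → from-cheapAt sub {A₀}) common-neighbours S-small

  -- 7 = 3 + 4. The near-average part costs (1 + 1/y)^2 ≤ 1 + 3/y times the average; at most 2σ/y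
  -- further vertices, half of them from the ball and half from the decayed weight, cost at most
  -- twice the average each.
  cheap-tree : ∀ h Δ d x (sub : Forest n) a σ → Branching Δ sub → roots sub ≤ Δ →
    suc (size sub) ≤ S → suc (size sub) ≤ σ → g' ^ h * y ≤ suc g' ^ h → y * ballSize Δ h ≤ σ →
    ∃₂ λ z A' → T (U z) × T (nbr G d a z) × Σ (Emb G (U ∖ (_== z)) z sub A') λ e →
      (c z + cost c e) * (u * y) ≤ A * (suc (size sub) * y + 7 * σ)
  cheap-tree h Δ d x sub a σ br ro s≤S s≤σ hyp-h ball =
    let z , A' , Uz , az , e , sp =
          connect-tree h Δ d x sub U a br ro (λ _ p → p) (+-monoʳ-≤ u s≤S)
    in z , A' , Uz , az , e , bound (c z + cost c e) sp
    where
    open ≤-Reasoning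
    s = suc (size sub)
    b = ballSize Δ h
    bound : ∀ C → Split h s s b C → C * (u * y) ≤ A * (s * y + 7 * σ)
    bound C (split ci co tot ch fw) = *-cancelʳ-≤ _ _ y ⦃ >-nonZero 0<y ⦄ (begin
      C * (u * y) * y ≤⟨ *-monoˡ-≤ y (*-monoˡ-≤ (u * y) tot) ⟩
      (ci + W * co) * (u * y) * y ≡⟨ eq₁ ci W co u y ⟩
      ci * κ + y * (co * y) * (W * u) ≤⟨ +-mono-≤ ch (*-mono-≤ (*-monoʳ-≤ y co≤) W-avg) ⟩
      s * β + y * (2 * σ) * (2 * A) ≡⟨ eq₂ s y A σ ⟩
      A * (s * (y * y) + (2 * y + 1) * s + 4 * (y * σ))
        ≤⟨ *-monoʳ-≤ A (+-monoˡ-≤ (4 * (y * σ)) (+-monoʳ-≤ (s * (y * y))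
             (*-mono-≤ (+-monoʳ-≤ (2 * y) 0<y) s≤σ))) ⟩
      A * (s * (y * y) + (2 * y + y) * σ + 4 * (y * σ)) ≡⟨ eq₃ s y A σ ⟩
      A * (s * y + 7 * σ) * y ∎)
      where
      co≤ : co * y ≤ 2 * σ
      co≤ = *-cancelˡ-≤ (suc g' ^ h) ⦃ >-nonZero (0<^ {suc g'} h z<s) ⦄ (begin
        suc g' ^ h * (co * y) ≡⟨ eq₄ (suc g' ^ h) co y ⟩
        co * suc g' ^ h * y ≤⟨ *-monoˡ-≤ y fw ⟩
        (suc g' ^ h * b + g' ^ h * s) * y ≡⟨ eq₅ (suc g' ^ h) b (g' ^ h) s y ⟩
        suc g' ^ h * (y * b) + (g' ^ h * y) * s
          ≤⟨ +-mono-≤ (*-monoʳ-≤ (suc g' ^ h) ball) (*-mono-≤ hyp-h s≤σ) ⟩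
        suc g' ^ h * σ + suc g' ^ h * σ ≡⟨ eq₆ (suc g' ^ h) σ ⟩
        suc g' ^ h * (2 * σ) ∎)
        where
        eq₄ : ∀ q o y → q * (o * y) ≡ o * q * y
        eq₄ = solve-∀
        eq₅ : ∀ q b p s y → (q * b + p * s) * y ≡ q * (y * b) + (p * y) * s
        eq₅ = solve-∀
        eq₆ : ∀ q s → q * s + q * s ≡ q * (2 * s)
        eq₆ = solve-∀
      eq₁ : ∀ i W o u y → (i + W * o) * (u * y) * y ≡ i * (u * (y * y)) + y * (o * y) * (W * u)
      eq₁ = solve-∀
      eq₂ : ∀ s y A t → s * ((1 + y) * (1 + y) * A) + y * (2 * t) * (2 * A) ≡ A * (s * (y * y) + (2 * y + 1) * s + 4 * (y * t))
      eq₂ = solve-∀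
      eq₃ : ∀ s y A t → A * (s * (y * y) + (2 * y + y) * t + 4 * (y * t)) ≡ A * (s * y + 7 * t) * y
      eq₃ = solve-∀

-- The potential function

bernoulli : ∀ l x t → x ^ suc l + suc l * (x ^ l * t) ≤ (x + t) ^ suc l
bernoulli zero x t = ≤-reflexive (eq x t)
  where
  eq : ∀ x t → x * 1 + (1 * t + 0) ≡ (x + t) * 1
  eq = solve-∀
bernoulli (suc l) x t = begin
  x * x ^ suc l + suc (suc l) * (x ^ suc l * t)
    ≤⟨ m≤m+n _ (suc l * (x ^ l * t * t)) ⟩
  x * x ^ suc l + suc (suc l) * (x ^ suc l * t) + suc l * (x ^ l * t * t)
    ≡⟨ eq x (x ^ l) l t ⟩
  (x + t) * (x ^ suc l + suc l * (x ^ l * t)) ≤⟨ *-monoʳ-≤ (x + t) (bernoulli l x t) ⟩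
  (x + t) * (x + t) ^ suc l ∎
  where
  open ≤-Reasoning
  eq : ∀ x q l t → x * (x * q) + (2 + l) * (x * q * t) + (1 + l) * (q * t * t) ≡
    (x + t) * (x * q + (1 + l) * (q * t))
  eq = solve-∀

-- The upper counterpart of `bernoulli`: for `t` this small, all higher-order terms fit into 1/y of
-- the linear one.
first-order : ∀ l x t y → suc y * suc l * t ≤ x →
  y * (x + t) ^ suc l ≤ y * x ^ suc l + suc y * (suc l * (x ^ l * t))
first-order zero x t y _ = ≤-trans (m≤m+n _ t) (≤-reflexive (eq x t y))
  where
  eq : ∀ x t y → y * ((x + t) * 1) + t ≡ y * (x * 1) + (1 + y) * (1 * t + 0)
  eq = solve-∀
first-order (suc l) x t y h = begin
  y * ((x + t) * (x + t) ^ suc l) ≡⟨ eq₁ y (x + t) ((x + t) ^ suc l) ⟩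
  (x + t) * (y * (x + t) ^ suc l)
    ≤⟨ *-monoʳ-≤ (x + t) (first-order l x t y (≤-trans (*-monoˡ-≤ t (*-monoʳ-≤ (suc y) (n≤1+n (suc l)))) h)) ⟩
  (x + t) * (y * x ^ suc l + suc y * (suc l * (x ^ l * t))) ≡⟨ eq₂ x t y l (x ^ l) ⟩
  y * (x * x ^ suc l) + suc y * (suc l * (x ^ suc l * t)) + x ^ l * t * (y * x + suc y * suc l * t)
    ≤⟨ +-monoʳ-≤ (y * (x * x ^ suc l) + suc y * (suc l * (x ^ suc l * t)))
         (*-monoʳ-≤ (x ^ l * t) (≤-trans (+-monoʳ-≤ (y * x)
           (≤-trans (*-monoˡ-≤ t (*-monoʳ-≤ (suc y) (n≤1+n (suc l)))) h)) (≤-reflexive (+-comm (y * x) x)))) ⟩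
  y * (x * x ^ suc l) + suc y * (suc l * (x ^ suc l * t)) + x ^ l * t * (suc y * x)
    ≡⟨ eq₃ x t y l (x ^ l) ⟩
  y * (x * x ^ suc l) + suc y * (suc (suc l) * (x ^ suc l * t)) ∎
  where
  open ≤-Reasoning
  eq₁ : ∀ y a b → y * (a * b) ≡ a * (y * b)
  eq₁ = solve-∀
  eq₂ : ∀ x t y l q → (x + t) * (y * (x * q) + (1 + y) * ((1 + l) * (q * t))) ≡
    y * (x * (x * q)) + (1 + y) * ((1 + l) * (x * q * t)) + q * t * (y * x + (1 + y) * (1 + l) * t)
  eq₂ = solve-∀
  eq₃ : ∀ x t y l q → y * (x * (x * q)) + (1 + y) * ((1 + l) * (x * q * t)) + q * t * ((1 + y) * x) ≡
    y * (x * (x * q)) + (1 + y) * ((2 + l) * (x * q * t))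
  eq₃ = solve-∀

^-distribʳ-* : ∀ k a b → (a * b) ^ k ≡ a ^ k * b ^ k
^-distribʳ-* zero a b = refl
^-distribʳ-* (suc k) a b = trans (cong (a * b *_) (^-distribʳ-* k a b)) (eq a b (a ^ k) (b ^ k))
  where
  eq : ∀ a b p q → a * b * (p * q) ≡ a * p * (b * q)
  eq = solve-∀

sum-* : ∀ {n} k (f : Fin n → ℕ) → sum (λ i → k * f i) ≡ k * sum f
sum-* k f = sym (*-distribˡ-sum k f)

module Potential {N J : ℕ} (Ns : Fin J → Fin N → Bool) where

  -- With z the proportion of U outside Ns j, load U j is |U| (1 + 2 z).
  load : (Fin N → Bool) → Fin J → ℕ
  load U j = 2 * card (U ∖ Ns j) + card U

  potential : ℕ → (Fin N → Bool) → ℕ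
  potential L U = sum (λ j → load U j ^ L)

  module Price (U : Fin N → Bool) (s l : ℕ) where

    -- `base j` is the load after losing `s` vertices outside `Ns j`; every lost vertex inside
    -- `Ns j` adds 2 to it. Up to the factor 2 (l + 1), `price v` is therefore the first-order
    -- effect of using `v` on the potential.
    base weight : Fin J → ℕ
    base j = load U j ∸ 3 * s
    weight j = base j ^ l

    price : Fin N → ℕ
    price v = sum (λ j → weight j * 𝟙 (Ns j v))

    price≤ : ∀ v → price v ≤ sum weight
    price≤ v = sum-mono λ j → ≤-trans (*-monoʳ-≤ (weight j) (𝟙≤1 (Ns j v))) (≤-reflexive (*-identityʳ (weight j)))

    sumOver-price : ∀ X → sumOver X price ≡ sum (λ j → weight j * card (X ∩ Ns j))
    sumOver-price X = begin
      sum (λ v → 𝟙 (X v) * sum (λ j → weight j * 𝟙 (Ns j v)))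
        ≡⟨ sum-cong-≗ (λ v → *-distribˡ-sum (𝟙 (X v)) (λ j → weight j * 𝟙 (Ns j v))) ⟩
      sum (λ v → sum (λ j → 𝟙 (X v) * (weight j * 𝟙 (Ns j v))))
        ≡⟨ ∑-comm (λ v j → 𝟙 (X v) * (weight j * 𝟙 (Ns j v))) ⟩
      sum (λ j → sum (λ v → 𝟙 (X v) * (weight j * 𝟙 (Ns j v))))
        ≡⟨ sum-cong-≗ (λ j → trans (sumOver-* X (weight j) (λ v → 𝟙 (Ns j v)))
             (cong (weight j *_) (sym (card-∩ X (Ns j))))) ⟩
      sum (λ j → weight j * card (X ∩ Ns j)) ∎
      where open ≡-Reasoning

    -- As each neighbourhood covers half of `U`, even the crude bound `sum weight` is at most twice
    -- the average price. This limits the damage done by vertices placed without price control.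
    weight-average : (∀ j → card U ≤ 2 * card (U ∩ Ns j)) → sum weight * card U ≤ 2 * sumOver U price
    weight-average h = begin
      sum weight * card U ≡⟨ *-distribʳ-sum (card U) weight ⟩
      sum (λ j → weight j * card U) ≤⟨ sum-mono (λ j → ≤-trans (*-monoʳ-≤ (weight j) (h j))
         (≤-reflexive (eq (weight j) (card (U ∩ Ns j))))) ⟩
      sum (λ j → 2 * (weight j * card (U ∩ Ns j))) ≡⟨ sum-* 2 (λ j → weight j * card (U ∩ Ns j)) ⟩
      2 * sum (λ j → weight j * card (U ∩ Ns j)) ≡⟨ cong (2 *_) (sumOver-price U) ⟨
      2 * sumOver U price ∎
      where
      open ≤-Reasoning
      eq : ∀ w d → w * (2 * d) ≡ 2 * (w * d)
      eq = solve-∀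

  module Step (U U' : Fin N → Bool) (s l y σ C : ℕ)
    (U'⊆U : U' ⊆ U) (shrink : card U ≡ s + card U')
    (room : 4 * s * suc l * suc y ≤ card U) (room′ : 6 * s ≤ card U)
    (s≤σ : s ≤ σ) (0<y : 0 < y) (0<u : 0 < card U) where

    open Price U s l

    private
      u u' : ℕ
      u = card U
      u' = card U'

      d d' used : Fin J → ℕ
      d j = card (U ∩ Ns j)
      d' j = card (U' ∩ Ns j)
      used j = d j ∸ d' j

      A : ℕ
      A = sumOver U price

    d'≤d : ∀ j → d' j ≤ d j
    d'≤d j = card-mono {X = U' ∩ Ns j} {U ∩ Ns j} λ v h →
      let p , q = ∧⁻ (U' v) h in ∧⁺ (U'⊆U v p) q

    used+ : ∀ j → used j + d' j ≡ d j
    used+ j = m∸n+n≡m (d'≤d j)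

    outside : ∀ j → card (U' ∖ Ns j) ≤ card (U ∖ Ns j)
    outside j = card-mono {X = U' ∖ Ns j} {U ∖ Ns j} λ v h →
      let p , q = ∧⁻ (U' v) h in ∧⁺ (U'⊆U v p) q

    balance : ∀ j → used j + d' j + card (U ∖ Ns j) ≡ s + (d' j + card (U' ∖ Ns j))
    balance j = trans (cong (_+ card (U ∖ Ns j)) (used+ j)) (trans (sym (card-split U (Ns j)))
      (trans shrink (cong (s +_) (card-split U' (Ns j)))))

    used≤s : ∀ j → used j ≤ s
    used≤s j = lin (+-monoʳ-≤ (d' j) (outside j))
      (≤-reflexive (trans (sym (+-assoc (used j) (d' j) _)) (balance j)))

    u≤load : ∀ j → u ≤ load U j
    u≤load j = m≤n+m u _

    base+ : ∀ j → base j + 3 * s ≡ load U j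
    base+ j = m∸n+n≡m (≤-trans (≤-trans (*-monoˡ-≤ s 3≤6) room′) (u≤load j))
      where
      3≤6 : 3 ≤ 6
      3≤6 = s≤s (s≤s (s≤s z≤n))

    u≤2base : ∀ j → u ≤ 2 * base j
    u≤2base j = lin (+-mono-≤ (*-monoʳ-≤ 2 (u≤load j)) room′) (≤-reflexive
      (trans (cong (λ z → u + (2 * z + u)) (sym (base+ j))) (eq u (base j) s)))
      where
      eq : ∀ u b s → u + (2 * (b + 3 * s) + u) ≡ 2 * b + (2 * u + 6 * s)
      eq = solve-∀

    load-shrunk : ∀ j → load U' j ≡ base j + 2 * used j
    load-shrunk j = +-cancelʳ-≡ (3 * s + 2 * d' j) _ _ (begin
      2 * q' + u' + (3 * s + 2 * d' j) ≡⟨ eq₁ q' u' s (d' j) ⟩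
      2 * (d' j + q') + (u' + 3 * s) ≡⟨ cong (λ z → 2 * z + (u' + 3 * s)) (card-split U' (Ns j)) ⟨
      2 * u' + (u' + 3 * s) ≡⟨ eq₂ u' s ⟩
      3 * (s + u') ≡⟨ cong (3 *_) shrink ⟨
      3 * u ≡⟨ eq₃ u ⟩
      2 * u + u ≡⟨ cong (λ z → 2 * z + u) (card-split U (Ns j)) ⟩
      2 * (d j + q) + u ≡⟨ cong (λ z → 2 * (z + q) + u) (used+ j) ⟨
      2 * (used j + d' j + q) + u ≡⟨ eq₄ (used j) (d' j) q u ⟩
      (2 * q + u) + (2 * used j + 2 * d' j) ≡⟨ cong (_+ (2 * used j + 2 * d' j)) (base+ j) ⟨
      base j + 3 * s + (2 * used j + 2 * d' j) ≡⟨ eq₅ (base j) s (used j) (d' j) ⟩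
      base j + 2 * used j + (3 * s + 2 * d' j) ∎)
      where
      open ≡-Reasoning
      q = card (U ∖ Ns j)
      q' = card (U' ∖ Ns j)
      eq₁ : ∀ q u s d → 2 * q + u + (3 * s + 2 * d) ≡ 2 * (d + q) + (u + 3 * s)
      eq₁ = solve-∀
      eq₂ : ∀ u s → 2 * u + (u + 3 * s) ≡ 3 * (s + u)
      eq₂ = solve-∀
      eq₃ : ∀ u → 3 * u ≡ 2 * u + u
      eq₃ = solve-∀
      eq₄ : ∀ c d q u → 2 * (c + d + q) + u ≡ (2 * q + u) + (2 * c + 2 * d)
      eq₄ = solve-∀
      eq₅ : ∀ b s c d → b + 3 * s + (2 * c + 2 * d) ≡ b + 2 * c + (3 * s + 2 * d)
      eq₅ = solve-∀

    -- The first-order expansion of the potential is exact: an average price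
    -- for the s removed vertices scales every load by u' / u.
    scaled : ∀ j → u * base j + 2 * (d j * s) ≡ load U j * u'
    scaled j = +-cancelʳ-≡ (3 * (s * u)) _ _ (begin
      u * base j + 2 * (d j * s) + 3 * (s * u) ≡⟨ eq₁ u (base j) (d j * s) s ⟩
      u * (base j + 3 * s) + 2 * (d j * s) ≡⟨ cong (λ z → u * z + 2 * (d j * s)) (base+ j) ⟩
      u * load U j + 2 * (d j * s) ≡⟨ cong (λ z → z * load U j + 2 * (d j * s)) shrink ⟩
      (s + u') * (2 * q + u) + 2 * (d j * s) ≡⟨ eq₂ s u' q u (d j) ⟩
      (2 * q + u) * u' + (2 * s * (d j + q) + s * u)
        ≡⟨ cong (λ z → load U j * u' + (2 * s * z + s * u)) (card-split U (Ns j)) ⟨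
      load U j * u' + (2 * s * u + s * u) ≡⟨ eq₃ (load U j * u') s u ⟩
      load U j * u' + 3 * (s * u) ∎)
      where
      open ≡-Reasoning
      q = card (U ∖ Ns j)
      eq₁ : ∀ u b p s → u * b + 2 * p + 3 * (s * u) ≡ u * (b + 3 * s) + 2 * p
      eq₁ = solve-∀
      eq₂ : ∀ s u' q u d → (s + u') * (2 * q + u) + 2 * (d * s) ≡ (2 * q + u) * u' + (2 * s * (d + q) + s * u)
      eq₂ = solve-∀
      eq₃ : ∀ a s u → a + (2 * s * u + s * u) ≡ a + 3 * (s * u)
      eq₃ = solve-∀

    private
      L P Φ Φ' : ℕ
      L = suc l
      P = sum (λ j → base j ^ suc l)
      Φ = potential (suc l) U
      Φ' = potential (suc l) U'

    A-eq : A ≡ sum (λ j → weight j * d j)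
    A-eq = sumOver-price U

    C-eq : A ≡ C + sumOver U' price → C ≡ sum (λ j → weight j * used j)
    C-eq paid = +-cancelʳ-≡ (sum (λ j → weight j * d' j)) _ _ (begin
      C + sum (λ j → weight j * d' j) ≡⟨ cong (C +_) (sumOver-price U') ⟨
      C + sumOver U' price ≡⟨ paid ⟨
      A ≡⟨ A-eq ⟩
      sum (λ j → weight j * d j)
        ≡⟨ sum-cong-≗ (λ j → trans (cong (weight j *_) (sym (used+ j))) (*-distribˡ-+ (weight j) (used j) (d' j))) ⟩
      sum (λ j → weight j * used j + weight j * d' j)
        ≡⟨ ∑-distrib-+ (λ j → weight j * used j) (λ j → weight j * d' j) ⟩
      sum (λ j → weight j * used j) + sum (λ j → weight j * d' j) ∎)
      where open ≡-Reasoning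

    -- The expansion is taken at `base`, where the linear terms add up to the cost `C`.
    expand : A ≡ C + sumOver U' price → y * Φ' ≤ y * P + suc y * (2 * (L * C))
    expand paid = begin
      y * Φ' ≡⟨ sum-* y (λ j → load U' j ^ suc l) ⟨
      sum (λ j → y * load U' j ^ suc l) ≤⟨ sum-mono pointwise ⟩
      sum (λ j → y * base j ^ suc l + suc y * (2 * L) * (weight j * used j))
        ≡⟨ ∑-distrib-+ (λ j → y * base j ^ suc l) (λ j → suc y * (2 * L) * (weight j * used j)) ⟩
      sum (λ j → y * base j ^ suc l) + sum (λ j → suc y * (2 * L) * (weight j * used j))
        ≡⟨ cong₂ _+_ (sum-* y (λ j → base j ^ suc l)) (sum-* (suc y * (2 * L)) (λ j → weight j * used j)) ⟩
      y * P + suc y * (2 * L) * sum (λ j → weight j * used j)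
        ≡⟨ cong (λ z → y * P + suc y * (2 * L) * z) (C-eq paid) ⟨
      y * P + suc y * (2 * L) * C ≡⟨ cong (y * P +_) (eq (suc y) L C) ⟩
      y * P + suc y * (2 * (L * C)) ∎
      where
      open ≤-Reasoning
      eq : ∀ y L C → y * (2 * L) * C ≡ y * (2 * (L * C))
      eq = solve-∀
      eq₂ : ∀ y L w c → y * (L * (w * (2 * c))) ≡ y * (2 * L) * (w * c)
      eq₂ = solve-∀
      eq₃ : ∀ y L c → 2 * (y * L * (2 * c)) ≡ 4 * c * L * y
      eq₃ = solve-∀
      small : ∀ j → suc y * suc l * (2 * used j) ≤ base j
      small j = *-cancelˡ-≤ 2 (begin
        2 * (suc y * suc l * (2 * used j)) ≡⟨ eq₃ (suc y) (suc l) (used j) ⟩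
        4 * used j * suc l * suc y ≤⟨ *-monoˡ-≤ (suc y) (*-monoˡ-≤ (suc l) (*-monoʳ-≤ 4 (used≤s j))) ⟩
        4 * s * suc l * suc y ≤⟨ room ⟩
        u ≤⟨ u≤2base j ⟩
        2 * base j ∎)
      pointwise : ∀ j → y * load U' j ^ suc l ≤ y * base j ^ suc l + suc y * (2 * L) * (weight j * used j)
      pointwise j = begin
        y * load U' j ^ suc l ≡⟨ cong (λ z → y * z ^ suc l) (load-shrunk j) ⟩
        y * (base j + 2 * used j) ^ suc l ≤⟨ first-order l (base j) (2 * used j) y (small j) ⟩
        y * base j ^ suc l + suc y * (suc l * (weight j * (2 * used j)))
          ≡⟨ cong (y * base j ^ suc l +_) (eq₂ (suc y) (suc l) (weight j) (used j)) ⟩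
        y * base j ^ suc l + suc y * (2 * L) * (weight j * used j) ∎

    -- 15 = 1 + 7 + 7: (1 + 1/y)(s + 7σ/y) ≤ s + 15σ/y, since s ≤ σ and 1 ≤ y.
    expand-cheap : A ≡ C + sumOver U' price → C * (u * y) ≤ A * (s * y + 7 * σ) →
      u * y * Φ' ≤ u * y * P + 2 * (L * A) * (s * y + 15 * σ)
    expand-cheap paid cheap = *-cancelʳ-≤ _ _ y ⦃ >-nonZero 0<y ⦄ (begin
      u * y * Φ' * y ≡⟨ eq₁ u y Φ' ⟩
      u * y * (y * Φ') ≤⟨ *-monoʳ-≤ (u * y) (expand paid) ⟩
      u * y * (y * P + suc y * (2 * (L * C))) ≡⟨ eq₂ u y P L C ⟩
      u * y * P * y + 2 * L * (suc y * (C * (u * y)))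
        ≤⟨ +-monoʳ-≤ (u * y * P * y) (*-monoʳ-≤ (2 * L) (*-monoʳ-≤ (suc y) cheap)) ⟩
      u * y * P * y + 2 * L * (suc y * (A * (s * y + 7 * σ))) ≡⟨ eq₃ (u * y * P * y) L y A s σ ⟩
      u * y * P * y + 2 * L * A * (y * s * y + s * y + 7 * σ * y + 7 * σ * 1)
        ≤⟨ +-monoʳ-≤ (u * y * P * y) (*-monoʳ-≤ (2 * L * A) (+-mono-≤
             (+-monoˡ-≤ (7 * σ * y) (+-monoʳ-≤ (y * s * y) (*-monoˡ-≤ y s≤σ))) (*-monoʳ-≤ (7 * σ) 0<y))) ⟩
      u * y * P * y + 2 * L * A * (y * s * y + σ * y + 7 * σ * y + 7 * σ * y)
        ≡⟨ eq₄ (u * y * P) L y A s σ ⟩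
      (u * y * P + 2 * (L * A) * (s * y + 15 * σ)) * y ∎)
      where
      open ≤-Reasoning
      eq₁ : ∀ u y p → u * y * p * y ≡ u * y * (y * p)
      eq₁ = solve-∀
      eq₂ : ∀ u y p L C → u * y * (y * p + (1 + y) * (2 * (L * C))) ≡ u * y * p * y + 2 * L * ((1 + y) * (C * (u * y)))
      eq₂ = solve-∀
      eq₃ : ∀ r L y A s t → r + 2 * L * ((1 + y) * (A * (s * y + 7 * t))) ≡ r + 2 * L * A * (y * s * y + s * y + 7 * t * y + 7 * t * 1)
      eq₃ = solve-∀
      eq₄ : ∀ r L y A s t → r * y + 2 * L * A * (y * s * y + t * y + 7 * t * y + 7 * t * y) ≡ (r + 2 * (L * A) * (s * y + 15 * t)) * y
      eq₄ = solve-∀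

    -- Bernoulli in the other direction: by `scaled`, paying exactly the average price would not
    -- increase the potential normalised by `u ^ L`.
    shrink-exact : u ^ l * (u * P + 2 * (L * A * s)) ≤ u' ^ L * Φ
    shrink-exact = begin
      u ^ l * (u * P + 2 * (L * A * s)) ≡⟨ eq₁ (u ^ l) u P L A s ⟩
      u ^ l * u * P + u ^ l * (2 * L * s) * A ≡⟨ cong (λ z → u ^ l * u * P + u ^ l * (2 * L * s) * z) A-eq ⟩
      u ^ l * u * P + u ^ l * (2 * L * s) * sum (λ j → weight j * d j)
        ≡⟨ cong₂ _+_ (sum-* (u ^ l * u) (λ j → base j ^ suc l)) (sum-* (u ^ l * (2 * L * s)) (λ j → weight j * d j)) ⟨
      sum (λ j → u ^ l * u * base j ^ suc l) + sum (λ j → u ^ l * (2 * L * s) * (weight j * d j))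
        ≡⟨ ∑-distrib-+ (λ j → u ^ l * u * base j ^ suc l) (λ j → u ^ l * (2 * L * s) * (weight j * d j)) ⟨
      sum (λ j → u ^ l * u * base j ^ suc l + u ^ l * (2 * L * s) * (weight j * d j)) ≤⟨ sum-mono pointwise ⟩
      sum (λ j → u' ^ suc l * load U j ^ suc l) ≡⟨ sum-* (u' ^ suc l) (λ j → load U j ^ suc l) ⟩
      u' ^ suc l * Φ ∎
      where
      open ≤-Reasoning
      eq₁ : ∀ q u p L A s → q * (u * p + 2 * (L * A * s)) ≡ q * u * p + q * (2 * L * s) * A
      eq₁ = solve-∀
      eq₂ : ∀ q u b w L s d → q * u * (b * w) + q * (2 * L * s) * (w * d) ≡ u * b * (q * w) + L * (q * w * (2 * (d * s)))
      eq₂ = solve-∀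
      pointwise : ∀ j → u ^ l * u * base j ^ suc l + u ^ l * (2 * L * s) * (weight j * d j) ≤
        u' ^ suc l * load U j ^ suc l
      pointwise j = begin
        u ^ l * u * base j ^ suc l + u ^ l * (2 * L * s) * (weight j * d j)
          ≡⟨ eq₂ (u ^ l) u (base j) (weight j) (suc l) s (d j) ⟩
        u * base j * (u ^ l * weight j) + suc l * (u ^ l * weight j * (2 * (d j * s)))
          ≡⟨ cong (λ z → u * base j * z + suc l * (z * (2 * (d j * s)))) (^-distribʳ-* l u (base j)) ⟨
        (u * base j) ^ suc l + suc l * ((u * base j) ^ l * (2 * (d j * s)))
          ≤⟨ bernoulli l (u * base j) (2 * (d j * s)) ⟩
        (u * base j + 2 * (d j * s)) ^ suc l ≡⟨ cong (_^ suc l) (scaled j) ⟩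
        (load U j * u') ^ suc l ≡⟨ ^-distribʳ-* (suc l) (load U j) u' ⟩
        load U j ^ suc l * u' ^ suc l ≡⟨ *-comm (load U j ^ suc l) (u' ^ suc l) ⟩
        u' ^ suc l * load U j ^ suc l ∎

    A≤2P : A ≤ 2 * P
    A≤2P = begin
      A ≡⟨ A-eq ⟩
      sum (λ j → weight j * d j) ≤⟨ sum-mono (λ j → ≤-trans
        (*-monoʳ-≤ (weight j) (≤-trans (m+n≤o⇒m≤o (d j) (≤-reflexive (sym (card-split U (Ns j))))) (u≤2base j)))
        (≤-reflexive (eq (weight j) (base j)))) ⟩
      sum (λ j → 2 * base j ^ suc l) ≡⟨ sum-* 2 (λ j → base j ^ suc l) ⟩
      2 * P ∎
      where
      open ≤-Reasoning
      eq : ∀ w b → w * (2 * b) ≡ 2 * (b * w)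
      eq = solve-∀

    -- The overpayment carries a factor 2 * 15, and `A≤2P` compares it with the main term at the
    -- price of another 2. This gives 60, and a relative growth of L σ / X.
    potential-step : A ≡ C + sumOver U' price → C * (u * y) ≤ A * (s * y + 7 * σ) →
      ∀ X → 60 * X ≤ u * y → X * (u ^ L * Φ') ≤ (X + L * σ) * (u' ^ L * Φ)
    potential-step paid cheap X X≤ = *-cancelʳ-≤ _ _ (u * y) ⦃ >-nonZero (*-mono-< 0<u 0<y) ⦄ (begin
      X * (u ^ L * Φ') * (u * y) ≡⟨ eq₁ X u (u ^ l) Φ' y ⟩
      X * u * (u ^ l * (u * y * Φ')) ≤⟨ *-monoʳ-≤ (X * u) (*-monoʳ-≤ (u ^ l) (expand-cheap paid cheap)) ⟩
      X * u * (u ^ l * (u * y * P + 2 * (L * A) * (s * y + 15 * σ))) ≡⟨ eq₂ X u (u ^ l) y P L A s σ ⟩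
      X * u * y * (u ^ l * (u * P + 2 * (L * A * s))) + 30 * X * u * u ^ l * L * σ * A
        ≤⟨ +-mono-≤ (*-monoʳ-≤ (X * u * y) shrink-exact) (*-monoʳ-≤ (30 * X * u * u ^ l * L * σ) A≤2P) ⟩
      X * u * y * (u' ^ L * Φ) + 30 * X * u * u ^ l * L * σ * (2 * P)
        ≡⟨ cong (X * u * y * (u' ^ L * Φ) +_) (eq₃ X u (u ^ l) L σ P) ⟩
      X * u * y * (u' ^ L * Φ) + 60 * X * (L * σ) * (u ^ l * (u * P))
        ≤⟨ +-monoʳ-≤ (X * u * y * (u' ^ L * Φ)) (*-mono-≤ (*-monoˡ-≤ (L * σ) X≤)
             (≤-trans (*-monoʳ-≤ (u ^ l) (m≤m+n (u * P) _)) shrink-exact)) ⟩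
      X * u * y * (u' ^ L * Φ) + u * y * (L * σ) * (u' ^ L * Φ) ≡⟨ eq₄ X u y (L * σ) (u' ^ L * Φ) ⟩
      (X + L * σ) * (u' ^ L * Φ) * (u * y) ∎)
      where
      open ≤-Reasoning
      eq₁ : ∀ X u q p y → X * (u * q * p) * (u * y) ≡ X * u * (q * (u * y * p))
      eq₁ = solve-∀
      eq₂ : ∀ X u q y P L A s t → X * u * (q * (u * y * P + 2 * (L * A) * (s * y + 15 * t))) ≡
        X * u * y * (q * (u * P + 2 * (L * A * s))) + 30 * X * u * q * L * t * A
      eq₂ = solve-∀
      eq₃ : ∀ X u q L t P → 30 * X * u * q * L * t * (2 * P) ≡ 60 * X * (L * t) * (q * (u * P))
      eq₃ = solve-∀
      eq₄ : ∀ X u y z p → X * u * y * p + u * y * z * p ≡ (X + z) * p * (u * y)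
      eq₄ = solve-∀

-- Embedding one piece while the potential stays under control

module TreeStep {N : ℕ} (n : ℕ) (G : Digraph N) (B p r₀ S m l y g' h Δ X T₀ : ℕ)
  (0<B : 0 < B) (0<y : 0 < y) (0<S : 0 < S) (0<X : 0 < X)
  (g-eq : suc g' ≡ 2 * (4 * B)) (p-eq : p + 2 ≡ 4 * B)
  (N-eq : n + r₀ ≡ N) (slack : N ≤ B * r₀)
  (non-neighbours : ∀ d a → 2 * card (λ v → not (nbr G d a v)) ≤ n)
  (decay : g' ^ h * y ≤ suc g' ^ h) (ball : y * ballSize Δ h ≤ m)
  (S-small : 8 * B * (S * S * suc y + S) < r₀)
  (SL-small : 4 * S * suc l * suc y ≤ r₀) (6S : 6 * S ≤ r₀)
  (X-small : 60 * X ≤ r₀ * y)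
  (growth : ∀ t → t ≤ T₀ → 2 * N * (p ^ suc l * suc X ^ (suc l * t)) ≤ suc p ^ suc l * X ^ (suc l * t))
  where

  private
    L : ℕ
    L = suc l

  neighbourhood : Fin (N + N) → Fin N → Bool
  neighbourhood j = [ nbr G true , nbr G false ]′ (splitAt N j)

  index : Bool → Fin N → Fin (N + N)
  index true  a = a ↑ˡ N
  index false a = N ↑ʳ a

  neighbourhood-index : ∀ d a → neighbourhood (index d a) ≡ nbr G d a
  neighbourhood-index true  a = cong [ nbr G true , nbr G false ]′ (Fin.splitAt-↑ˡ N a N)
  neighbourhood-index false a = cong [ nbr G true , nbr G false ]′ (Fin.splitAt-↑ʳ N N a)

  open Potential neighbourhood public

  -- Relative to its initial bound, and normalised by card U ^ L, the potential
  -- has grown by a factor of at most (1 + 1/X) ^ (L t).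
  Invariant : ℕ → (Fin N → Bool) → Set
  Invariant t U = potential L U * (N ^ L * X ^ (L * t)) ≤
    2 * N * (n + N) ^ L * (card U ^ L * suc X ^ (L * t))

  0<r₀ : 0 < r₀
  0<r₀ = ≤-<-trans z≤n S-small

  0<N : 0 < N
  0<N = subst (0 <_) N-eq (≤-trans 0<r₀ (m≤n+m r₀ n))

  everything : Fin N → Bool
  everything _ = true

  card-everything : card everything ≡ N
  card-everything = trans (sum-const N 1) (*-identityʳ N)

  initial : Invariant 0 everything
  initial = begin
    potential L everything * (N ^ L * X ^ (L * 0))
      ≤⟨ *-monoˡ-≤ (N ^ L * X ^ (L * 0)) (≤-trans (sum-mono λ j → ^-monoˡ-≤ L (load≤ j))
           (≤-reflexive (sum-const (N + N) ((n + N) ^ L)))) ⟩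
    (N + N) * (n + N) ^ L * (N ^ L * X ^ (L * 0)) ≡⟨ cong₂ (λ a b → a * (n + N) ^ L * (N ^ L * b)) eq powers ⟩
    2 * N * (n + N) ^ L * (N ^ L * suc X ^ (L * 0))
      ≡⟨ cong (λ z → 2 * N * (n + N) ^ L * (z ^ L * suc X ^ (L * 0))) (sym card-everything) ⟩
    2 * N * (n + N) ^ L * (card everything ^ L * suc X ^ (L * 0)) ∎
    where
    open ≤-Reasoning
    eq : N + N ≡ 2 * N
    eq = cong (N +_) (sym (+-identityʳ N))
    powers : X ^ (L * 0) ≡ suc X ^ (L * 0)
    powers = trans (cong (X ^_) (*-zeroʳ L)) (cong (suc X ^_) (sym (*-zeroʳ L)))
    load≤ : ∀ j → load everything j ≤ n + N
    load≤ j with splitAt N j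
    ... | inj₁ a = +-mono-≤ (non-neighbours true a) (≤-reflexive card-everything)
    ... | inj₂ a = +-mono-≤ (non-neighbours false a) (≤-reflexive card-everything)

  -- Initially load / N ≤ 1 + n/N = 2 - r₀/N ≤ 2 - 1/B, which is p/(2B).
  spread : 2 * B * (n + N) ≤ p * N
  spread = lin {2 * N} {2 * (B * r₀)} (*-monoʳ-≤ 2 slack) (≤-reflexive (begin
    2 * B * (n + N) + 2 * (B * r₀) ≡⟨ eq₁ B n N r₀ ⟩
    2 * B * (n + r₀ + N) ≡⟨ cong (λ z → 2 * B * (z + N)) N-eq ⟩
    2 * B * (N + N) ≡⟨ eq₂ B N ⟩
    4 * B * N ≡⟨ cong (_* N) p-eq ⟨
    (p + 2) * N ≡⟨ *-distribʳ-+ N p 2 ⟩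
    p * N + 2 * N ∎))
    where
    open ≡-Reasoning
    eq₁ : ∀ B n N r → 2 * B * (n + N) + 2 * (B * r) ≡ 2 * B * (n + r + N)
    eq₁ = solve-∀
    eq₂ : ∀ B N → 2 * B * (N + N) ≡ 4 * B * N
    eq₂ = solve-∀

  -- A degree below (1/2 + 1/(4B)) u means a load above u (p + 1)/(2B). The `L`-th power of this
  -- single load would already exceed what the invariant and `growth` allow for the whole sum.
  invariant⇒degree : ∀ t U → t ≤ T₀ → 0 < card U → Invariant t U →
    ∀ j → card U * (2 * B + 1) ≤ 4 * B * card (U ∩ neighbourhood j)
  invariant⇒degree t U t≤ 0<u inv j = ≮⇒≥ λ bad → <⇒≱ (heavy bad) light
    where
    u d q K : ℕ
    u = card U
    d = card (U ∩ neighbourhood j)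
    q = card (U ∖ neighbourhood j)
    K = N ^ L * X ^ (L * t)
    excess : 4 * B * d < u * (2 * B + 1) → suc p * u < 2 * B * load U j
    excess bad = lin {suc (4 * B * d)} {u * (2 * B + 1)} bad (≤-reflexive (begin
      suc (suc p * u) + u * (2 * B + 1) ≡⟨ eq₁ p u B ⟩
      suc ((p + 2) * u + 2 * B * u) ≡⟨ cong (λ z → suc (z * u + 2 * B * u)) p-eq ⟩
      suc (4 * B * u + 2 * B * u) ≡⟨ cong (λ z → suc (4 * B * z + 2 * B * u)) (card-split U (neighbourhood j)) ⟩
      suc (4 * B * (d + q) + 2 * B * u) ≡⟨ eq₂ B d q u ⟩
      2 * B * (2 * q + u) + suc (4 * B * d) ∎))
      where
      open ≡-Reasoning
      eq₁ : ∀ p u B → 1 + ((1 + p) * u) + u * (2 * B + 1) ≡ 1 + ((p + 2) * u + 2 * B * u)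
      eq₁ = solve-∀
      eq₂ : ∀ B d q u → 1 + (4 * B * (d + q) + 2 * B * u) ≡ 2 * B * (2 * q + u) + (1 + (4 * B * d))
      eq₂ = solve-∀
    0<K : 0 < K
    0<K = *-mono-< (0<^ {N} L 0<N) (0<^ {X} (L * t) 0<X)
    open ≤-Reasoning
    heavy : 4 * B * d < u * (2 * B + 1) → (suc p * u) ^ L * K < (2 * B) ^ L * potential L U * K
    heavy bad = *-monoˡ-< K ⦃ >-nonZero 0<K ⦄ (begin-strict
      (suc p * u) ^ L <⟨ ^-monoˡ-< L (excess bad) ⟩
      (2 * B * load U j) ^ L ≡⟨ ^-distribʳ-* L (2 * B) (load U j) ⟩
      (2 * B) ^ L * load U j ^ L ≤⟨ *-monoʳ-≤ ((2 * B) ^ L) (term≤sum (λ j → load U j ^ L) j) ⟩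
      (2 * B) ^ L * potential L U ∎)
    light : (2 * B) ^ L * potential L U * K ≤ (suc p * u) ^ L * K
    light = begin
      (2 * B) ^ L * potential L U * K ≡⟨ *-assoc ((2 * B) ^ L) (potential L U) K ⟩
      (2 * B) ^ L * (potential L U * K) ≤⟨ *-monoʳ-≤ ((2 * B) ^ L) inv ⟩
      (2 * B) ^ L * (2 * N * (n + N) ^ L * (u ^ L * suc X ^ (L * t)))
        ≡⟨ eq₁ ((2 * B) ^ L) (2 * N) ((n + N) ^ L) (u ^ L) (suc X ^ (L * t)) ⟩
      ((2 * B) ^ L * (n + N) ^ L) * (2 * N * (u ^ L * suc X ^ (L * t)))
        ≡⟨ cong (_* (2 * N * (u ^ L * suc X ^ (L * t)))) (^-distribʳ-* L (2 * B) (n + N)) ⟨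
      (2 * B * (n + N)) ^ L * (2 * N * (u ^ L * suc X ^ (L * t)))
        ≤⟨ *-monoˡ-≤ (2 * N * (u ^ L * suc X ^ (L * t))) (^-monoˡ-≤ L spread) ⟩
      (p * N) ^ L * (2 * N * (u ^ L * suc X ^ (L * t)))
        ≡⟨ cong (_* (2 * N * (u ^ L * suc X ^ (L * t)))) (^-distribʳ-* L p N) ⟩
      p ^ L * N ^ L * (2 * N * (u ^ L * suc X ^ (L * t)))
        ≡⟨ eq₂ (p ^ L) (N ^ L) (2 * N) (u ^ L) (suc X ^ (L * t)) ⟩
      2 * N * (p ^ L * suc X ^ (L * t)) * (N ^ L * u ^ L)
        ≤⟨ *-monoˡ-≤ (N ^ L * u ^ L) (growth t t≤) ⟩
      suc p ^ L * X ^ (L * t) * (N ^ L * u ^ L)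
        ≡⟨ eq₃ (suc p ^ L) (X ^ (L * t)) (N ^ L) (u ^ L) ⟩
      suc p ^ L * u ^ L * K ≡⟨ cong (_* K) (^-distribʳ-* L (suc p) u) ⟨
      (suc p * u) ^ L * K ∎
      where
      eq₁ : ∀ b n c u x → b * (n * c * (u * x)) ≡ (b * c) * (n * (u * x))
      eq₁ = solve-∀
      eq₂ : ∀ p N n u x → p * N * (n * (u * x)) ≡ n * (p * x) * (N * u)
      eq₂ = solve-∀
      eq₃ : ∀ p x N u → p * x * (N * u) ≡ p * u * (N * x)
      eq₃ = solve-∀

  tree-step : ∀ t σ U a d x (sub : Forest n) → Branching Δ sub → roots sub ≤ Δ →
    suc (size sub) ≤ S → suc (size sub) ≤ σ → m ≤ σ → t ≤ T₀ → r₀ ≤ card U → Invariant t U →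
    ∃₂ λ z U' → T (U z) × T (nbr G d a z) × Emb G (U ∖ (_== z)) z sub U' × Invariant (t + σ) U'
  tree-step t σ U a d x sub br ro s≤S s≤σ m≤σ t≤ r₀≤u inv =
    let z , U' , Uz , az , e , le = CheapTree.cheap-tree {n = n} G U price B S (sum weight) y g'
          0<B g-eq degrees price≤ (weight-average half) 0<y 0<S (<-≤-trans S-small r₀≤u)
          h Δ d x sub a σ br ro s≤S s≤σ decay (≤-trans ball m≤σ)
    in z , U' , Uz , az , e , advance z U' Uz e le
    where
    s = suc (size sub)
    u = card U
    0<u : 0 < u
    0<u = ≤-trans 0<r₀ r₀≤u
    open Price U s l
    deg : ∀ j → u * (2 * B + 1) ≤ 4 * B * card (U ∩ neighbourhood j)
    deg = invariant⇒degree t U t≤ 0<u inv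
    degrees : ∀ a d → u * (2 * B + 1) ≤ 4 * B * card (U ∩ nbr G d a)
    degrees a d = subst (λ Z → u * (2 * B + 1) ≤ 4 * B * card (U ∩ Z)) (neighbourhood-index d a) (deg (index d a))
    open ≤-Reasoning
    half : ∀ j → u ≤ 2 * card (U ∩ neighbourhood j)
    half j = *-cancelˡ-≤ (2 * B) ⦃ >-nonZero (*-mono-< {0} {2} z<s 0<B) ⦄ (begin
      2 * B * u ≡⟨ *-comm (2 * B) u ⟩
      u * (2 * B) ≤⟨ *-monoʳ-≤ u (m≤m+n (2 * B) 1) ⟩
      u * (2 * B + 1) ≤⟨ deg j ⟩
      4 * B * card (U ∩ neighbourhood j) ≡⟨ eq B (card (U ∩ neighbourhood j)) ⟩
      2 * B * (2 * card (U ∩ neighbourhood j)) ∎)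
      where
      eq : ∀ B d → 4 * B * d ≡ 2 * B * (2 * d)
      eq = solve-∀
    advance : ∀ z U' → T (U z) → (e : Emb G (U ∖ (_== z)) z sub U') →
      (price z + cost price e) * (u * y) ≤ sumOver U price * (s * y + 7 * σ) → Invariant (t + σ) U'
    advance z U' Uz e le = *-cancelʳ-≤ _ _ (X * u ^ L) ⦃ >-nonZero (*-mono-< 0<X (0<^ {u} L 0<u)) ⦄ (begin
      Φ' * (N ^ L * X ^ (L * (t + σ))) * (X * u ^ L)
        ≡⟨ cong (λ k → Φ' * (N ^ L * k) * (X * u ^ L)) (pow X) ⟩
      Φ' * (N ^ L * (X ^ (L * t) * X ^ (L * σ))) * (X * u ^ L)
        ≡⟨ eq₁ Φ' (N ^ L) (X ^ (L * t)) (X ^ (L * σ)) X (u ^ L) ⟩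
      X * (u ^ L * Φ') * (N ^ L * X ^ (L * t)) * X ^ (L * σ)
        ≤⟨ *-monoˡ-≤ (X ^ (L * σ)) (*-monoˡ-≤ (N ^ L * X ^ (L * t)) shrunk) ⟩
      (X + L * σ) * (u' ^ L * Φ) * (N ^ L * X ^ (L * t)) * X ^ (L * σ)
        ≡⟨ eq₂ (X + L * σ) (u' ^ L) Φ (N ^ L * X ^ (L * t)) (X ^ (L * σ)) ⟩
      (Φ * (N ^ L * X ^ (L * t))) * u' ^ L * ((X + L * σ) * X ^ (L * σ))
        ≤⟨ *-mono-≤ (*-monoˡ-≤ (u' ^ L) inv) (bernoulli′ (L * σ)) ⟩
      2 * N * (n + N) ^ L * (u ^ L * suc X ^ (L * t)) * u' ^ L * (X * suc X ^ (L * σ))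
        ≡⟨ eq₃ (2 * N * (n + N) ^ L) (u ^ L) (suc X ^ (L * t)) (u' ^ L) X (suc X ^ (L * σ)) ⟩
      2 * N * (n + N) ^ L * (u' ^ L * (suc X ^ (L * t) * suc X ^ (L * σ))) * (X * u ^ L)
        ≡⟨ cong (λ k → 2 * N * (n + N) ^ L * (u' ^ L * k) * (X * u ^ L)) (pow (suc X)) ⟨
      2 * N * (n + N) ^ L * (u' ^ L * suc X ^ (L * (t + σ))) * (X * u ^ L) ∎)
      where
      u' = card U'
      Φ = potential L U
      Φ' = potential L U'
      shrunk : X * (u ^ L * Φ') ≤ (X + L * σ) * (u' ^ L * Φ)
      shrunk = Step.potential-step U U' s l y σ (price z + cost price e)
        (λ v q → proj₁ (∧⁻ (U v) (Emb-⊆ e v q)))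
        (trans (card-∸-δ U z Uz) (cong suc (card-Emb e)))
        (≤-trans (*-monoˡ-≤ (suc y) (*-monoˡ-≤ L (*-monoʳ-≤ 4 s≤S))) (≤-trans SL-small r₀≤u))
        (≤-trans (*-monoʳ-≤ 6 s≤S) (≤-trans 6S r₀≤u)) s≤σ 0<y 0<u
        (trans (sumOver-∸-δ U z price Uz) (trans (cong (price z +_) (cost-sum price e)) (sym (+-assoc (price z) _ _))))
        le X (≤-trans X-small (*-monoˡ-≤ y r₀≤u))
      pow : ∀ Z → Z ^ (L * (t + σ)) ≡ Z ^ (L * t) * Z ^ (L * σ)
      pow Z = trans (cong (Z ^_) (*-distribˡ-+ L t σ)) (^-distribˡ-+-* Z (L * t) (L * σ))
      -- Converts the factor 1 + L σ / X of one step into powers of 1 + 1/X, so that the charges add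
      -- up in the exponent.
      bernoulli′ : ∀ k → (X + k) * X ^ k ≤ X * suc X ^ k
      bernoulli′ zero = ≤-reflexive (cong (_* 1) (+-identityʳ X))
      bernoulli′ (suc k) = begin
        (X + suc k) * (X * X ^ k) ≡⟨ eq X k (X ^ k) ⟩
        X * (X ^ suc k + suc k * (X ^ k * 1)) ≤⟨ *-monoʳ-≤ X (bernoulli k X 1) ⟩
        X * (X + 1) ^ suc k ≡⟨ cong (λ z → X * z ^ suc k) (+-comm X 1) ⟩
        X * suc X ^ suc k ∎
        where
        eq : ∀ X k q → (X + (1 + k)) * (X * q) ≡ X * (X * q + (1 + k) * (q * 1))
        eq = solve-∀
      eq₁ : ∀ f N a b X u → f * (N * (a * b)) * (X * u) ≡ X * (u * f) * (N * a) * b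
      eq₁ = solve-∀
      eq₂ : ∀ c u f k b → c * (u * f) * k * b ≡ f * k * u * (c * b)
      eq₂ = solve-∀
      eq₃ : ∀ c u a v X b → c * (u * a) * v * (X * b) ≡ c * (v * (a * b)) * (X * u)
      eq₃ = solve-∀

-- Cutting the tree into pieces

𝟙-∖-== : ∀ {N} (A : Fin N → Bool) b → T (A b) → ∀ v → 𝟙 (A v) ≡ 𝟙 (v == b) + 𝟙 ((A ∖ (_== b)) v)
𝟙-∖-== A b Ab v with v Fin.≟ b
... | yes refl = trans (𝟙-true Ab) (cong suc (sym (𝟙-false λ h → proj₂ (∧⁻ (A b) h))))
... | no _ with A v
... | true = refl
... | false = refl

-- Carries no available sets: a piece is placed completely before the pieces below it, which is not
-- the order in which `Emb` threads a forest. Injectivity is recovered by counting occurrences.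
data Hom {N n} (G : Digraph N) : Fin N → Forest n → Set where
  nil  : ∀ {a} → Hom G a nil
  cons : ∀ {a d x sub rest} (b : Fin N) → T (nbr G d a b) →
    Hom G b sub → Hom G a rest → Hom G a (cons d x sub rest)

module _ {N n : ℕ} {G : Digraph N} where

  occ : ∀ {a} {F : Forest n} → Hom G a F → Fin N → ℕ
  occ nil v = 0
  occ (cons b _ s r) v = 𝟙 (v == b) + (occ s v + occ r v)

  forget : ∀ {A a A'} {F : Forest n} → Emb G A a F A' → Hom G a F
  forget nil = nil
  forget (cons b _ ab e f) = cons b ab (forget e) (forget f)

  occ-forget : ∀ {A a A'} {F : Forest n} (e : Emb G A a F A') v →
    𝟙 (A v) ≡ occ (forget e) v + 𝟙 (A' v)
  occ-forget nil v = refl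
  occ-forget {A} {A' = A''} (cons {A' = A'} b Ab _ e f) v = begin
    𝟙 (A v) ≡⟨ 𝟙-∖-== A b Ab v ⟩
    𝟙 (v == b) + 𝟙 ((A ∖ (_== b)) v)
      ≡⟨ cong (𝟙 (v == b) +_) (trans (occ-forget e v) (cong (occ (forget e) v +_) (occ-forget f v))) ⟩
    𝟙 (v == b) + (occ (forget e) v + (occ (forget f) v + 𝟙 (A'' v)))
      ≡⟨ eq (𝟙 (v == b)) (occ (forget e) v) (occ (forget f) v) (𝟙 (A'' v)) ⟩
    𝟙 (v == b) + (occ (forget e) v + occ (forget f) v) + 𝟙 (A'' v) ∎
    where
    open ≡-Reasoning
    eq : ∀ a b c d → a + (b + (c + d)) ≡ a + (b + c) + d
    eq = solve-∀

-- The mark says whether the edge to the parent is cut, that is, whether the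
-- vertex is the root of a new piece.
data Marked (n : ℕ) : Set where
  nil  : Marked n
  cons : (cut d : Bool) (x : Fin n) (sub rest : Marked n) → Marked n

trim erase : ∀ {n} → Marked n → Forest n
trim nil = nil
trim (cons true  d x sub rest) = trim rest
trim (cons false d x sub rest) = cons d x (trim sub) (trim rest)
erase nil = nil
erase (cons _ d x sub rest) = cons d x (erase sub) (erase rest)

cutSize : ∀ {n} → Marked n → ℕ
cutSize nil = 0
cutSize (cons true  d x sub rest) = suc (size (trim sub)) + cutSize sub + cutSize rest
cutSize (cons false d x sub rest) = cutSize sub + cutSize rest

size-erase : ∀ {n} (F : Marked n) → size (erase F) ≡ size (trim F) + cutSize F
size-erase nil = refl
size-erase (cons true d x sub rest) =
  trans (cong suc (cong₂ _+_ (size-erase sub) (size-erase rest)))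
    (eq (size (trim sub)) (cutSize sub) (size (trim rest)) (cutSize rest))
  where
  eq : ∀ a b c d → 1 + ((a + b) + (c + d)) ≡ c + (1 + a + b + d)
  eq = solve-∀
size-erase (cons false d x sub rest) =
  trans (cong suc (cong₂ _+_ (size-erase sub) (size-erase rest)))
    (eq (size (trim sub)) (cutSize sub) (size (trim rest)) (cutSize rest))
  where
  eq : ∀ a b c d → 1 + ((a + b) + (c + d)) ≡ 1 + (a + c) + (b + d)
  eq = solve-∀

-- Cuts from the leaves upwards, as soon as what remains below an edge reaches `m` vertices. An
-- uncut child thus carries fewer than `m`, which bounds a piece by 1 + Δ m.
mark : ∀ {n} → ℕ → Forest n → Marked n
mark m nil = nil
mark m (cons d x sub rest) =
  cons (m ≤ᵇ suc (size (trim (mark m sub)))) d x (mark m sub) (mark m rest)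

erase-mark : ∀ {n} m (F : Forest n) → erase (mark m F) ≡ F
erase-mark m nil = refl
erase-mark m (cons d x sub rest) = cong₂ (cons d x) (erase-mark m sub) (erase-mark m rest)

trim-mark-size : ∀ {n} m (F : Forest n) → size (trim (mark m F)) ≤ roots F * m
trim-mark-size m nil = z≤n
trim-mark-size m (cons d x sub rest) with m ≤ᵇ suc (size (trim (mark m sub))) in eq
... | true  = ≤-trans (trim-mark-size m rest) (m≤n+m _ m)
... | false = +-mono-≤ (≰⇒≥ λ h → subst T eq (≤⇒≤ᵇ h)) (trim-mark-size m rest)

trim-mark-roots : ∀ {n} m (F : Forest n) → roots (trim (mark m F)) ≤ roots F
trim-mark-roots m nil = z≤n
trim-mark-roots m (cons d x sub rest) with m ≤ᵇ suc (size (trim (mark m sub)))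
... | true  = ≤-trans (trim-mark-roots m rest) (n≤1+n _)
... | false = s≤s (trim-mark-roots m rest)

trim-mark-branching : ∀ {n} m {Δ} {F : Forest n} → Branching Δ F → Branching Δ (trim (mark m F))
trim-mark-branching m nil = nil
trim-mark-branching m (cons {sub = sub} ro br br') with m ≤ᵇ suc (size (trim (mark m sub)))
... | true  = trim-mark-branching m br'
... | false = cons (≤-trans (trim-mark-roots m sub) ro) (trim-mark-branching m br) (trim-mark-branching m br')

data Pieces {n} (m S Δ : ℕ) : Marked n → Set where
  nil  : Pieces m S Δ nil
  cons : ∀ {cut d x sub rest} →
    (T cut → m ≤ suc (size (trim sub)) × suc (size (trim sub)) ≤ S ×
      Branching Δ (trim sub) × roots (trim sub) ≤ Δ) →
    Pieces m S Δ sub → Pieces m S Δ rest → Pieces m S Δ (cons cut d x sub rest)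

mark-pieces : ∀ {n} m {Δ} {F : Forest n} → Branching Δ F → Pieces m (suc (Δ * m)) Δ (mark m F)
mark-pieces m nil = nil
mark-pieces m (cons {sub = sub} ro br br') = cons
  (λ cut → ≤ᵇ⇒≤ _ _ cut , s≤s (≤-trans (trim-mark-size m sub) (*-monoˡ-≤ m ro)) ,
    trim-mark-branching m br , ≤-trans (trim-mark-roots m sub) ro)
  (mark-pieces m br) (mark-pieces m br')

module Embedding {N : ℕ} (n : ℕ) (G : Digraph N) (r₀ S m Δ : ℕ)
  (N-eq : n + r₀ ≡ N) (S-eq : S ≡ suc (Δ * m)) (0<N : 0 < N)
  (Invariant : ℕ → (Fin N → Bool) → Set)
  (initial : Invariant 0 (λ _ → true))
  (tree-step : ∀ t σ U a d (x : Fin n) (sub : Forest n) → Branching Δ sub → roots sub ≤ Δ →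
    suc (size sub) ≤ S → suc (size sub) ≤ σ → m ≤ σ → t ≤ n + m → r₀ ≤ card U → Invariant t U →
    ∃₂ λ z U' → T (U z) × T (nbr G d a z) × Emb G (U ∖ (_== z)) z sub U' × Invariant (t + σ) U')
  where

  -- t counts the vertices used so far, except that the first piece counts as
  -- m more than its size since it may be small.
  record State (t rest : ℕ) (U : Fin N → Bool) : Set where
    field
      invariant : Invariant t U
      used      : card U + t ≡ N + m
      remaining : t + rest ≤ n + m
  open State

  enough : ∀ {t rest U} → State t rest U → r₀ ≤ card U
  enough {t} {rest} {U} st = lin {t + rest} {n + m} (remaining st) (begin
    r₀ + (n + m) ≡⟨ eq r₀ n m ⟩
    n + r₀ + m ≡⟨ cong (_+ m) N-eq ⟩
    N + m ≡⟨ used st ⟨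
    card U + t ≤⟨ +-monoʳ-≤ (card U) (m≤m+n t rest) ⟩
    card U + (t + rest) ∎)
    where
    open ≤-Reasoning
    eq : ∀ r n m → r + (n + m) ≡ n + r + m
    eq = solve-∀

  -- `h₀` is the part already placed, to which the cut pieces are added. The final equation
  -- conserves vertices: those free or in `h₀` before are those free or in `h` afterwards.
  complete : ∀ (F : Marked n) a (h₀ : Hom G a (trim F)) t rest U → Pieces m S Δ F →
    State t (cutSize F + rest) U →
    ∃₂ λ (h : Hom G a (erase F)) U' → State (t + cutSize F) rest U' ×
      (∀ v → 𝟙 (U v) + occ h₀ v ≡ occ h v + 𝟙 (U' v))
  complete nil a nil t rest U nil st = nil , U ,
    subst (λ k → State k rest U) (sym (+-identityʳ t)) st , λ v → +-identityʳ (𝟙 (U v))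
  complete (cons false d x sub tail) a (cons b ab s₀ r₀') t rest U (cons _ ps ps') st =
    let s , U₁ , st₁ , o₁ = complete sub b s₀ t (cutSize tail + rest) U ps
          (subst (λ k → State t k U) (+-assoc (cutSize sub) (cutSize tail) rest) st)
        r , U₂ , st₂ , o₂ = complete tail a r₀' (t + cutSize sub) rest U₁ ps' st₁
    in cons b ab s r , U₂ ,
       subst (λ k → State k rest U₂) (+-assoc t (cutSize sub) (cutSize tail)) st₂ ,
       λ v → tally v (occ s₀ v) (occ s v) (occ r₀' v) (occ r v) (o₁ v) (o₂ v)
    where
    tally : ∀ v {u u₁ u₂} s₀ s r₀ r → u + s₀ ≡ s + u₁ → u₁ + r₀ ≡ r + u₂ →
      u + (𝟙 (v == b) + (s₀ + r₀)) ≡ 𝟙 (v == b) + (s + r) + u₂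
    tally v {u} {u₁} {u₂} s₀ s r₀ r p q = begin
      u + (k + (s₀ + r₀)) ≡⟨ eq₁ u k s₀ r₀ ⟩
      k + r₀ + (u + s₀) ≡⟨ cong (k + r₀ +_) p ⟩
      k + r₀ + (s + u₁) ≡⟨ eq₂ k r₀ s u₁ ⟩
      k + s + (u₁ + r₀) ≡⟨ cong (k + s +_) q ⟩
      k + s + (r + u₂) ≡⟨ eq₃ k s r u₂ ⟩
      k + (s + r) + u₂ ∎
      where
      open ≡-Reasoning
      k = 𝟙 (v == b)
      eq₁ : ∀ u k s r → u + (k + (s + r)) ≡ k + r + (u + s)
      eq₁ = solve-∀
      eq₂ : ∀ k r s u → k + r + (s + u) ≡ k + s + (u + r)
      eq₂ = solve-∀
      eq₃ : ∀ k s r u → k + s + (r + u) ≡ k + (s + r) + u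
      eq₃ = solve-∀
  complete (cons true d x sub tail) a h₀ t rest U (cons piece ps ps') st =
    let m≤s , s≤S , br , ro = piece tt
        z , U₁ , Uz , az , e , inv = tree-step t s U a d x (trim sub) br ro s≤S ≤-refl m≤s
          (≤-trans (m≤m+n t _) (remaining st)) (enough st) (invariant st)
        st₁ : State (t + s) (cutSize sub + (cutSize tail + rest)) U₁
        st₁ = record
          { invariant = inv
          ; used = trans (trans (shift (card U₁) t s)
              (cong (_+ t) (sym (trans (card-∸-δ U z Uz) (cong suc (card-Emb e)))))) (used st)
          ; remaining = ≤-trans (≤-reflexive (regroup t s (cutSize sub) (cutSize tail) rest)) (remaining st) }
        hs , U₂ , st₂ , o₂ = complete sub z (forget e) (t + s) (cutSize tail + rest) U₁ ps st₁
        hr , U₃ , st₃ , o₃ = complete tail a h₀ (t + s + cutSize sub) rest U₂ ps' st₂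
    in cons z az hs hr , U₃ ,
       subst (λ k → State k rest U₃) (regroup′ t s (cutSize sub) (cutSize tail)) st₃ ,
       λ v → tally v z (occ (forget e) v) (occ hs v) (occ h₀ v) (occ hr v)
         (trans (𝟙-∖-== U z Uz v) (cong (𝟙 (v == z) +_) (occ-forget e v))) (o₂ v) (o₃ v)
    where
    s = suc (size (trim sub))
    shift : ∀ u t s → u + (t + s) ≡ s + u + t
    shift = solve-∀
    regroup : ∀ t s a b c → t + s + (a + (b + c)) ≡ t + (s + a + b + c)
    regroup = solve-∀
    regroup′ : ∀ t s a b → t + s + a + b ≡ t + (s + a + b)
    regroup′ = solve-∀
    tally : ∀ v z {u u₁ u₂ u₃} e s h₀ r → u ≡ 𝟙 (v == z) + (e + u₁) → u₁ + e ≡ s + u₂ → u₂ + h₀ ≡ r + u₃ →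
      u + h₀ ≡ 𝟙 (v == z) + (s + r) + u₃
    tally v z {u} {u₁} {u₂} {u₃} e s h₀ r p q w = begin
      u + h₀ ≡⟨ cong (_+ h₀) p ⟩
      k + (e + u₁) + h₀ ≡⟨ eq₁ k e u₁ h₀ ⟩
      k + (u₁ + e) + h₀ ≡⟨ cong (λ i → k + i + h₀) q ⟩
      k + (s + u₂) + h₀ ≡⟨ eq₂ k s u₂ h₀ ⟩
      k + s + (u₂ + h₀) ≡⟨ cong (k + s +_) w ⟩
      k + s + (r + u₃) ≡⟨ eq₃ k s r u₃ ⟩
      k + (s + r) + u₃ ∎
      where
      open ≡-Reasoning
      k = 𝟙 (v == z)
      eq₁ : ∀ k e u h → k + (e + u) + h ≡ k + (u + e) + h
      eq₁ = solve-∀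
      eq₂ : ∀ k s u h → k + (s + u) + h ≡ k + s + (u + h)
      eq₂ = solve-∀
      eq₃ : ∀ k s r u → k + s + (r + u) ≡ k + (s + r) + u
      eq₃ = solve-∀

  embed-tree : ∀ (x : Fin n) (F : Forest n) → suc (size F) ≡ n → Branching Δ F → roots F ≤ Δ →
    ∃₂ λ z (h : Hom G z F) → ∀ v → 𝟙 (v == z) + occ h v ≤ 1
  embed-tree x F size-F br ro =
    -- An arbitrary vertex and direction stand in for the missing parent of the root. The charge
    -- `s + m` makes `m ≤ σ` true even for a small top piece.
    let z , U₁ , Uz , _ , e , inv = tree-step 0 (s + m) everything₀ (fromℕ< 0<N) true x (trim M)
          (trim-mark-branching m br) (≤-trans (trim-mark-roots m F) ro) s≤S (m≤m+n s m) (m≤n+m m s) z≤n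
          (≤-trans (≤-trans (m≤n+m r₀ n) (≤-reflexive N-eq)) (≤-reflexive (sym card₀))) initial
        st₁ : State (s + m) (cutSize M + 0) U₁
        st₁ = record
          { invariant = inv
          ; used = trans (shift (card U₁) s m) (cong (_+ m)
              (trans (sym (trans (card-∸-δ everything₀ z Uz) (cong suc (card-Emb e)))) card₀))
          ; remaining = ≤-reflexive (trans (shift′ s m (cutSize M))
              (cong (_+ m) (trans (cong suc (trans (sym (size-erase M)) (cong size (erase-mark m F)))) size-F))) }
        h , U₂ , _ , o = complete M z (forget e) (s + m) 0 U₁
          (subst (λ k → Pieces m k Δ M) (sym S-eq) (mark-pieces m br)) st₁
    in z , subst (Hom G z) (erase-mark m F) h , λ v →
       subst (λ k → 𝟙 (v == z) + k ≤ 1) (sym (occ-subst (erase-mark m F) h v))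
         (tally (𝟙 (v == z)) (occ (forget e) v) (occ h v)
           (trans (𝟙-∖-== everything₀ z Uz v) (cong (𝟙 (v == z) +_) (occ-forget e v))) (o v))
    where
    M = mark m F
    s = suc (size (trim M))
    everything₀ : Fin N → Bool
    everything₀ _ = true
    card₀ : card everything₀ ≡ N
    card₀ = trans (sum-const N 1) (*-identityʳ N)
    s≤S : s ≤ S
    s≤S = ≤-trans (s≤s (≤-trans (trim-mark-size m F) (*-monoˡ-≤ m ro))) (≤-reflexive (sym S-eq))
    shift : ∀ u s m → u + (s + m) ≡ s + u + m
    shift = solve-∀
    shift′ : ∀ s m c → s + m + (c + 0) ≡ s + c + m
    shift′ = solve-∀
    occ-subst : ∀ {z} {F F' : Forest n} (p : F ≡ F') (h : Hom G z F) v → occ (subst (Hom G z) p h) v ≡ occ h v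
    occ-subst refl h v = refl
    tally : ∀ k e h {u₁ u₂} → 1 ≡ k + (e + u₁) → u₁ + e ≡ h + u₂ → k + h ≤ 1
    tally k e h {u₁} {u₂} p q = begin
      k + h ≤⟨ +-monoʳ-≤ k (m≤m+n h u₂) ⟩
      k + (h + u₂) ≡⟨ cong (k +_) q ⟨
      k + (u₁ + e) ≡⟨ cong (k +_) (+-comm u₁ e) ⟩
      k + (e + u₁) ≡⟨ p ⟨
      1 ∎
      where open ≤-Reasoning

-- Reading an oriented tree as a labelled forest

-- Arc q F d p y: in the forest F hung below q, y is a child of p and d is the
-- orientation of the edge.
data Arc {n} (q : Fin n) : Forest n → Bool → Fin n → Fin n → Set where
  here : ∀ {d x sub rest} → Arc q (cons d x sub rest) d q x
  down : ∀ {d x sub rest e p y} → Arc x sub e p y → Arc q (cons d x sub rest) e p y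
  next : ∀ {d x sub rest e p y} → Arc q rest e p y → Arc q (cons d x sub rest) e p y

lab : ∀ {n} → Forest n → Fin n → ℕ
lab nil v = 0
lab (cons d x sub rest) v = 𝟙 (v == x) + (lab sub v + lab rest v)

sum-lab : ∀ {n} (F : Forest n) → sum (lab F) ≡ size F
sum-lab {n} nil = trans (sum-const n 0) (*-zeroʳ n)
sum-lab (cons d x sub rest) = begin
  sum (λ v → 𝟙 (v == x) + (lab sub v + lab rest v))
    ≡⟨ ∑-distrib-+ (λ v → 𝟙 (v == x)) (λ v → lab sub v + lab rest v) ⟩
  sum (λ v → 𝟙 (v == x)) + sum (λ v → lab sub v + lab rest v)
    ≡⟨ cong₂ _+_ (trans (sum-cong-≗ λ v → sym (*-identityʳ (𝟙 (v == x)))) (sum-δ x (λ _ → 1)))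
         (trans (∑-distrib-+ (lab sub) (lab rest)) (cong₂ _+_ (sum-lab sub) (sum-lab rest))) ⟩
  suc (size sub + size rest) ∎
  where open ≡-Reasoning

module _ {n : ℕ} where

  occurrences : ∀ {A : Set} → (A → Fin n) → List A → Fin n → ℕ
  occurrences f [] v = 0
  occurrences f (p ∷ ps) v = 𝟙 (v == f p) + occurrences f ps v

  occurrences-++ : ∀ {A : Set} (f : A → Fin n) ps qs v →
    occurrences f (ps ++ qs) v ≡ occurrences f ps v + occurrences f qs v
  occurrences-++ f [] qs v = refl
  occurrences-++ f (p ∷ ps) qs v = trans (cong (𝟙 (v == f p) +_) (occurrences-++ f ps qs v))
    (sym (+-assoc (𝟙 (v == f p)) _ _))

  ∈⇒occurs : ∀ {A : Set} (f : A → Fin n) {p ps} → p ∈ ps → 1 ≤ occurrences f ps (f p)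
  ∈⇒occurs f {p} (here refl) = ≤-trans (≤-reflexive (sym (𝟙-true (==-refl (f p))))) (m≤m+n _ _)
  ∈⇒occurs f {p} {q ∷ ps} (there i) = ≤-trans (∈⇒occurs f i) (m≤n+m _ (𝟙 (f p == f q)))

  occurs⇒∈ : ∀ {A : Set} (f : A → Fin n) ps v → 1 ≤ occurrences f ps v → ∃ λ p → p ∈ ps × f p ≡ v
  occurs⇒∈ f (p ∷ ps) v h with v Fin.≟ f p
  ... | yes e = p , here refl , sym e
  ... | no _ = let q , i , e = occurs⇒∈ f ps v h in q , there i , e

  occurs-once : ∀ {A : Set} (f : A → Fin n) {p q ps} → p ∈ ps → q ∈ ps → f p ≡ f q →
    occurrences f ps (f p) ≤ 1 → p ≡ q
  occurs-once f (here refl) (here refl) e h = refl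
  occurs-once f {p} {q} (here refl) (there {xs = ps} j) e h = ⊥-elim (<⇒≱ (s≤s (≤-trans (∈⇒occurs f j)
    (≤-reflexive (cong (occurrences f ps) (sym e)))))
    (≤-trans (≤-reflexive (cong (_+ occurrences f ps (f p)) (sym (𝟙-true (==-refl (f p)))))) h))
  occurs-once f {p} {q} (there {xs = ps} i) (here refl) e h = ⊥-elim (<⇒≱ (s≤s (∈⇒occurs f i))
    (≤-trans (≤-reflexive (cong (_+ occurrences f ps (f p))
      (sym (𝟙-true (subst (λ z → T (f p == z)) e (==-refl (f p))))))) h))
  occurs-once f {p} {ps = r ∷ ps} (there i) (there j) e h = occurs-once f i j e (m+n≤o⇒n≤o (𝟙 (f p == f r)) h)

module _ {N n : ℕ} {G : Digraph N} where

  pairs : ∀ {a} {F : Forest n} → Hom G a F → List (Fin n × Fin N)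
  pairs nil = []
  pairs (cons {x = x} b _ s r) = (x , b) ∷ (pairs s ++ pairs r)

  occurrences-pairs : ∀ {a} {F : Forest n} (h : Hom G a F) v → occurrences proj₂ (pairs h) v ≡ occ h v
  occurrences-pairs nil v = refl
  occurrences-pairs (cons b _ s r) v = cong (𝟙 (v == b) +_)
    (trans (occurrences-++ proj₂ (pairs s) (pairs r) v)
      (cong₂ _+_ (occurrences-pairs s v) (occurrences-pairs r v)))

  occurrences-labels : ∀ {a} {F : Forest n} (h : Hom G a F) v → occurrences proj₁ (pairs h) v ≡ lab F v
  occurrences-labels nil v = refl
  occurrences-labels (cons {x = x} b _ s r) v = cong (𝟙 (v == x) +_)
    (trans (occurrences-++ proj₁ (pairs s) (pairs r) v)
      (cong₂ _+_ (occurrences-labels s v) (occurrences-labels r v)))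

  arc-image : ∀ {a q} {F : Forest n} {d p y} (h : Hom G a F) → Arc q F d p y →
    ∃₂ λ b c → (p , b) ∈ (q , a) ∷ pairs h × (y , c) ∈ pairs h × T (nbr G d b c)
  arc-image {a} (cons b ab s r) here = a , b , here refl , here refl , ab
  arc-image (cons b ab s r) (down arc) =
    let b' , c , i , j , e = arc-image s arc
    in b' , c , there (promote i) , there (∈-++⁺ˡ j) , e
    where
    promote : ∀ {w x ps qs} → w ∈ x ∷ ps → w ∈ x ∷ (ps ++ qs)
    promote (here e) = here e
    promote (there i) = there (∈-++⁺ˡ i)
  arc-image (cons {x = x} b ab s r) (next arc) =
    let b' , c , i , j , e = arc-image r arc
    in b' , c , skip i , there (∈-++⁺ʳ (pairs s) j) , e
    where
    skip : ∀ {w v ps} → w ∈ v ∷ ps → w ∈ v ∷ ((x , b) ∷ (pairs s ++ ps))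
    skip (here e) = here e
    skip (there i) = there (there (∈-++⁺ʳ (pairs s) i))

record Reading {n} (T' : OrientedTree n) (Δ : ℕ) : Set where
  field
    root      : Fin n
    forest    : Forest n
    branching : Branching Δ forest
    roots≤    : roots forest ≤ Δ
    once      : ∀ v → 𝟙 (v == root) + lab forest v ≡ 1
    arcs      : ∀ u v → T (E (graph T') u v) → Arc root forest true u v ⊎ Arc root forest false v u

  size-forest : suc (size forest) ≡ n
  size-forest = begin
    suc (size forest) ≡⟨ cong₂ _+_ (trans (sum-cong-≗ λ v → sym (*-identityʳ (𝟙 (v == root)))) (sum-δ root (λ _ → 1))) (sum-lab forest) ⟨
    sum (λ v → 𝟙 (v == root)) + sum (lab forest) ≡⟨ ∑-distrib-+ (λ v → 𝟙 (v == root)) (lab forest) ⟨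
    sum (λ v → 𝟙 (v == root) + lab forest v) ≡⟨ sum-cong-≗ once ⟩
    sum {n} (λ _ → 1) ≡⟨ trans (sum-const n 1) (*-identityʳ n) ⟩
    n ∎
    where open ≡-Reasoning

-- The list of labels with images is the graph of the embedding: labels occurring exactly once make
-- it a function, images occurring at most once make it injective.
hom⇒contains : ∀ {N n Δ} {G : Digraph N} {T' : OrientedTree n} (R : Reading T' Δ) z
  (h : Hom G z (Reading.forest R)) → (∀ v → 𝟙 (v == z) + occ h v ≤ 1) → Contains G T'
hom⇒contains {N} {n} {G = G} {T'} R z h simple = f , f-injective , f-edge
  where
  open Reading R
  ps : List (Fin n × Fin N)
  ps = (root , z) ∷ pairs h
  label-occurs : ∀ v → occurrences proj₁ ps v ≡ 1
  label-occurs v = trans (cong (𝟙 (v == root) +_) (occurrences-labels h v)) (once v)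
  place : ∀ v → ∃ λ p → p ∈ ps × proj₁ p ≡ v
  place v = occurs⇒∈ proj₁ ps v (≤-reflexive (sym (label-occurs v)))
  f : Fin n → Fin N
  f v = proj₂ (proj₁ (place v))
  f-unique : ∀ {v b} → (v , b) ∈ ps → f v ≡ b
  f-unique {v} i = let q , j , e = place v in
    cong proj₂ (occurs-once proj₁ j i e (≤-reflexive (label-occurs (proj₁ q))))
  f-injective : Injective _≡_ _≡_ f
  f-injective {u} {v} e =
    let p , i , pu = place u
        q , j , qv = place v
    in trans (sym pu) (trans (cong proj₁ (occurs-once proj₂ i j e
         (≤-trans (≤-reflexive (cong (𝟙 (f u == z) +_) (occurrences-pairs h (f u)))) (simple (f u))))) qv)
  f-edge : ∀ u v → T (E (graph T') u v) → T (E G (f u) (f v))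
  f-edge u v uv with arcs u v uv
  ... | inj₁ arc = let b , c , i , j , e = arc-image h arc in
    subst₂ (λ x y → T (E G x y)) (sym (f-unique i)) (sym (f-unique (there j))) e
  ... | inj₂ arc = let b , c , i , j , e = arc-image h arc in
    subst₂ (λ x y → T (E G x y)) (sym (f-unique (there j))) (sym (f-unique i)) e

-- `q` is the parent of the current list of siblings; the new child is appended wherever this parent
-- is `p`.
graft : ∀ {n} → Fin n → Bool → Fin n → Fin n → Forest n → Forest n
graft p d y q nil = case p Fin.≟ q of λ { (yes _) → cons d y nil nil ; (no _) → nil }
graft p d y q (cons e x sub rest) = cons e x (graft p d y x sub) (graft p d y q rest)

module _ {n : ℕ} (p : Fin n) (d : Bool) (y : Fin n) where

  lab-graft : ∀ q F v → lab (graft p d y q F) v ≡ lab F v + 𝟙 (v == y) * (𝟙 (p == q) + lab F p)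
  lab-graft q nil v with p Fin.≟ q
  ... | yes _ = trans (+-identityʳ _) (sym (*-identityʳ (𝟙 (v == y))))
  ... | no _ = sym (*-zeroʳ (𝟙 (v == y)))
  lab-graft q (cons e x sub rest) v = trans
    (cong (𝟙 (v == x) +_) (cong₂ _+_ (lab-graft x sub v) (lab-graft q rest v)))
    (eq (𝟙 (v == x)) (lab sub v) (lab rest v) (𝟙 (v == y)) (𝟙 (p == x)) (lab sub p) (𝟙 (p == q)) (lab rest p))
    where
    eq : ∀ a s r k b s' c r' → a + ((s + k * (b + s')) + (r + k * (c + r'))) ≡
      a + (s + r) + k * (c + (b + (s' + r')))
    eq = solve-∀

  arc-graft : ∀ {q F e a b} → Arc q F e a b → Arc q (graft p d y q F) e a b
  arc-graft here = here
  arc-graft (down arc) = down (arc-graft arc)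
  arc-graft (next arc) = next (arc-graft arc)

  arc-new : ∀ q F → 1 ≤ 𝟙 (p == q) + lab F p → Arc q (graft p d y q F) d p y
  arc-new q nil h with p Fin.≟ q
  ... | yes refl = here
  ... | no _ = ⊥-elim (<⇒≱ h z≤n)
  arc-new q (cons e x sub rest) h with 1 ≤? 𝟙 (p == x) + lab sub p
  ... | yes k = down (arc-new x sub k)
  ... | no ¬k = next (arc-new q rest (subst (1 ≤_) (trans (eq (𝟙 (p == q)) (𝟙 (p == x)) (lab sub p) (lab rest p))
      (cong (_+ (𝟙 (p == q) + lab rest p)) (n≤0⇒n≡0 (s≤s⁻¹ (≰⇒> ¬k))))) h))
    where
    eq : ∀ c b s r → c + (b + (s + r)) ≡ (b + s) + (c + r)
    eq = solve-∀

  arc-graft⁻ : ∀ q F {e a b} → Arc q (graft p d y q F) e a b →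
    Arc q F e a b ⊎ (e ≡ d × a ≡ p × b ≡ y)
  arc-graft⁻ q nil arc with p Fin.≟ q
  arc-graft⁻ q nil here | yes refl = inj₂ (refl , refl , refl)
  arc-graft⁻ q nil (down ()) | yes _
  arc-graft⁻ q nil (next ()) | yes _
  arc-graft⁻ q nil () | no _
  arc-graft⁻ q (cons e x sub rest) here = inj₁ here
  arc-graft⁻ q (cons e x sub rest) (down arc) = [ inj₁ ∘ down , inj₂ ]′ (arc-graft⁻ x sub arc)
  arc-graft⁻ q (cons e x sub rest) (next arc) = [ inj₁ ∘ next , inj₂ ]′ (arc-graft⁻ q rest arc)

data Path {A : Set} (R : A → A → Set) : A → A → List A → Set where
  done : ∀ {u} → Path R u u (u ∷ [])
  _▸_  : ∀ {u w v ws} → R u w → Path R w v ws → Path R u v (u ∷ ws)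

path-map : ∀ {A : Set} {R R' : A → A → Set} → (∀ {a b} → R a b → R' a b) →
  ∀ {u v ws} → Path R u v ws → Path R' u v ws
path-map f done = done
path-map f (r ▸ π) = f r ▸ path-map f π

path-snoc : ∀ {A : Set} {R : A → A → Set} {u v y ws} → Path R u v ws → R v y → Path R u y (ws ++ y ∷ [])
path-snoc done r = r ▸ done
path-snoc (r' ▸ π) r = r' ▸ path-snoc π r

count≡card : ∀ {n} (f : Fin n → Bool) → count f ≡ card f
count≡card {zero} f = refl
count≡card {suc n} f with f zero
... | true  = cong suc (count≡card (f ∘ suc))
... | false = count≡card (f ∘ suc)

≤maxF : ∀ {n} (f : Fin n → ℕ) i → f i ≤ maxF f
≤maxF f zero = m≤m⊔n (f zero) _
≤maxF f (suc i) = ≤-trans (≤maxF (f ∘ suc) i) (m≤n⊔m (f zero) _)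

module Read {n : ℕ} (T' : OrientedTree n) (x₀ : Fin n) where

  private
    H : Digraph n
    H = graph T'

  cnt : Forest n → Fin n → ℕ
  cnt F v = 𝟙 (v == x₀) + lab F v

  Sound : Fin n → Forest n → Set
  Sound q F = ∀ {d p y} → Arc q F d p y → T (nbr H d p y)

  TreeAdj : Forest n → Fin n → Fin n → Set
  TreeAdj F u v = ∃ λ d → Arc x₀ F d u v ⊎ Arc x₀ F d v u

  -- Simple paths are carried along so that an edge outside the finished spanning tree can be closed
  -- to a cycle.
  record Grown (F : Forest n) : Set where
    field
      atMostOnce : ∀ v → cnt F v ≤ 1
      sound      : Sound x₀ F
      path       : ∀ u v → 1 ≤ cnt F u → 1 ≤ cnt F v →
        ∃ λ ws → Path (TreeAdj F) u v ws × Unique ws × All (λ w → 1 ≤ cnt F w) ws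
  open Grown

  sum-cnt : ∀ F → sum (cnt F) ≡ suc (size F)
  sum-cnt F = trans (∑-distrib-+ (λ v → 𝟙 (v == x₀)) (lab F))
    (cong₂ _+_ (trans (sum-cong-≗ λ v → sym (*-identityʳ (𝟙 (v == x₀)))) (sum-δ x₀ (λ _ → 1))) (sum-lab F))

  nbr⇒UAdj : ∀ d u v → T (nbr H d u v) → T (UAdj H u v)
  nbr⇒UAdj true  u v h = Equivalence.from (T-∨ {E H u v}) (inj₁ h)
  nbr⇒UAdj false u v h = Equivalence.from (T-∨ {E H u v}) (inj₂ h)

  UAdj-sym : ∀ u v → T (UAdj H u v) → T (UAdj H v u)
  UAdj-sym u v h = Equivalence.from (T-∨ {E H v u}) ([ inj₂ , inj₁ ]′ (Equivalence.to (T-∨ {E H u v}) h))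

  -- Follows a walk to its first step out of the covered set, which provides the next vertex to
  -- graft.
  crossing : ∀ F {u v ws} → UWalk H (u ∷ ws) → EndsAt (u ∷ ws) v → 1 ≤ cnt F u → ¬ 1 ≤ cnt F v →
    ∃₂ λ p y → 1 ≤ cnt F p × ¬ 1 ≤ cnt F y × T (UAdj H p y)
  crossing F (single _) (here _) cu cv = ⊥-elim (cv cu)
  crossing F (step u w vs uw walk) (there _ ends) cu cv with 1 ≤? cnt F w
  ... | yes cw = crossing F walk ends cw cv
  ... | no ¬cw = u , w , cu , ¬cw , uw

  grown-nil : Grown nil
  grown-nil = record
    { atMostOnce = λ v → subst (_≤ 1) (sym (+-identityʳ _)) (𝟙≤1 (v == x₀))
    ; sound = λ ()
    ; path = λ u v cu cv → subst₂ (λ a b → ∃ λ ws → Path (TreeAdj nil) a b ws × Unique ws × All (λ w → 1 ≤ cnt nil w) ws)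
        (sym (only u cu)) (sym (only v cv))
        (x₀ ∷ [] , done , [] ∷ [] , x₀-covered ∷ []) }
    where
    only : ∀ u → 1 ≤ cnt nil u → u ≡ x₀
    only u h with u Fin.≟ x₀
    ... | yes e = e
    ... | no _ = ⊥-elim (<⇒≱ h z≤n)
    x₀-covered : 1 ≤ cnt nil x₀
    x₀-covered = ≤-trans (≤-reflexive (sym (𝟙-true (==-refl x₀)))) (m≤m+n _ 0)

  module Extend {F : Forest n} (gr : Grown F) (p y : Fin n) (cp : 1 ≤ cnt F p) (¬cy : ¬ 1 ≤ cnt F y)
    (d : Bool) (py : T (nbr H d p y)) where

    F' : Forest n
    F' = graft p d y x₀ F

    cnt-F' : ∀ v → cnt F' v ≡ cnt F v + 𝟙 (v == y)
    cnt-F' v = begin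
      𝟙 (v == x₀) + lab F' v ≡⟨ cong (𝟙 (v == x₀) +_) (lab-graft p d y x₀ F v) ⟩
      𝟙 (v == x₀) + (lab F v + 𝟙 (v == y) * cnt F p)
        ≡⟨ cong (λ k → 𝟙 (v == x₀) + (lab F v + 𝟙 (v == y) * k)) (≤-antisym (atMostOnce gr p) cp) ⟩
      𝟙 (v == x₀) + (lab F v + 𝟙 (v == y) * 1)
        ≡⟨ trans (cong (λ k → 𝟙 (v == x₀) + (lab F v + k)) (*-identityʳ _)) (sym (+-assoc (𝟙 (v == x₀)) _ _)) ⟩
      cnt F v + 𝟙 (v == y) ∎
      where open ≡-Reasoning

    -- Read off from the label counts, since `graft` inserts one vertex per occurrence of `p`.
    size-F' : size F' ≡ suc (size F)
    size-F' = suc-injective (begin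
      suc (size F') ≡⟨ sum-cnt F' ⟨
      sum (cnt F') ≡⟨ sum-cong-≗ cnt-F' ⟩
      sum (λ v → cnt F v + 𝟙 (v == y)) ≡⟨ ∑-distrib-+ (cnt F) (λ v → 𝟙 (v == y)) ⟩
      sum (cnt F) + sum (λ v → 𝟙 (v == y))
        ≡⟨ cong₂ _+_ (sum-cnt F) (trans (sum-cong-≗ λ v → sym (*-identityʳ (𝟙 (v == y)))) (sum-δ y (λ _ → 1))) ⟩
      suc (size F) + 1 ≡⟨ +-comm (suc (size F)) 1 ⟩
      suc (suc (size F)) ∎)
      where open ≡-Reasoning

    old : ∀ {v} → 1 ≤ cnt F v → 1 ≤ cnt F' v
    old {v} h = ≤-trans h (≤-trans (m≤m+n _ _) (≤-reflexive (sym (cnt-F' v))))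

    y-covered : 1 ≤ cnt F' y
    y-covered = ≤-trans (≤-trans (≤-reflexive (sym (𝟙-true (==-refl y)))) (m≤n+m _ (cnt F y)))
      (≤-reflexive (sym (cnt-F' y)))

    covered⁻ : ∀ v → 1 ≤ cnt F' v → v ≡ y ⊎ 1 ≤ cnt F v
    covered⁻ v h with v Fin.≟ y | cnt-F' v
    ... | yes e | _ = inj₁ e
    ... | no _ | e = inj₂ (subst (1 ≤_) (trans e (+-identityʳ _)) h)

    adj : ∀ {a b} → TreeAdj F a b → TreeAdj F' a b
    adj (e , inj₁ arc) = e , inj₁ (arc-graft p d y arc)
    adj (e , inj₂ arc) = e , inj₂ (arc-graft p d y arc)

    fresh : ∀ {ws} → All (λ w → 1 ≤ cnt F w) ws → All (y ≢_) ws
    fresh = All.map λ c e → ¬cy (subst (λ w → 1 ≤ cnt F w) (sym e) c)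

    unique-snoc : ∀ {ws} → Unique ws → All (y ≢_) ws → Unique (ws ++ y ∷ [])
    unique-snoc [] [] = [] ∷ []
    unique-snoc (a ∷ u) (y≢ ∷ f) = All.++⁺ a ((λ e → y≢ (sym e)) ∷ []) ∷ unique-snoc u f

    path' : ∀ u v → 1 ≤ cnt F' u → 1 ≤ cnt F' v →
      ∃ λ ws → Path (TreeAdj F') u v ws × Unique ws × All (λ w → 1 ≤ cnt F' w) ws
    path' u v cu cv with covered⁻ u cu | covered⁻ v cv
    ... | inj₁ refl | inj₁ refl = y ∷ [] , done , [] ∷ [] , y-covered ∷ []
    ... | inj₁ refl | inj₂ cv' =
      let ws , π , un , al = path gr p v cp cv'
      in y ∷ ws , (d , inj₂ (arc-new p d y x₀ F cp)) ▸ path-map adj π , fresh al ∷ un , y-covered ∷ All.map old al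
    ... | inj₂ cu' | inj₁ refl =
      let ws , π , un , al = path gr u p cu' cp
      in ws ++ y ∷ [] , path-snoc (path-map adj π) (d , inj₁ (arc-new p d y x₀ F cp)) ,
         unique-snoc un (fresh al) , All.++⁺ (All.map old al) (y-covered ∷ [])
    ... | inj₂ cu' | inj₂ cv' =
      let ws , π , un , al = path gr u v cu' cv'
      in ws , path-map adj π , un , All.map old al

    grown' : Grown F'
    grown' = record
      { atMostOnce = λ v → subst (_≤ 1) (sym (cnt-F' v)) (bound v)
      ; sound = λ arc → [ sound gr , (λ { (refl , refl , refl) → py }) ]′ (arc-graft⁻ p d y x₀ F arc)
      ; path = path' }
      where
      bound : ∀ v → cnt F v + 𝟙 (v == y) ≤ 1
      bound v with v Fin.≟ y
      ... | yes refl = ≤-reflexive (cong (_+ 1) (n≤0⇒n≡0 (s≤s⁻¹ (≰⇒> ¬cy))))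
      ... | no _ = subst (_≤ 1) (sym (+-identityʳ _)) (atMostOnce gr v)

  grow : ∀ k F → Grown F → suc (size F) + k ≡ n → ∃ λ F → Grown F × (∀ v → cnt F v ≡ 1)
  grow zero F gr e = F , gr , sum-tight (atMostOnce gr)
    (≤-reflexive (trans (sum-const n 1) (trans (*-identityʳ n)
      (trans (sym e) (trans (+-identityʳ _) (sym (sum-cnt F)))))))
  grow (suc k) F gr e =
    let v , ¬cv = sum-strict {f = cnt F} {λ _ → 1} (subst₂ _<_ (sym (sum-cnt F))
          (sym (trans (sum-const n 1) (*-identityʳ n))) (subst (suc (size F) <_) e (m<m+n _ z<s)))
        ws , walk , ends = connected T' x₀ v
        p , y , cp , ¬cy , adj = crossing F walk ends
          (≤-trans (≤-reflexive (sym (𝟙-true (==-refl x₀)))) (m≤m+n _ _)) (<⇒≱ ¬cv)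
    in [ attach p y cp ¬cy true , attach p y cp ¬cy false ]′ (Equivalence.to (T-∨ {E H p y}) adj)
    where
    attach : ∀ p y → 1 ≤ cnt F p → ¬ 1 ≤ cnt F y → ∀ d → T (nbr H d p y) →
      ∃ λ F → Grown F × (∀ v → cnt F v ≡ 1)
    attach p y cp ¬cy d py = grow k F' grown'
      (trans (cong (λ s → suc s + k) size-F') (trans (cong suc (sym (+-suc (size F) k))) e))
      where open Extend gr p y cp ¬cy d py

  module _ {F : Forest n} (gr : Grown F) (all : ∀ v → cnt F v ≡ 1) where

    asymmetric : ∀ {u v} → T (E H u v) → ¬ T (E H v u)
    asymmetric {u} {v} uv vu = subst T (oriented T' u v uv) vu

    treeAdj⇒arc : ∀ {u v} → T (E H u v) → TreeAdj F u v → Arc x₀ F true u v ⊎ Arc x₀ F false v u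
    treeAdj⇒arc uv (true  , inj₁ arc) = inj₁ arc
    treeAdj⇒arc uv (false , inj₁ arc) = ⊥-elim (asymmetric uv (sound gr arc))
    treeAdj⇒arc uv (true  , inj₂ arc) = ⊥-elim (asymmetric uv (sound gr arc))
    treeAdj⇒arc uv (false , inj₂ arc) = inj₂ arc

    treeAdj⇒UAdj : ∀ {u v} → TreeAdj F u v → T (UAdj H u v)
    treeAdj⇒UAdj {u} {v} (d , inj₁ arc) = nbr⇒UAdj d u v (sound gr arc)
    treeAdj⇒UAdj {u} {v} (d , inj₂ arc) = UAdj-sym v u (nbr⇒UAdj d v u (sound gr arc))

    path⇒walk : ∀ {u v ws} → Path (TreeAdj F) u v ws → UWalk H ws × EndsAt ws v
    path⇒walk (done {u}) = single u , here u
    path⇒walk (_▸_ {u} r done) = step u _ [] (treeAdj⇒UAdj r) (single _) , there u (here _)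
    path⇒walk (_▸_ {u} r π@(_ ▸ _)) = let w , e = path⇒walk π in
      step u _ _ (treeAdj⇒UAdj r) w , there u e

    -- An edge that is not in the spanning tree closes a cycle.
    edge⇒arc : ∀ u v → T (E H u v) → Arc x₀ F true u v ⊎ Arc x₀ F false v u
    edge⇒arc u v uv with path gr u v (≤-reflexive (sym (all u))) (≤-reflexive (sym (all v)))
    ... | _ , done , _ , _ = ⊥-elim (subst T (loopless H u) uv)
    ... | _ , (r ▸ done) , _ , _ = treeAdj⇒arc uv r
    ... | _ , π@(_▸_ {w = w} r (_ ▸ _)) , un , _ with v Fin.≟ w
    ... | yes refl = treeAdj⇒arc uv r
    ... | no v≢w = let walk , ends = path⇒walk π in ⊥-elim (acyclic T'
        (u , w , _ , v , walk , un , ends , v≢w , UAdj-sym u v (nbr⇒UAdj true u v uv)))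

  rootOcc : Forest n → Fin n → ℕ
  rootOcc nil v = 0
  rootOcc (cons d x sub rest) v = 𝟙 (v == x) + rootOcc rest v

  sum-rootOcc : ∀ F → sum (rootOcc F) ≡ roots F
  sum-rootOcc nil = trans (sum-const n 0) (*-zeroʳ n)
  sum-rootOcc (cons d x sub rest) = trans (∑-distrib-+ (λ v → 𝟙 (v == x)) (rootOcc rest))
    (cong₂ _+_ (trans (sum-cong-≗ λ v → sym (*-identityʳ (𝟙 (v == x)))) (sum-δ x (λ _ → 1))) (sum-rootOcc rest))

  rootOcc≤lab : ∀ F v → rootOcc F v ≤ lab F v
  rootOcc≤lab nil v = z≤n
  rootOcc≤lab (cons d x sub rest) v = +-monoʳ-≤ (𝟙 (v == x)) (≤-trans (rootOcc≤lab rest v) (m≤n+m _ (lab sub v)))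

  rootOcc⇒adj : ∀ q F v → Sound q F → 1 ≤ rootOcc F v → T (UAdj H q v)
  rootOcc⇒adj q (cons d x sub rest) v so h with v Fin.≟ x
  ... | yes refl = nbr⇒UAdj d q v (so here)
  ... | no _ = rootOcc⇒adj q rest v (so ∘ next) h

  -- The roots carry pairwise distinct labels, all adjacent to `q`.
  roots≤Δ : ∀ q F → Sound q F → (∀ v → lab F v ≤ 1) → roots F ≤ Δ T'
  roots≤Δ q F so le = begin
    roots F ≡⟨ sum-rootOcc F ⟨
    sum (rootOcc F) ≤⟨ sum-mono (λ v → aux v (UAdj H q v) (rootOcc⇒adj q F v so)) ⟩
    card (UAdj H q) ≡⟨ count≡card (UAdj H q) ⟨
    udeg H q ≤⟨ ≤maxF (udeg H) q ⟩
    Δ T' ∎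
    where
    open ≤-Reasoning
    aux : ∀ v b → (1 ≤ rootOcc F v → T b) → rootOcc F v ≤ 𝟙 b
    aux v true _ = ≤-trans (rootOcc≤lab F v) (le v)
    aux v false k = ≮⇒≥ k

  branching : ∀ q F → Sound q F → (∀ v → lab F v ≤ 1) → Branching (Δ T') F
  branching q nil so le = nil
  branching q (cons d x sub rest) so le = cons (roots≤Δ x sub (so ∘ down) le-sub)
      (branching x sub (so ∘ down) le-sub) (branching q rest (so ∘ next) le-rest)
    where
    le-sub : ∀ v → lab sub v ≤ 1
    le-sub v = ≤-trans (≤-trans (m≤m+n _ _) (m≤n+m _ (𝟙 (v == x)))) (le v)
    le-rest : ∀ v → lab rest v ≤ 1
    le-rest v = ≤-trans (≤-trans (m≤n+m _ (lab sub v)) (m≤n+m _ (𝟙 (v == x)))) (le v)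

  reading : ∀ k → 1 + k ≡ n → Reading T' (Δ T')
  reading k e =
    let F , gr , all = grow k nil grown-nil e
        le = λ v → ≤-trans (m≤n+m _ (𝟙 (v == x₀))) (≤-reflexive (all v))
    in record
      { root = x₀ ; forest = F ; branching = branching x₀ F (sound gr) le
      ; roots≤ = roots≤Δ x₀ F (sound gr) le ; once = all ; arcs = edge⇒arc gr all }

-- Choice of the parameters

square-cancel : ∀ {x n} → x * x ≤ n * n → x ≤ n
square-cancel h = ≮⇒≥ λ lt → <⇒≱ (*-mono-< lt lt) h

x≤x*x : ∀ x → x ≤ x * x
x≤x*x zero = z≤n
x≤x*x (suc x) = m≤m*n (suc x) (suc x)

n<2^n : ∀ n → n < 2 ^ n
n<2^n zero = z<s
n<2^n (suc n) = begin-strict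
  1 + n <⟨ +-mono-≤-< (m^n>0 2 n) (n<2^n n) ⟩
  2 ^ n + 2 ^ n ≡⟨ cong (2 ^ n +_) (+-identityʳ (2 ^ n)) ⟨
  2 ^ suc n ∎
  where open ≤-Reasoning

floor-root : ∀ e n → ∃ λ q → q ^ suc e ≤ n × n < suc q ^ suc e
floor-root e zero = 0 , z≤n , m^n>0 1 (suc e)
floor-root e (suc n) with floor-root e n
... | q , lo , hi with suc q ^ suc e ≤? suc n
... | yes le = suc q , le , ≤-<-trans hi (^-monoˡ-< (suc e) (n<1+n (suc q)))
... | no ¬le = q , ≤-trans lo (n≤1+n n) , ≰⇒> ¬le

ballSize≤ : ∀ Δ h → ballSize Δ h ≤ suc Δ ^ h
ballSize≤ Δ zero = z≤n
ballSize≤ Δ (suc h) = +-mono-≤ (0<^ {suc Δ} h z<s) (*-monoʳ-≤ Δ (ballSize≤ Δ h))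

-- Bernoulli: (1 + 1/x)^(x y) ≥ 1 + y.
decay-exponent : ∀ x y → 0 < x → 0 < y → x ^ (x * y) * y ≤ suc x ^ (x * y)
decay-exponent x y 0<x 0<y with x * y in eq
... | zero = ⊥-elim (<⇒≱ (*-mono-< 0<x 0<y) (≤-reflexive eq))
... | suc k = begin
  x * x ^ k * y ≡⟨ eq₁ x (x ^ k) y ⟩
  x * y * (x ^ k * 1) ≡⟨ cong (_* (x ^ k * 1)) eq ⟩
  suc k * (x ^ k * 1) ≤⟨ m≤n+m _ (x ^ suc k) ⟩
  x ^ suc k + suc k * (x ^ k * 1) ≤⟨ bernoulli k x 1 ⟩
  (x + 1) ^ suc k ≡⟨ cong (_^ suc k) (+-comm x 1) ⟩
  suc x ^ suc k ∎
  where
  open ≤-Reasoning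
  eq₁ : ∀ x q y → x * q * y ≡ x * y * (q * 1)
  eq₁ = solve-∀

doubling : ∀ M → 0 < M → 2 * M ^ M ≤ suc M ^ M
doubling (suc k) _ = begin
  2 * suc k ^ suc k ≡⟨ eq (suc k ^ suc k) ⟩
  suc k ^ suc k + suc k * suc k ^ k ≡⟨ cong (λ z → suc k ^ suc k + suc k * z) (sym (*-identityʳ (suc k ^ k))) ⟩
  suc k ^ suc k + suc k * (suc k ^ k * 1) ≤⟨ bernoulli k (suc k) 1 ⟩
  (suc k + 1) ^ suc k ≡⟨ cong (_^ suc k) (+-comm (suc k) 1) ⟩
  suc (suc k) ^ suc k ∎
  where
  open ≤-Reasoning
  eq : ∀ x → 2 * x ≡ x + x
  eq = solve-∀

module Main (B p g' M y h c : ℕ) (0<B : 0 < B)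
  (g-eq : suc g' ≡ 2 * (4 * B)) (p-eq : p + 2 ≡ 4 * B) (0<M : 0 < M) (M-eq : M ≡ 3 * p)
  (y-large : 120 * suc M * B ≤ y) (decay : g' ^ h * y ≤ suc g' ^ h) where

  -- The constants occurring in `S-small` and `SL-small`, each to be absorbed by one factor `q`.
  threshold₁ threshold₂ : ℕ
  threshold₁ = B * (8 * B * (suc y + 1) + 1) * (y * y)
  threshold₂ = 4 * y * (M * (8 + 2 * c)) * suc y * B

  0<y : 0 < y
  0<y = ≤-trans (*-mono-< {0} {120 * suc M} {0} {B} z<s 0<B) y-large

  module Sized {n N : ℕ} (G : Digraph N) (T' : OrientedTree n) (r₀ q : ℕ)
    (N-eq : n + r₀ ≡ N) (slack : N ≤ B * r₀) (N≤ : N ≤ c * n)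
    (non-neighbours : ∀ d a → 2 * card (λ v → not (nbr G d a v)) ≤ n)
    (q^8≤n : q ^ 8 ≤ n) (n≤ : n ≤ suc q ^ 8) (0<q : 0 < q)
    (q≥₁ : threshold₁ ≤ q) (q≥₂ : threshold₂ ≤ q) (q≥y : y ≤ q)
    (degree : suc (Δ T') ^ (suc h * 4) ≤ n) where

    private
      D F m S ℓ L X : ℕ
      D = Δ T'
      F = suc D ^ suc h
      -- Makes the ball of `h` levels at most the fraction 1/y of a piece.
      m = y * suc D ^ h
      S = suc (D * m)
      -- Then 2 N ≤ 2^ℓ, because n ≤ (q + 1)^8 ≤ 2^(8 q) and N ≤ c n. The factor `M` in `L` gives (1
      -- + 1/M)^L ≥ 2^ℓ.
      ℓ = 8 * q + 2 * c
      L = M * ℓ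
      -- The charges sum to at most n + m ≤ 2 n, whence (1 + 1/X)^t ≤ 1 + 1/M throughout.
      X = 2 * n * suc M

    0<n : 0 < n
    0<n = ≤-trans (0<^ {q} 8 0<q) q^8≤n

    n≤N : n ≤ N
    n≤N = subst (n ≤_) N-eq (m≤m+n n r₀)

    from-n : ∀ {z} → B * z ≤ n → z ≤ r₀
    from-n {z} le = *-cancelˡ-≤ B ⦃ >-nonZero 0<B ⦄ (≤-trans le (≤-trans n≤N slack))

    open ≤-Reasoning

    F⁴≤n : F * F * (F * F) ≤ n
    F⁴≤n = ≤-trans (≤-reflexive (trans (eq F) (^-*-assoc (suc D) (suc h) 4))) degree
      where
      eq : ∀ x → x * x * (x * x) ≡ x * (x * (x * (x * 1)))
      eq = solve-∀

    q⁸ : q * q * (q * q) * (q * q * (q * q)) ≤ n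
    q⁸ = ≤-trans (≤-reflexive (eq q)) q^8≤n
      where
      eq : ∀ x → x * x * (x * x) * (x * x * (x * x)) ≡ x * (x * (x * (x * (x * (x * (x * (x * 1)))))))
      eq = solve-∀

    -- With q ≤ n^(1/8) and F ≤ n^(1/4) the product is at most n^(1/2); fourth powers avoid the
    -- fractional exponents.
    qqF≤n : q * q * F ≤ n
    qqF≤n = ≤-trans (x≤x*x (q * q * F)) (square-cancel (begin
      q * q * F * (q * q * F) * (q * q * F * (q * q * F)) ≡⟨ eq q F ⟩
      q * q * (q * q) * (q * q * (q * q)) * (F * F * (F * F)) ≤⟨ *-mono-≤ q⁸ F⁴≤n ⟩
      n * n ∎))
      where
      eq : ∀ q f → q * q * f * (q * q * f) * (q * q * f * (q * q * f)) ≡ q * q * (q * q) * (q * q * (q * q)) * (f * f * (f * f))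
      eq = solve-∀

    qFF≤n : q * (F * F) ≤ n
    qFF≤n = square-cancel (begin
      q * (F * F) * (q * (F * F)) ≡⟨ eq q F ⟩
      q * q * (F * F * (F * F)) ≤⟨ *-mono-≤ (≤-trans (≤-trans (x≤x*x (q * q)) (x≤x*x _)) q⁸) F⁴≤n ⟩
      n * n ∎)
      where
      eq : ∀ q f → q * (f * f) * (q * (f * f)) ≡ q * q * (f * f * (f * f))
      eq = solve-∀

    0<m : 0 < m
    0<m = *-mono-< 0<y (0<^ {suc D} h z<s)

    S≤ : S ≤ y * F
    S≤ = begin
      suc (D * m) ≤⟨ +-monoˡ-≤ (D * m) 0<m ⟩
      m + D * m ≡⟨ eq y (suc D ^ h) D ⟩
      y * F ∎
      where
      eq : ∀ y x D → y * x + D * (y * x) ≡ y * ((1 + D) * x)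
      eq = solve-∀

    m≤n : m ≤ n
    m≤n = begin
      y * suc D ^ h ≤⟨ *-mono-≤ (≤-trans q≥y (x≤x*x q)) (m≤n*m (suc D ^ h) (suc D)) ⟩
      q * q * F ≤⟨ qqF≤n ⟩
      n ∎

    ℓ≤ : ℓ ≤ (8 + 2 * c) * q
    ℓ≤ = begin
      8 * q + 2 * c ≤⟨ +-monoʳ-≤ (8 * q) (≤-trans (≤-reflexive (sym (*-identityʳ (2 * c)))) (*-monoʳ-≤ (2 * c) 0<q)) ⟩
      8 * q + 2 * c * q ≡⟨ *-distribʳ-+ q 8 (2 * c) ⟨
      (8 + 2 * c) * q ∎

    S-small : 8 * B * (S * S * suc y + S) < r₀
    S-small = from-n (begin
      B * suc (8 * B * (S * S * suc y + S))
        ≤⟨ *-monoʳ-≤ B (+-mono-≤ {1} {S * S} (≤-trans (s≤s z≤n) (x≤x*x S)) (*-monoʳ-≤ (8 * B) (+-monoʳ-≤ (S * S * suc y) (x≤x*x S)))) ⟩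
      B * (S * S + 8 * B * (S * S * suc y + S * S)) ≡⟨ eq₁ B S (suc y) ⟩
      B * (8 * B * (suc y + 1) + 1) * (S * S) ≤⟨ *-monoʳ-≤ (B * (8 * B * (suc y + 1) + 1)) (*-mono-≤ S≤ S≤) ⟩
      B * (8 * B * (suc y + 1) + 1) * (y * F * (y * F)) ≡⟨ eq₂ (B * (8 * B * (suc y + 1) + 1)) y F ⟩
      threshold₁ * (F * F) ≤⟨ *-monoˡ-≤ (F * F) q≥₁ ⟩
      q * (F * F) ≤⟨ qFF≤n ⟩
      n ∎)
      where
      eq₁ : ∀ B S z → B * (S * S + 8 * B * (S * S * z + S * S)) ≡ B * (8 * B * (z + 1) + 1) * (S * S)
      eq₁ = solve-∀
      eq₂ : ∀ k y f → k * (y * f * (y * f)) ≡ k * (y * y) * (f * f)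
      eq₂ = solve-∀

    SL-small : 4 * S * L * suc y ≤ r₀
    SL-small = from-n (begin
      B * (4 * S * (M * ℓ) * suc y) ≡⟨ eq₁ B S M ℓ (suc y) ⟩
      4 * M * suc y * B * (S * ℓ) ≤⟨ *-monoʳ-≤ (4 * M * suc y * B) (*-mono-≤ S≤ ℓ≤) ⟩
      4 * M * suc y * B * (y * F * ((8 + 2 * c) * q)) ≡⟨ eq₂ M (suc y) B y F (8 + 2 * c) q ⟩
      threshold₂ * (q * F) ≤⟨ *-monoˡ-≤ (q * F) q≥₂ ⟩
      q * (q * F) ≡⟨ *-assoc q q F ⟨
      q * q * F ≤⟨ qqF≤n ⟩
      n ∎)
      where
      eq₁ : ∀ B S M l z → B * (4 * S * (M * l) * z) ≡ 4 * M * z * B * (S * l)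
      eq₁ = solve-∀
      eq₂ : ∀ M z B y f k q → 4 * M * z * B * (y * f * (k * q)) ≡ 4 * y * (M * k) * z * B * (q * f)
      eq₂ = solve-∀

    0<L : 0 < L
    0<L = *-mono-< 0<M (≤-trans (*-mono-< {0} {8} z<s 0<q) (m≤m+n (8 * q) (2 * c)))

    6S : 6 * S ≤ r₀
    6S = begin
      6 * S ≤⟨ *-monoˡ-≤ S 6≤8 ⟩
      8 * S ≡⟨ eq S ⟩
      4 * S * 1 * 2 ≤⟨ *-mono-≤ (*-monoʳ-≤ (4 * S) 0<L) (s≤s 0<y) ⟩
      4 * S * L * suc y ≤⟨ SL-small ⟩
      r₀ ∎
      where
      6≤8 : 6 ≤ 8
      6≤8 = s≤s (s≤s (s≤s (s≤s (s≤s (s≤s z≤n)))))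
      eq : ∀ S → 8 * S ≡ 4 * S * 1 * 2
      eq = solve-∀

    X-small : 60 * X ≤ r₀ * y
    X-small = begin
      60 * (2 * n * suc M) ≡⟨ eq₁ n (suc M) ⟩
      120 * suc M * n ≤⟨ *-monoʳ-≤ (120 * suc M) (≤-trans n≤N slack) ⟩
      120 * suc M * (B * r₀) ≡⟨ eq₂ (120 * suc M) B r₀ ⟩
      r₀ * (120 * suc M * B) ≤⟨ *-monoʳ-≤ r₀ y-large ⟩
      r₀ * y ∎
      where
      eq₁ : ∀ n z → 60 * (2 * n * z) ≡ 120 * z * n
      eq₁ = solve-∀
      eq₂ : ∀ k B r → k * (B * r) ≡ r * (k * B)
      eq₂ = solve-∀

    2N≤2^ℓ : 2 * N ≤ 2 ^ ℓ
    2N≤2^ℓ = begin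
      2 * N ≤⟨ *-monoʳ-≤ 2 N≤ ⟩
      2 * (c * n) ≡⟨ eq c n ⟩
      n * (2 * c) ≤⟨ *-mono-≤ (≤-trans n≤ (^-monoˡ-≤ 8 (n<2^n q))) (<⇒≤ (n<2^n (2 * c))) ⟩
      (2 ^ q) ^ 8 * 2 ^ (2 * c) ≡⟨ cong (_* 2 ^ (2 * c)) (trans (^-*-assoc 2 q 8) (cong (2 ^_) (*-comm q 8))) ⟩
      2 ^ (8 * q) * 2 ^ (2 * c) ≡⟨ ^-distribˡ-+-* 2 (8 * q) (2 * c) ⟨
      2 ^ ℓ ∎
      where
      eq : ∀ c n → 2 * (c * n) ≡ n * (2 * c)
      eq = solve-∀

    2N-M : 2 * N * M ^ L ≤ suc M ^ L
    2N-M = begin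
      2 * N * M ^ (M * ℓ) ≤⟨ *-monoˡ-≤ (M ^ L) 2N≤2^ℓ ⟩
      2 ^ ℓ * M ^ (M * ℓ) ≡⟨ cong (2 ^ ℓ *_) (^-*-assoc M M ℓ) ⟨
      2 ^ ℓ * (M ^ M) ^ ℓ ≡⟨ ^-distribʳ-* ℓ 2 (M ^ M) ⟨
      (2 * M ^ M) ^ ℓ ≤⟨ ^-monoˡ-≤ ℓ (doubling M 0<M) ⟩
      (suc M ^ M) ^ ℓ ≡⟨ ^-*-assoc (suc M) M ℓ ⟩
      suc M ^ (M * ℓ) ∎

    0<p : 0 < p
    0<p = case 0 <? p of λ
      { (yes z) → z
      ; (no ¬z) → ⊥-elim (<⇒≱ 0<M (≤-reflexive (trans M-eq (cong (3 *_) (n≤0⇒n≡0 (≮⇒≥ ¬z)))))) }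

    -- (1 + 1/M)² ≤ 1 + 1/p for M = 3p
    two-steps : p * (suc M * suc M) ≤ suc p * (M * M)
    two-steps = begin
      p * (suc M * suc M) ≡⟨ cong (λ z → p * (suc z * suc z)) M-eq ⟩
      p * (suc (3 * p) * suc (3 * p)) ≡⟨ eq₁ p ⟩
      9 * (p * (p * p)) + 6 * (p * p) + p ≤⟨ +-monoʳ-≤ (9 * (p * (p * p)) + 6 * (p * p))
        (≤-trans (x≤x*x p) (m≤n*m (p * p) 3)) ⟩
      9 * (p * (p * p)) + 6 * (p * p) + 3 * (p * p) ≡⟨ eq₂ p ⟩
      suc p * (3 * p * (3 * p)) ≡⟨ cong (λ z → suc p * (z * z)) M-eq ⟨
      suc p * (M * M) ∎
      where
      eq₁ : ∀ p → p * ((1 + 3 * p) * (1 + 3 * p)) ≡ 9 * (p * (p * p)) + 6 * (p * p) + p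
      eq₁ = solve-∀
      eq₂ : ∀ p → 9 * (p * (p * p)) + 6 * (p * p) + 3 * (p * p) ≡ (1 + p) * (3 * p * (3 * p))
      eq₂ = solve-∀

    drift : ∀ t → t ≤ n + m → suc X ^ t * M ≤ suc M * X ^ t
    drift t t≤ = subst (λ z → z ^ t * M ≤ suc M * X ^ t) (+-comm X 1)
      (pow-ratio t X 1 M (m≤n+m 1 X) (begin
        t * 1 * suc M ≡⟨ cong (_* suc M) (*-identityʳ t) ⟩
        t * suc M ≤⟨ *-monoˡ-≤ (suc M) (≤-trans t≤ (+-monoʳ-≤ n (≤-trans m≤n (m≤m+n n 0)))) ⟩
        2 * n * suc M ≤⟨ m≤m+n X 1 ⟩
        X + 1 ∎))

    -- Since (1 + 1/M)^2 ≤ 1 + 1/p, there are two factors (1 + 1/M)^L to spend: one on the 2 N terms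
    -- of the potential, one on its drift.
    growth : ∀ t → t ≤ n + m → 2 * N * (p ^ L * suc X ^ (L * t)) ≤ suc p ^ L * X ^ (L * t)
    growth t t≤ = *-cancelʳ-≤ _ _ (M ^ L * M ^ L) ⦃ >-nonZero (*-mono-< (0<^ {M} L 0<M) (0<^ {M} L 0<M)) ⦄ (begin
      2 * N * (p ^ L * suc X ^ (L * t)) * (M ^ L * M ^ L) ≡⟨ eq₁ (2 * N) (p ^ L) (suc X ^ (L * t)) (M ^ L) ⟩
      2 * N * M ^ L * (p ^ L * (suc X ^ (L * t) * M ^ L))
        ≤⟨ *-mono-≤ 2N-M (*-monoʳ-≤ (p ^ L) (begin
             suc X ^ (L * t) * M ^ L ≡⟨ cong (_* M ^ L) (swap (suc X)) ⟩
             (suc X ^ t) ^ L * M ^ L ≡⟨ ^-distribʳ-* L (suc X ^ t) M ⟨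
             (suc X ^ t * M) ^ L ≤⟨ ^-monoˡ-≤ L (drift t t≤) ⟩
             (suc M * X ^ t) ^ L ≡⟨ ^-distribʳ-* L (suc M) (X ^ t) ⟩
             suc M ^ L * (X ^ t) ^ L ≡⟨ cong (suc M ^ L *_) (swap X) ⟨
             suc M ^ L * X ^ (L * t) ∎)) ⟩
      suc M ^ L * (p ^ L * (suc M ^ L * X ^ (L * t))) ≡⟨ eq₂ (suc M ^ L) (p ^ L) (X ^ (L * t)) ⟩
      p ^ L * (suc M ^ L * suc M ^ L) * X ^ (L * t)
        ≡⟨ cong (_* X ^ (L * t)) (trans (cong (p ^ L *_) (sym (^-distribʳ-* L (suc M) (suc M)))) (sym (^-distribʳ-* L p (suc M * suc M)))) ⟩
      (p * (suc M * suc M)) ^ L * X ^ (L * t) ≤⟨ *-monoˡ-≤ (X ^ (L * t)) (^-monoˡ-≤ L two-steps) ⟩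
      (suc p * (M * M)) ^ L * X ^ (L * t)
        ≡⟨ cong (_* X ^ (L * t)) (trans (^-distribʳ-* L (suc p) (M * M)) (cong (suc p ^ L *_) (^-distribʳ-* L M M))) ⟩
      suc p ^ L * (M ^ L * M ^ L) * X ^ (L * t) ≡⟨ eq₃ (suc p ^ L) (M ^ L * M ^ L) (X ^ (L * t)) ⟩
      suc p ^ L * X ^ (L * t) * (M ^ L * M ^ L) ∎)
      where
      swap : ∀ Z → Z ^ (L * t) ≡ (Z ^ t) ^ L
      swap Z = trans (cong (Z ^_) (*-comm L t)) (sym (^-*-assoc Z t L))
      eq₁ : ∀ k p x m → k * (p * x) * (m * m) ≡ k * m * (p * (x * m))
      eq₁ = solve-∀
      eq₂ : ∀ s p x → s * (p * (s * x)) ≡ p * (s * s) * x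
      eq₂ = solve-∀
      eq₃ : ∀ a b c → a * b * c ≡ a * c * b
      eq₃ = solve-∀

    contains : Contains G T'
    contains = assemble (pred L) (suc-pred L ⦃ >-nonZero 0<L ⦄)
      where
      assemble : ∀ l → suc l ≡ L → Contains G T'
      assemble l l-eq =
        let z , hom , simple = Embedding.embed-tree n G r₀ S m D N-eq refl 0<N Invariant initial
              (λ t σ U a d x sub → tree-step t σ U a d x sub)
              root forest size-forest branching roots≤
        in hom⇒contains R z hom simple
        where
        R = Read.reading T' (fromℕ< 0<n) (pred n) (suc-pred n ⦃ >-nonZero 0<n ⦄)
        open Reading R
        open TreeStep n G B p r₀ S m l y g' h D X (n + m) 0<B 0<y z<s
          (*-mono-< {0} {2 * n} {0} {suc M} (*-mono-< {0} {2} z<s 0<n) z<s)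
          g-eq p-eq N-eq slack non-neighbours decay
          (*-monoʳ-≤ y (ballSize≤ D h))
          S-small
          (subst (λ k → 4 * S * k * suc y ≤ r₀) (sym l-eq) SL-small) 6S X-small
          (subst (λ k → ∀ t → t ≤ n + m → 2 * N * (p ^ k * suc X ^ (k * t)) ≤ suc p ^ k * X ^ (k * t)) (sym l-eq) growth)

  private
    k C : ℕ
    k = suc h * 4
    C = suc (threshold₁ + threshold₂ + y)

  -- The 2 in `K₀` pays for `suc d ≤ d ^ 2`. In `n₀`, the summand `C ^ 8` forces `C ≤ q`, and
  -- `3 ^ k` settles d ≤ 2.
  K₀ n₀ : ℕ
  K₀ = 2 * k
  n₀ = C ^ 8 + 3 ^ k

  -- For d ≥ 3 one has 1 < log d, and the degree bound at this rational reads d^K ≤ n.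
  degree-power : ∀ K n d → K₀ ≤ K → 3 ^ k ≤ n → DegBound K n d → suc d ^ k ≤ n
  degree-power K n d K≥ n≥ bound with 3 ≤? d
  ... | no ¬3≤d = ≤-trans (^-monoˡ-≤ k (≰⇒> ¬3≤d)) n≥
  ... | yes 3≤d = begin
    suc d ^ k ≤⟨ ^-monoˡ-≤ k suc-d≤ ⟩
    (d ^ 2) ^ k ≡⟨ ^-*-assoc d 2 k ⟩
    d ^ (2 * k) ≤⟨ ^-monoʳ-≤ d ⦃ >-nonZero 0<d ⦄ K≥ ⟩
    d ^ K ≡⟨ cong (d ^_) (*-identityʳ K) ⟨
    d ^ (K * 1) ≤⟨ bound 1 1 ≤-refl exp<3 ⟩
    n ^ 1 ≡⟨ *-identityʳ n ⟩
    n ∎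
    where
    open ≤-Reasoning
    0<d : 0 < d
    0<d = ≤-trans z<s 3≤d
    suc-d≤ : suc d ≤ d ^ 2
    suc-d≤ = begin
      1 + d ≤⟨ +-monoˡ-≤ d 0<d ⟩
      d + d ≡⟨ cong (d +_) (+-identityʳ d) ⟨
      2 * d ≤⟨ *-monoˡ-≤ d (≤-trans (n≤1+n 2) 3≤d) ⟩
      d * d ≡⟨ cong (d *_) (*-identityʳ d) ⟨
      d ^ 2 ∎
    -- e < (1 + 1/5)⁶ < 3
    exp<3 : ExpLt 1 1 d
    exp<3 = 5 , s≤s z≤n , (begin-strict
      6 ^ 6 <⟨ <ᵇ⇒< (6 ^ 6) (3 * 5 ^ 6) tt ⟩
      3 * 5 ^ 6 ≤⟨ *-monoˡ-≤ (5 ^ 6) 3≤d ⟩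
      d * 5 ^ 6 ≡⟨ cong (_* 5 ^ 6) (*-identityʳ d) ⟨
      d ^ 1 * 5 ^ 6 ∎)

  contains-tree : ∀ K → K₀ ≤ K → ∀ n → n₀ ≤ n → ∀ {N} (G : Digraph N) r₀ →
    n + r₀ ≡ N → N ≤ B * r₀ → N ≤ c * n →
    (∀ d a → 2 * card (λ v → not (nbr G d a v)) ≤ n) →
    (T' : OrientedTree n) → DegBound K n (Δ T') → Contains G T'
  contains-tree K K≥ n n≥ G r₀ N-eq slack N≤ non-nbrs T' bound =
    let q , q^8≤n , n< = floor-root 7 n
        C≤q = ≮⇒≥ λ q<C → <⇒≱ n< (≤-trans (^-monoˡ-≤ 8 q<C) (m+n≤o⇒m≤o (C ^ 8) n≥))
        ths≤q = ≤-trans (n≤1+n _) C≤q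
    in Sized.contains G T' r₀ q N-eq slack N≤ non-nbrs q^8≤n (<⇒≤ n<)
         (≤-trans z<s C≤q)
         (≤-trans (≤-trans (m≤m+n threshold₁ threshold₂) (m≤m+n _ y)) ths≤q)
         (≤-trans (≤-trans (m≤n+m threshold₂ threshold₁) (m≤m+n _ y)) ths≤q)
         (≤-trans (m≤n+m y _) ths≤q)
         (degree-power K n (Δ T') K≥ (m+n≤o⇒n≤o (C ^ 8) n≥) bound)

-- From rational to natural hypotheses

toℚᵘ-ℕ : ∀ n → toℚᵘ (ℕtoℚ n) ≃ mkℚᵘ (ℤ.+ n) 0
toℚᵘ-ℕ n = ℚ.toℚᵘ-fromℚᵘ (mkℚᵘ (ℤ.+ n) 0)

+-fractions : ∀ x d z e → mkℚᵘ (ℤ.+ x) d ℚᵘ.+ mkℚᵘ (ℤ.+ z) e ≡ mkℚᵘ (ℤ.+ (x * suc e + z * suc d)) (e + d * suc e)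
+-fractions x d z e = cong (λ i → mkℚᵘ i (e + d * suc e))
  (trans (cong₂ ℤ._+_ (sym (ℤ.pos-* x (suc e))) (sym (ℤ.pos-* z (suc d)))) (sym (ℤ.pos-+ (x * suc e) (z * suc d))))

*-fractions : ∀ x d z e → mkℚᵘ (ℤ.+ x) d ℚᵘ.* mkℚᵘ (ℤ.+ z) e ≡ mkℚᵘ (ℤ.+ (x * z)) (e + d * suc e)
*-fractions x d z e = cong (λ i → mkℚᵘ i (e + d * suc e)) (sym (ℤ.pos-* x z))

≃-fractions : ∀ {x d z e} → mkℚᵘ (ℤ.+ x) d ≃ mkℚᵘ (ℤ.+ z) e → x * suc e ≡ z * suc d
≃-fractions {x} {d} {z} {e} (*≡* h) =
  ℤ.+-injective (trans (ℤ.pos-* x (suc e)) (trans h (sym (ℤ.pos-* z (suc d)))))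

≤-fractions : ∀ {x d z e} → mkℚᵘ (ℤ.+ x) d ℚᵘ.≤ mkℚᵘ (ℤ.+ z) e → x * suc e ≤ z * suc d
≤-fractions {x} {d} {z} {e} (*≤* h) =
  ℤ.drop‿+≤+ (subst₂ ℤ._≤_ (sym (ℤ.pos-* x (suc e))) (sym (ℤ.pos-* z (suc d))) h)

module Rational (a' b' : ℕ) .(cop : Coprime (suc a') (suc b')) where

  α₀ : ℚ
  α₀ = mkℚ (ℤ.+ suc a') b' cop

  private
    a b : ℕ
    a = suc a'
    b = suc b'

  -- Applied with β = 1 to the order and β = 1/2 to the semidegree. The denominator keeps the shape
  -- in which unnormalised arithmetic produces it.
  scaled-fraction : ∀ β x d → toℚᵘ β ≡ mkℚᵘ (ℤ.+ x) d → ∀ n →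
    toℚᵘ ((β ℚ.+ α₀) ℚ.* ℕtoℚ n) ≃ mkℚᵘ (ℤ.+ ((x * b + a * suc d) * n)) (0 + (b' + d * b) * 1)
  scaled-fraction β x d e n = begin-equality
    toℚᵘ ((β ℚ.+ α₀) ℚ.* ℕtoℚ n) ≃⟨ ℚ.toℚᵘ-homo-* (β ℚ.+ α₀) (ℕtoℚ n) ⟩
    toℚᵘ (β ℚ.+ α₀) ℚᵘ.* toℚᵘ (ℕtoℚ n) ≃⟨ ℚᵘ.*-cong (ℚ.toℚᵘ-homo-+ β α₀) (toℚᵘ-ℕ n) ⟩
    (toℚᵘ β ℚᵘ.+ mkℚᵘ (ℤ.+ a) b') ℚᵘ.* mkℚᵘ (ℤ.+ n) 0 ≡⟨ cong (λ p → (p ℚᵘ.+ mkℚᵘ (ℤ.+ a) b') ℚᵘ.* mkℚᵘ (ℤ.+ n) 0) e ⟩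
    (mkℚᵘ (ℤ.+ x) d ℚᵘ.+ mkℚᵘ (ℤ.+ a) b') ℚᵘ.* mkℚᵘ (ℤ.+ n) 0
      ≡⟨ cong (ℚᵘ._* mkℚᵘ (ℤ.+ n) 0) (+-fractions x d a b') ⟩
    mkℚᵘ (ℤ.+ (x * b + a * suc d)) (b' + d * b) ℚᵘ.* mkℚᵘ (ℤ.+ n) 0
      ≡⟨ *-fractions (x * b + a * suc d) (b' + d * b) n 0 ⟩
    mkℚᵘ (ℤ.+ ((x * b + a * suc d) * n)) (0 + (b' + d * b) * 1) ∎
    where open ℚᵘ.≤-Reasoning

  module Hypotheses {n N : ℕ} (G : Digraph N) (order : ℕtoℚ N ≡ (1ℚ ℚ.+ α₀) ℚ.* ℕtoℚ n)
    (semidegree : MinSemidegreeAtLeast G ((½ ℚ.+ α₀) ℚ.* ℕtoℚ n)) where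

    bN : b * N ≡ (b + a) * n
    bN = trans (eq₁ b' N) (trans (≃-fractions (ℚᵘ.≃-trans (ℚᵘ.≃-sym (toℚᵘ-ℕ N))
      (ℚᵘ.≃-trans (ℚ.toℚᵘ-cong order) (scaled-fraction 1ℚ 1 0 refl n)))) (eq₂ a' b' n))
      where
      eq₁ : ∀ b' N → (1 + b') * N ≡ N * (1 + (b' + 0 * (1 + b')) * 1)
      eq₁ = solve-∀
      eq₂ : ∀ a' b' n → (1 * (1 + b') + (1 + a') * 1) * n * 1 ≡ (1 + b' + (1 + a')) * n
      eq₂ = solve-∀

    degree≥ : ∀ d v → (b + 2 * a) * n ≤ 2 * b * card (nbr G d v)
    degree≥ d v = subst₂ _≤_ (eq₁ a' b' n) (eq₂ b' (card (nbr G d v)))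
      (≤-fractions (ℚᵘ.≤-trans (ℚᵘ.≤-reflexive (ℚᵘ.≃-sym (scaled-fraction ½ 1 1 refl n)))
        (ℚᵘ.≤-trans (ℚ.toℚᵘ-mono-≤ (deg d)) (ℚᵘ.≤-reflexive (toℚᵘ-ℕ (card (nbr G d v)))))))
      where
      eq₁ : ∀ a' b' n → (1 * (1 + b') + (1 + a') * 2) * n * 1 ≡ (1 + b' + 2 * (1 + a')) * n
      eq₁ = solve-∀
      eq₂ : ∀ b' x → x * (1 + (b' + 1 * (1 + b')) * 1) ≡ 2 * (1 + b') * x
      eq₂ = solve-∀
      deg : ∀ d → (½ ℚ.+ α₀) ℚ.* ℕtoℚ n ℚ.≤ ℕtoℚ (card (nbr G d v))
      deg true = subst (λ k → (½ ℚ.+ α₀) ℚ.* ℕtoℚ n ℚ.≤ ℕtoℚ k) (count≡card (nbr G true v)) (proj₁ (semidegree v))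
      deg false = subst (λ k → (½ ℚ.+ α₀) ℚ.* ℕtoℚ n ℚ.≤ ℕtoℚ k) (count≡card (nbr G false v)) (proj₂ (semidegree v))

    r₀ : ℕ
    r₀ = N ∸ n

    N-eq : n + r₀ ≡ N
    N-eq = m+[n∸m]≡n (*-cancelˡ-≤ b (≤-trans (*-monoˡ-≤ n (m≤m+n b a)) (≤-reflexive (sym bN))))

    br₀ : b * r₀ ≡ a * n
    br₀ = +-cancelˡ-≡ (b * n) _ _ (begin
      b * n + b * r₀ ≡⟨ *-distribˡ-+ b n r₀ ⟨
      b * (n + r₀) ≡⟨ cong (b *_) N-eq ⟩
      b * N ≡⟨ bN ⟩
      (b + a) * n ≡⟨ *-distribʳ-+ n b a ⟩
      b * n + a * n ∎)
      where open ≡-Reasoning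

    open ≤-Reasoning

    -- `r₀` is α n = a n / b, and a ≥ 1 gives n ≤ b r₀; hence the choice B = b + 1.
    slack : N ≤ suc b * r₀
    slack = begin
      N ≡⟨ N-eq ⟨
      n + r₀ ≤⟨ +-monoˡ-≤ r₀ (≤-trans (m≤n*m n a) (≤-reflexive (sym br₀))) ⟩
      b * r₀ + r₀ ≡⟨ +-comm (b * r₀) r₀ ⟩
      suc b * r₀ ∎

    N≤ : N ≤ suc a * n
    N≤ = begin
      N ≡⟨ N-eq ⟨
      n + r₀ ≤⟨ +-monoʳ-≤ n (≤-trans (m≤n*m r₀ b) (≤-reflexive br₀)) ⟩
      suc a * n ∎

    -- The two α cancel: (1 + α) n - (1/2 + α) n = n/2.
    non-neighbours : ∀ d v → 2 * card (λ w → not (nbr G d v w)) ≤ n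
    non-neighbours d v = *-cancelˡ-≤ b (lin (degree≥ d v) (≤-reflexive (begin-equality
      b * (2 * q) + 2 * b * card (nbr G d v) ≡⟨ eq₁ b q (card (nbr G d v)) ⟩
      2 * (b * (card (nbr G d v) + q)) ≡⟨ cong (λ z → 2 * (b * z)) (trans (sym (card-split (λ _ → true) (nbr G d v))) (trans (sum-const N 1) (*-identityʳ N))) ⟩
      2 * (b * N) ≡⟨ cong (2 *_) bN ⟩
      2 * ((b + a) * n) ≡⟨ eq₂ a b n ⟩
      b * n + (b + 2 * a) * n ∎)))
      where
      q = card (λ w → not (nbr G d v w))
      eq₁ : ∀ b q x → b * (2 * q) + 2 * b * x ≡ 2 * (b * (x + q))
      eq₁ = solve-∀
      eq₂ : ∀ a b n → 2 * ((b + a) * n) ≡ b * n + (b + 2 * a) * n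
      eq₂ = solve-∀

  private
    g' p M y : ℕ
    -- In terms of B = b + 1 these are 8 B - 1 and 4 B - 2; `y` is the least value that `y-large`
    -- admits.
    g' = 8 * b + 7
    p = 4 * b + 2
    M = 3 * p
    y = 120 * suc M * suc b

    g-eq : ∀ b → suc (8 * b + 7) ≡ 2 * (4 * suc b)
    g-eq b = eq b
      where
      eq : ∀ b → 1 + (8 * b + 7) ≡ 2 * (4 * (1 + b))
      eq = solve-∀

    p-eq : ∀ b → 4 * b + 2 + 2 ≡ 4 * suc b
    p-eq b = eq b
      where
      eq : ∀ b → 4 * b + 2 + 2 ≡ 4 * (1 + b)
      eq = solve-∀

    0<p : 0 < p
    0<p = ≤-trans z<s (m≤n+m 2 (4 * b))

  module Constants = Main (suc b) p g' M y (g' * y) (suc a) z<s (g-eq b) (p-eq b)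
    (*-mono-< {0} {3} {0} {p} z<s 0<p) refl ≤-refl
    (decay-exponent g' y (≤-trans z<s (m≤n+m 7 (8 * b))) (*-mono-< {0} {120 * suc M} {0} {suc b} z<s z<s))

theorem1p8 : ∀ (α : ℚ) → 0ℚ ℚ.< α →
    Σ ℚ λ λ₀ → 0ℚ ℚ.< λ₀ × (∀ (λ' : ℚ) → 0ℚ ℚ.< λ' → λ' ℚ.< λ₀ →
    Σ ℕ λ K₀ → ∀ (K : ℕ) → K₀ Data.Nat.≤ K →
    Σ ℕ λ n₀ → ∀ (n : ℕ) → n₀ Data.Nat.≤ n →
    ∀ (N : ℕ) (G : Digraph N) → ℕtoℚ N ≡ (1ℚ ℚ.+ α) ℚ.* ℕtoℚ n →
    MinSemidegreeAtLeast G ((½ ℚ.+ α) ℚ.* ℕtoℚ n) →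
    ∀ (T' : OrientedTree n) → DegBound K n (Δ T') → Contains G T')
theorem1p8 (mkℚ (ℤ.+ zero) _ _) (*<* (ℤ.+<+ ()))
theorem1p8 (mkℚ -[1+ _ ] _ _) (*<* ())
theorem1p8 (mkℚ (ℤ.+ suc a') b' cop) _ = 1ℚ , *<* (ℤ.+<+ z<s) , λ _ _ _ →
  K₀ , λ K K≥ → n₀ , λ n n≥ N G order semidegree T' bound →
    contains K K≥ n n≥ G order semidegree T' bound
  where
  open Rational a' b' cop
  open Constants
  contains : ∀ K → K₀ Data.Nat.≤ K → ∀ n → n₀ Data.Nat.≤ n → ∀ {N} (G : Digraph N) →
    ℕtoℚ N ≡ (1ℚ ℚ.+ α₀) ℚ.* ℕtoℚ n → MinSemidegreeAtLeast G ((½ ℚ.+ α₀) ℚ.* ℕtoℚ n) →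
    ∀ T' → DegBound K n (Δ T') → Contains G T'
  contains K K≥ n n≥ {N} G order semidegree = contains-tree K K≥ n n≥ G r₀ N-eq slack N≤ non-neighbours
    where
    open Hypotheses {n} {N} G order semidegree
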